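{- Let $n\ge2$ and let $\lambda$ be a Young diagram with $\ell(\lambda)<n$. Suppose that $\gcd(n,|\lambda|)=1$ and that $\mathsf{s}_i\cdot\mathsf{pr}^n=\mathsf{pr}^n\cdot\mathsf{s}_i$ on $\mathsf{SST}_n(\lambda)$ for all $i\in\{1,\dots,n-1\}$. Then the following hold. (1) For every $T\in\mathsf{SST}_n(\lambda)$, $|\mathcal{O}_{\mathsf{pr}}(T)|=|\mathcal{O}_{\mathsf{C}\times\mathsf{P}}(T)|$, where $\mathcal{O}_{\mathsf{pr}}(T)=\{\mathsf{pr}^k(T)\mid k\in\mathbb{Z}_{\ge0}\}$ and $\mathcal{O}_{\mathsf{C}\times\mathsf{P}}(T)=\{\mathsf{c}^a\,\mathsf{pr}^{bn}(T)\mid a,b\in\mathbb{Z}_{\ge0}\}$. (2) For $\alpha\in\mathbb{Z}_{\ge0}^n$ with $\mathsf{SST}_n(\lambda,\alpha)\ne\emptyset$, let $\mathfrak{o}_\lambda(\alpha)$ be the order of the restriction of $\mathsf{pr}^n$ to $\mathsf{SST}_n(\lambda,\alpha)$. Then the order of $\mathsf{pr}$ on $\mathsf{SST}_n(\lambda)$ equals $n\cdot\mathrm{lcm}\{\mathfrak{o}_\lambda(\alpha)\mid\alpha\in\mathrm{cont}^+(\lambda)\}$.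
   Context: Partitions are identified with Young diagrams (English convention); $\ell(\lambda)$ is the number of positive parts and $|\lambda|$ the number of boxes. $\mathsf{SST}_n(\lambda)$ is the set of semistandard tableaux of shape $\lambda$ with entries in $\{1,\dots,n\}$ (rows weakly increasing, columns strictly increasing). The content of $T$ is $\mathrm{cont}(T)=(c_1,\dots,c_n)$ with $c_k$ the number of entries $k$ in $T$; $\mathsf{SST}_n(\lambda,\alpha)=\{T\in\mathsf{SST}_n(\lambda):\mathrm{cont}(T)=\alpha\}$; $\mathrm{cont}(\lambda)$ is the set of contents of all $T\in\mathsf{SST}_n(\lambda)$, and $\mathrm{cont}^+(\lambda)$ is the set of $(a_1,\dots,a_n)\in\mathrm{cont}(\lambda)$ with $a_1\ge a_2\ge\cdots\ge a_n$. Products of operators are compositions, rightmost applied first. Crystal reflections: for $1\le i\le n-1$, $\mathsf{s}_i$ acts on $T\in\mathsf{SST}_n(\lambda)$ as follows. Read the entries row by row, each row left to right, from the bottom row to the top row; regard each $i+1$ as "(" and each $i$ as ")" and match parentheses in the usual way; the unmatched letters form a subword $i^a(i+1)^b$, which $\mathsf{s}_i$ replaces by $i^b(i+1)^a$ in the same positions. (This is the Weyl group action from the standard $U_q(\mathfrak{sl}_n)$-crystal structure; the $\mathsf{s}_i$ define an action of $\mathfrak{S}_n$.) Put $\mathsf{c}=\mathsf{s}_1\mathsf{s}_2\cdots\mathsf{s}_{n-1}$; $\mathsf{C}$ is the cyclic group of order $n$ generated by $\mathsf{c}$ and $\mathsf{P}$ is the cyclic group generated by $\mathsf{pr}^n$;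 under the hypotheses $\mathsf{C}\times\mathsf{P}$ acts on $\mathsf{SST}_n(\lambda)$. Promotion: for $T\in\mathsf{SST}_n(\lambda)$, $\mathsf{pr}(T)$ is obtained as follows. If $T$ has no entry $n$, add 1 to every entry. Otherwise replace each entry $n$ by a dot; process the dots from left to right, and slide each toward the northwest by jeu de taquin: repeatedly exchange the dot with the larger of the (non-dot) entries immediately above and immediately to the left of it (with the one above in case of equality, and with the only one available if just one exists), until there is no non-dot entry above or to the left. Finally add 1 to all remaining entries and replace all dots by 1. $\mathsf{pr}$ is a bijection of $\mathsf{SST}_n(\lambda)$, and $\mathsf{pr}^n$ preserves each $\mathsf{SST}_n(\lambda,\alpha)$. -}

module Defs where

open import Data.Bool using (if_then_else_)
open import Data.Fin using (toℕ)
open import Data.List using (List; []; _∷_; map; concat; reverse; length; take; drop; head;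
  foldl; foldr; filter; upTo; applyUpTo; cartesianProduct)
open import Data.List.Membership.Propositional using () renaming (_∈_ to _∈ˡ_)
open import Data.List.Relation.Binary.Prefix.Heterogeneous using (Prefix)
open import Data.List.Relation.Unary.All using (All)
open import Data.List.Relation.Unary.Linked using (Linked)
open import Data.List.Relation.Unary.Unique.Propositional using (Unique)
open import Data.Maybe using (Maybe; just; nothing; maybe; _>>=_)
open import Data.Maybe.Properties using (≡-dec)
open import Data.Nat using (ℕ; zero; suc; _+_; _*_; _∸_; _≤_; _≥_; _<_; _>_; _⊔_; _≤ᵇ_; _≡ᵇ_; _≟_)
open import Data.Nat.Divisibility using (_∣_)
open import Data.Nat.ListAction using (sum)
open import Data.Product using (_×_; _,_; ∃; ∃-syntax)
open import Data.Vec using (Vec; tabulate)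
import Data.Vec.Relation.Unary.Linked as Vec
open import Function using (_∘_; _⇔_)
import Function.Endo.Propositional as Endo
open import Level using (0ℓ)
open import Relation.Binary.PropositionalEquality using (_≡_)
open import Relation.Nullary using (yes; no)
open import Relation.Unary using (Pred; _∈_)

record YoungDiagram : Set where
  field
    rows       : List ℕ
    decreasing : Linked _≥_ rows
    positive   : All (0 <_) rows

  ℓ : ℕ
  ℓ = length rows

  ∣_∣ : ℕ
  ∣_∣ = sum rows

open YoungDiagram public using (rows; ℓ; ∣_∣)

-- A filling of a Young diagram, row by row from the top. The operators below
-- are total maps on fillings; they are only meaningful on semistandard ones.
Filling : Set
Filling = List (List ℕ)

open Endo Filling public using (_^_)

record SST (n : ℕ) (Λ : YoungDiagram) (T : Filling) : Set where
  field
    shape   : map length T ≡ rows Λ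
    entries : All (All (λ x → 1 ≤ x × x ≤ n)) T
    rowWeak : All (Linked _≤_) T
    -- Prefix matches the lower row with the initial segment of the upper row
    -- lying directly above it.
    colStrict : Linked (λ upper lower → Prefix _>_ lower upper) T

-- Position k ∈ Fin n of the content counts the entries equal to k + 1.
content : (n : ℕ) → Filling → Vec ℕ n
content n T = tabulate λ k → length (filter (_≟ suc (toℕ k)) (concat T))

SSTα : (n : ℕ) → YoungDiagram → Vec ℕ n → Pred Filling 0ℓ
SSTα n Λ α T = SST n Λ T × content n T ≡ α

cont : (n : ℕ) → YoungDiagram → Pred (Vec ℕ n) 0ℓ
cont n Λ α = ∃[ T ] T ∈ SSTα n Λ α

cont⁺ : (n : ℕ) → YoungDiagram → Pred (Vec ℕ n) 0ℓ
cont⁺ n Λ α = α ∈ cont n Λ × Vec.Linked _≥_ α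

-- Crystal reflections

-- A letter of a word during the matching: an unmatched parenthesis, or a
-- letter that stays fixed (matched, or different from both i and i + 1).
data Mark : Set where
  unmatched⟨ : Mark
  unmatched⟩ : Mark
  fixed      : ℕ → Mark

-- Matches an opening parenthesis placed in front of the word with the first
-- unmatched closing one, if there is any.
open⟨ : ℕ → List Mark → List Mark
open⟨ i w = maybe (fixed (suc i) ∷_) (unmatched⟨ ∷ w) (close w)
  where
  close : List Mark → Maybe (List Mark)
  close []               = nothing
  close (unmatched⟩ ∷ w) = just (fixed i ∷ w)
  close (m ∷ w)          = close w >>= λ w′ → just (m ∷ w′)

mark : ℕ → List ℕ → List Mark
mark i []      = []
mark i (x ∷ w) with x ≟ i | x ≟ suc i
... | yes _ | _     = unmatched⟩ ∷ mark i w
... | no _  | yes _ = open⟨ i (mark i w)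
... | no _  | no _  = fixed x ∷ mark i w

count⟨ : List Mark → ℕ
count⟨ []               = 0
count⟨ (unmatched⟨ ∷ w) = suc (count⟨ w)
count⟨ (_ ∷ w)          = count⟨ w

-- Writes i in the first b unmatched positions and i + 1 in the others.
rewriteUnmatched : ℕ → ℕ → List Mark → List ℕ
rewriteUnmatched i b       []            = []
rewriteUnmatched i b       (fixed x ∷ w) = x ∷ rewriteUnmatched i b w
rewriteUnmatched i (suc b) (_ ∷ w)       = i ∷ rewriteUnmatched i b w
rewriteUnmatched i zero    (_ ∷ w)       = suc i ∷ rewriteUnmatched i zero w

sWord : ℕ → List ℕ → List ℕ
sWord i w = rewriteUnmatched i (count⟨ (mark i w)) (mark i w)

splitRows : List ℕ → List ℕ → List (List ℕ)
splitRows []       w = []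
splitRows (m ∷ ms) w = take m w ∷ splitRows ms (drop m w)

s : ℕ → Filling → Filling
s i T = reverse (splitRows (map length (reverse T)) (sWord i (concat (reverse T))))

-- s 1 ∘ s 2 ∘ ⋯ ∘ s (n ∸ 1), with s (n ∸ 1) applied first.
c : ℕ → Filling → Filling
c n T = foldr s T (applyUpTo suc (n ∸ 1))

-- Promotion

-- Row and column indices are counted from 0. The value nothing stands for a
-- dot or for a position outside the diagram; sliding treats both alike.
Grid : Set
Grid = ℕ → ℕ → Maybe ℕ

entry : Filling → Grid
entry T i j = head (drop i T) >>= λ row → head (drop j row)

set : ℕ → ℕ → Maybe ℕ → Grid → Grid
set i j v g k l = if k ≡ᵇ i then (if l ≡ᵇ j then v else g k l) else g k l

moveUp : ℕ → ℕ → ℕ → Grid → Grid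
moveUp i j a g = set i j nothing (set (suc i) j (just a) g)

moveLeft : ℕ → ℕ → ℕ → Grid → Grid
moveLeft i j b g = set i j nothing (set i (suc j) (just b) g)

-- Branches on the larger of the entries a above and b to the left of a dot.
byLarger : {A : Set} → (a b : Maybe ℕ) (up left : ℕ → A) (stay : A) → A
byLarger nothing  nothing  up left stay = stay
byLarger (just a) nothing  up left stay = up a
byLarger nothing  (just b) up left stay = left b
byLarger (just a) (just b) up left stay = if b ≤ᵇ a then up a else left b

-- Slides the dot at (i , j) to the northwest.
slide : Grid → ℕ → ℕ → Grid
slide g zero        zero        = g
slide g (suc i)     zero        = maybe (λ a → slide (moveUp i zero a g) i zero) g (g i zero)
slide g zero        (suc j)     = maybe (λ b → slide (moveLeft zero j b g) zero j) g (g zero j)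
slide g i⁺@(suc i)  j⁺@(suc j)  = byLarger (g i j⁺) (g i⁺ j)
  (λ a → slide (moveUp i j⁺ a g) i j⁺)
  (λ b → slide (moveLeft i⁺ j b g) i⁺ j)
  g

-- The positions (j , i) = (column , row) of the entries n, from left to right.
-- Sliding one dot does not move those to its right, so they are found at once.
dots : ℕ → Filling → List (ℕ × ℕ)
dots n T = filter (λ (j , i) → ≡-dec _≟_ (entry T i j) (just n))
  (cartesianProduct (upTo (foldr _⊔_ 0 (map length T))) (upTo (length T)))

dotted : ℕ → Filling → Grid
dotted n T i j = entry T i j >>= λ x → if x ≡ᵇ n then nothing else just x

slideAll : ℕ → Filling → Grid
slideAll n T = foldl (λ g (j , i) → slide g i j) (dotted n T) (dots n T)

fromGrid : List ℕ → (ℕ → ℕ → ℕ) → Filling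
fromGrid []       f = []
fromGrid (m ∷ ms) f = applyUpTo (f 0) m ∷ fromGrid ms (f ∘ suc)

-- When T has no entry n there are no dots, and this adds 1 to every entry.
pr : ℕ → Filling → Filling
pr n T = fromGrid (map length T) λ i j → maybe suc 1 (slideAll n T i j)

-- Orbits, cardinalities and orders

𝒪pr : ℕ → Filling → Pred Filling 0ℓ
𝒪pr n T U = ∃[ k ] U ≡ (pr n ^ k) T

𝒪C×P : ℕ → Filling → Pred Filling 0ℓ
𝒪C×P n T U = ∃[ a ] ∃[ b ] U ≡ (c n ^ a) ((pr n ^ (b * n)) T)

HasCardinality : {A : Set} → Pred A 0ℓ → ℕ → Set
HasCardinality P m = ∃[ xs ] Unique xs × (∀ x → x ∈ P ⇔ x ∈ˡ xs) × length xs ≡ m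

-- Equality of cardinalities of finite sets, finiteness included.
SameCardinality : {A : Set} → Pred A 0ℓ → Pred A 0ℓ → Set
SameCardinality P Q = ∃[ m ] HasCardinality P m × HasCardinality Q m

IsIdentityOn : Pred Filling 0ℓ → (Filling → Filling) → Set
IsIdentityOn S f = ∀ T → T ∈ S → f T ≡ T

-- m is the order of the restriction of f to S.
record IsOrder (f : Filling → Filling) (S : Pred Filling 0ℓ) (m : ℕ) : Set where
  field
    positive : 0 < m
    identity : IsIdentityOn S (f ^ m)
    least    : ∀ k → 0 < k → IsIdentityOn S (f ^ k) → m ≤ k

-- Data.Nat.LCM for a set of numbers instead of two.
record IsLCM (P : Pred ℕ 0ℓ) (l : ℕ) : Set where
  field
    commonMultiple : ∀ {x} → x ∈ P → x ∣ l
    least          : ∀ {m} → (∀ {x} → x ∈ P → x ∣ m) → l ∣ m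

{-# OPTIONS --safe #-}

-- Both pr and c rotate contents cyclically, so they raise the sum of the entries
-- by |λ| modulo n. As gcd(n , |λ|) = 1, only powers of them whose exponent is a
-- multiple of n fix a tableau. If pr ^ n has period r at T, both orbits of T have n r
-- elements, given that c ^ n = 1. The orders in part (2) are compared by sorting
-- contents with the reflections, which commute with pr ^ n.
--
-- That c ^ n = 1 and that s i is an involution is seen on words. The reflections
-- commute with Knuth moves at a fixed position and with the rotation x w ↦ w x,
-- and these moves connect every word with a sorted one, which the reflections
-- keep sorted. So identities between them may be checked on contents.
--
-- Promotion is controlled by the numbers of entries at most k in each row: a slide
-- raises one of them for each k, in a row that can be read off from the result.

module Submission where

open import Defs
open import Data.Bool using (true; false) renaming (T to IsTrue)
open import Data.Empty using (⊥; ⊥-elim)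
open import Data.Fin using (Fin; toℕ)
open import Data.Fin.Properties using (pigeonhole)
open import Data.List using (List; []; _∷_; _++_; _∷ʳ_; _ʳ++_; length; map; filter; foldl; foldr;
  applyUpTo; upTo; cartesianProduct; cartesianProductWith; concat; reverse; head; take; drop)
open import Data.List.Membership.Propositional using () renaming (_∈_ to _∈ˡ_)
open import Data.List.Membership.Propositional.Properties using (∈-cartesianProduct⁺; ∈-cartesianProduct⁻;
  ∈-cartesianProductWith⁺; ∈-upTo⁺; ∈-filter⁺; ∈-filter⁻; ∈-map⁻; ∈-applyUpTo⁺; ∈-applyUpTo⁻)
open import Data.List.Properties using (∷-injective; ∷-injectiveˡ; ∷-injectiveʳ; ∷ʳ-injective;
  ++-assoc; ++-identityʳ; length-++; length-map; length-filter; length-applyUpTo;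
  filter-accept; filter-reject; filter-none; filter-all; filter-++; reverse-map; reverse-involutive)
  renaming (≡-dec to List-≡-dec)
open import Data.List.Relation.Binary.Permutation.Propositional using (_↭_; ↭-refl; ↭-trans; ↭-sym)
import Data.List.Relation.Binary.Permutation.Propositional as ↭
open import Data.List.Relation.Binary.Permutation.Propositional.Properties using (++⁺ˡ; ++⁺ʳ; shifts; ∷↭∷ʳ;
  filter-↭; ↭-length; ↭-reverse; All-resp-↭)
open import Data.List.Relation.Binary.Prefix.Heterogeneous using (Prefix; []; _∷_)
open import Data.List.Relation.Binary.Prefix.Heterogeneous.Properties using (prefix?)
open import Data.List.Relation.Unary.All using (All; []; _∷_; all?)
import Data.List.Relation.Unary.All as All
import Data.List.Relation.Unary.All.Properties as All
open import Data.List.Relation.Unary.AllPairs using (AllPairs; []; _∷_)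
import Data.List.Relation.Unary.AllPairs as AllPairs
import Data.List.Relation.Unary.AllPairs.Properties as AllPairs
open import Data.List.Relation.Unary.Any using (here; there; index)
open import Data.List.Relation.Unary.Any.Properties using (lookup-index)
open import Data.List.Relation.Unary.Linked using (Linked; []; [-]; _∷_; linked?)
import Data.List.Relation.Unary.Linked.Properties as Linked
open import Data.Maybe using (Maybe; just; nothing; maybe; _>>=_)
open import Data.Maybe.Properties using (≡-dec)
open import Data.Nat hiding (_^_)
open import Data.Nat.Coprimality using (gcd≡1⇒coprime; coprime-divisor)
open import Data.Nat.Divisibility
open import Data.Nat.DivMod
open import Data.Nat.GCD using (gcd)
open import Data.Nat.Induction using (<-wellFounded)
open import Data.Nat.ListAction using (sum)
open import Data.Nat.Properties
open import Data.Nat.Solver using (module +-*-Solver)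
open import Data.Product using (_×_; _,_; proj₁; proj₂; ∃-syntax; Σ-syntax)
open import Data.Sum using (_⊎_; inj₁; inj₂; [_,_]′)
import Data.Sum as Sum
open import Data.Vec using (Vec; tabulate)
open import Data.Vec.Properties using () renaming (≡-dec to Vec-≡-dec)
import Data.Vec.Relation.Unary.Linked as Vec
open import Algebra.Properties.CommutativeSemigroup +-commutativeSemigroup using (x∙yz≈y∙xz)
open import Function using (_∘_; id; flip; mk⇔)
open import Function.Endo.Propositional (List ℕ) using () renaming (_^_ to _^ʷ_)
open import Induction.WellFounded using (Acc; acc)
open import Level using (0ℓ)
open import Relation.Binary using (tri<; tri≈; tri>)
open import Relation.Binary.Construct.Closure.ReflexiveTransitive using (Star; ε; _◅_; _◅◅_; gmap)
open import Relation.Binary.PropositionalEquality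
open import Relation.Nullary
open import Relation.Nullary.Decidable using (map′; _×-dec_)
open import Relation.Unary using (Pred; _∈_)

-- Fixing the label of a step, its position or the fact that it is a rotation, makes it a partial
-- injection. A map that respects labelled steps and fixes the last word of a chain therefore fixes
-- every word of it, and `equivariant-fixes` rests on this. Rotations cannot be dispensed with in
-- that role: a Knuth class contains a sorted word only if its tableau has a single row.
--
-- For promotion the point is injectivity, since cancelling iterates and finding periods depend on
-- it. The levels of a tableau form a Gelfand-Tsetlin pattern, and the path of a dot can be
-- recovered from the raised pattern because it ends in row 0: going up from there, interlacing
-- leaves one choice at each level. That every path does end in row 0 is not visible from a single
-- slide. It follows by comparing each path with that of the preceding dot (`guarded`), whose rows
-- bound those of the new one.

-- Reflections of words

-- The state (a , b) of a word: matching leaves a closing and then b opening ones.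
State : Set
State = ℕ × ℕ

data Kind (i : ℕ) : ℕ → Set where
  closing : Kind i i
  opening : Kind i (suc i)
  neutral : ∀ {x} → x ≢ i → x ≢ suc i → Kind i x

kind : ∀ i x → Kind i x
kind i x with x ≟ i | x ≟ suc i
... | yes refl | _        = closing
... | no _     | yes refl = opening
... | no x≢i   | no x≢1+i = neutral x≢i x≢1+i

module _ {i : ℕ} where

  consK : ∀ {x} → Kind i x → State → State
  consK closing       (a , b)     = suc a , b
  consK opening       (zero , b)  = zero , suc b
  consK opening       (suc a , b) = a , b
  consK (neutral _ _) st          = st

  snocK : ∀ {x} → Kind i x → State → State
  snocK closing       (a , zero)  = suc a , zero
  snocK closing       (a , suc b) = a , b
  snocK opening       (a , b)     = a , suc b
  snocK (neutral _ _) st          = st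

  choose : {P : Set} → Dec P → ℕ → ℕ → ℕ
  choose (yes _) m n = m
  choose (no _)  m n = n

  -- In the unmatched word i^a (i+1)^b the letter of rank k becomes i iff k < b.
  -- For a closing parenthesis, k is the number of closings in its left context
  -- and b the number of openings in its right one; dually for an opening one.
  newK : ∀ {x} → Kind i x → State → State → ℕ
  newK closing           (a , zero)  (_ , b)     = choose (b ≤? a) (suc i) i
  newK closing           (_ , suc _) _           = i
  newK opening           (a , _)     (zero , b)  = choose (a ≤? b) i (suc i)
  newK opening           _           (suc _ , _) = suc i
  newK {x} (neutral _ _) _           _           = x

suffix : ℕ → List ℕ → State → State
suffix i []      r = r
suffix i (x ∷ w) r = consK (kind i x) (suffix i w r)

prefix : ℕ → State → List ℕ → State
prefix i l []      = l
prefix i l (x ∷ w) = prefix i (snocK (kind i x) l) w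

-- The rest of a longer word acts on a factor only through the states `l` and `r` of its two sides.
-- Knuth moves and single rows of a tableau can therefore be treated in place, by `run-++`.
run : ℕ → State → List ℕ → State → List ℕ
run i l []      r = []
run i l (x ∷ w) r = newK (kind i x) l (suffix i w r) ∷ run i (snocK (kind i x) l) w r

-- The matching algorithm in terms of states

insertSecond : Mark → List Mark → List Mark
insertSecond m (a ∷ w) = a ∷ m ∷ w
insertSecond m []      = []

-- `open⟨` puts exactly one mark in front of the word, so a mark in front of its argument comes out
-- second. Here `X` stands for the outcome of the search for a closing parenthesis and `p` for the
-- function applied to it.
open⟨-step : ∀ i m w (X : Maybe (List Mark)) (p : Maybe (List Mark) → List Mark) →
  maybe (fixed (suc i) ∷_) (unmatched⟨ ∷ w) ≡ p →
  maybe (fixed (suc i) ∷_) (unmatched⟨ ∷ m ∷ w) (X >>= λ w′ → just (m ∷ w′)) ≡ insertSecond m (p X)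
open⟨-step i m w (just _) p refl = refl
open⟨-step i m w nothing  p refl = refl

-- Abstracting over the head of the normal form of open⟨ gives access to
-- the result of its local function, which has no name outside its module.
open⟨-fixed : ∀ i x w → open⟨ i (fixed x ∷ w) ≡ insertSecond (fixed x) (open⟨ i w)
open⟨-fixed i x w with maybe {B = λ _ → List Mark} (fixed (suc i) ∷_) (unmatched⟨ ∷ w) in eq
... | p = open⟨-step i (fixed x) w _ p eq

open⟨-unmatched⟨ : ∀ i w → open⟨ i (unmatched⟨ ∷ w) ≡ insertSecond unmatched⟨ (open⟨ i w)
open⟨-unmatched⟨ i w with maybe {B = λ _ → List Mark} (fixed (suc i) ∷_) (unmatched⟨ ∷ w) in eq
... | p = open⟨-step i unmatched⟨ w _ p eq

module _ (i : ℕ) where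

  markK : ∀ {x} → Kind i x → ℕ → ℕ → Mark
  markK closing           zero    _       = unmatched⟩
  markK closing           (suc _) _       = fixed i
  markK opening           _       zero    = unmatched⟨
  markK opening           _       (suc _) = fixed (suc i)
  markK {x} (neutral _ _) _       _       = fixed x

  nextK : ∀ {x} → Kind i x → ℕ → ℕ
  nextK closing       b = pred b
  nextK opening       b = suc b
  nextK (neutral _ _) b = b

  closes opens : List ℕ → ℕ
  closes w = proj₁ (suffix i w (0 , 0))
  opens w = proj₂ (suffix i w (0 , 0))

  -- Matching from left to right, with `b` opening parentheses pending on the left. Whereas `mark`
  -- revises marks already set whenever it meets an opening parenthesis, here each mark is final.
  marks : List ℕ → ℕ → List Mark
  marks []      b = []
  marks (x ∷ w) b = markK (kind i x) b (closes w) ∷ marks w (nextK (kind i x) b)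

  -- The `b` pending openings already match every closing parenthesis that `w` leaves open, so one
  -- more finds no partner.
  marks-saturated : ∀ w b → closes w ≤ b → marks w (suc b) ≡ marks w b
  marks-saturated []      b c≤b = refl
  marks-saturated (x ∷ w) b c≤b with kind i x | suffix i w (0 , 0) in eq
  marks-saturated (x ∷ w) (suc b) (s≤s c≤b) | closing | a , _ =
    cong (fixed i ∷_) (marks-saturated w b (subst (_≤ b) (sym (cong proj₁ eq)) c≤b))
  ... | opening | zero , _ =
    cong (unmatched⟨ ∷_) (marks-saturated w (suc b) (subst (_≤ suc b) (sym (cong proj₁ eq)) z≤n))
  ... | opening | suc a , _ =
    cong (fixed (suc i) ∷_) (marks-saturated w (suc b) (subst (_≤ suc b) (sym (cong proj₁ eq)) (s≤s c≤b)))
  ... | neutral _ _ | a , _ = cong (fixed x ∷_) (marks-saturated w b (subst (_≤ b) (sym (cong proj₁ eq)) c≤b))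

  open⟨-marks-saturated : ∀ w b → closes w ≤ b → open⟨ i (marks w b) ≡ unmatched⟨ ∷ marks w b
  open⟨-marks-saturated []      b c≤b = refl
  open⟨-marks-saturated (x ∷ w) b c≤b with kind i x | suffix i w (0 , 0) in eq
  open⟨-marks-saturated (x ∷ w) (suc b) (s≤s c≤b) | closing | a , _ =
    trans (open⟨-fixed i i (marks w b))
      (cong (insertSecond (fixed i)) (open⟨-marks-saturated w b (subst (_≤ b) (sym (cong proj₁ eq)) c≤b)))
  ... | opening | zero , _ = trans (open⟨-unmatched⟨ i (marks w (suc b)))
    (cong (insertSecond unmatched⟨) (open⟨-marks-saturated w (suc b) (subst (_≤ suc b) (sym (cong proj₁ eq)) z≤n)))
  ... | opening | suc a , _ = trans (open⟨-fixed i (suc i) (marks w (suc b)))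
    (cong (insertSecond (fixed (suc i))) (open⟨-marks-saturated w (suc b) (subst (_≤ suc b) (sym (cong proj₁ eq)) (s≤s c≤b))))
  ... | neutral _ _ | a , _ = trans (open⟨-fixed i x (marks w b))
    (cong (insertSecond (fixed x)) (open⟨-marks-saturated w b (subst (_≤ b) (sym (cong proj₁ eq)) c≤b)))

  open⟨-marks-closing : ∀ w b → b < closes w → open⟨ i (marks w b) ≡ fixed (suc i) ∷ marks w (suc b)
  open⟨-marks-closing (x ∷ w) b b<c with kind i x | suffix i w (0 , 0) in eq
  open⟨-marks-closing (x ∷ w) zero    _          | closing | a , _ = refl
  open⟨-marks-closing (x ∷ w) (suc b) (s≤s b<c) | closing | a , _ =
    trans (open⟨-fixed i i (marks w b))
      (cong (insertSecond (fixed i)) (open⟨-marks-closing w b (subst (b <_) (sym (cong proj₁ eq)) b<c)))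
  ... | opening | suc a , _ = trans (open⟨-fixed i (suc i) (marks w (suc b)))
    (cong (insertSecond (fixed (suc i))) (open⟨-marks-closing w (suc b) (subst (suc b <_) (sym (cong proj₁ eq)) (s≤s b<c))))
  ... | neutral _ _ | a , _ = trans (open⟨-fixed i x (marks w b))
    (cong (insertSecond (fixed x)) (open⟨-marks-closing w b (subst (b <_) (sym (cong proj₁ eq)) b<c)))

  open⟨-marks : ∀ w → open⟨ i (marks w 0) ≡ markK opening 0 (closes w) ∷ marks w 1
  open⟨-marks w with closes w in eq
  ... | zero  = trans (open⟨-marks-saturated w 0 (≤-reflexive eq))
                  (cong (unmatched⟨ ∷_) (sym (marks-saturated w 0 (≤-reflexive eq))))
  ... | suc _ = open⟨-marks-closing w 0 (subst (0 <_) (sym eq) (s≤s z≤n))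

  mark≡marks : ∀ w → mark i w ≡ marks w 0
  mark≡marks []      = refl
  mark≡marks (x ∷ w) with x ≟ i | x ≟ suc i
  ... | yes refl | _        = cong (unmatched⟩ ∷_) (mark≡marks w)
  ... | no _     | yes refl = trans (cong (open⟨ i) (mark≡marks w)) (open⟨-marks w)
  ... | no _     | no _     = cong (fixed x ∷_) (mark≡marks w)

  count⟨-marks : ∀ w b → count⟨ (marks w b) ≡ opens w
  count⟨-marks []      b = refl
  count⟨-marks (x ∷ w) b with kind i x | suffix i w (0 , 0) in eq
  count⟨-marks (x ∷ w) zero    | closing     | _         = trans (count⟨-marks w 0) (cong proj₂ eq)
  count⟨-marks (x ∷ w) (suc b) | closing     | _         = trans (count⟨-marks w b) (cong proj₂ eq)
  ... | opening     | zero , _  = cong suc (trans (count⟨-marks w (suc b)) (cong proj₂ eq))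
  ... | opening     | suc _ , _ = trans (count⟨-marks w (suc b)) (cong proj₂ eq)
  ... | neutral _ _ | _         = trans (count⟨-marks w b) (cong proj₂ eq)

  -- Of the letters that sWord still has to turn into i, the a unmatched
  -- closing parentheses passed so far have consumed a.
  rewriteUnmatched-marks : ∀ w a b →
    rewriteUnmatched i (opens w ∸ a) (marks w b) ≡ run i (a , b) w (0 , 0)
  rewriteUnmatched-marks []      a b = refl
  rewriteUnmatched-marks (x ∷ w) a b with kind i x | suffix i w (0 , 0) in eq
  rewriteUnmatched-marks (x ∷ w) a zero | closing | _ , e with e ≤? a | e ∸ a in eq′
  ... | yes e≤a | zero = cong (suc i ∷_) (trans
          (cong (λ b → rewriteUnmatched i b (marks w 0)) (sym (trans (cong (λ st → proj₂ st ∸ suc a) eq) (m≤n⇒m∸n≡0 (m≤n⇒m≤1+n e≤a)))))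
          (rewriteUnmatched-marks w (suc a) 0))
  ... | yes e≤a | suc _ with () ← trans (sym eq′) (m≤n⇒m∸n≡0 e≤a)
  ... | no e≰a  | zero  = ⊥-elim (e≰a (m∸n≡0⇒m≤n eq′))
  ... | no _    | suc k = cong (i ∷_) (trans
          (cong (λ b → rewriteUnmatched i b (marks w 0)) (sym (trans (cong (λ st → proj₂ st ∸ suc a) eq)
            (trans (sym (pred[m∸n]≡m∸[1+n] e a)) (cong pred eq′)))))
          (rewriteUnmatched-marks w (suc a) 0))
  rewriteUnmatched-marks (x ∷ w) a (suc b) | closing | _ , e =
    cong (i ∷_) (trans (cong (λ e → rewriteUnmatched i (e ∸ a) (marks w b)) (sym (cong proj₂ eq)))
      (rewriteUnmatched-marks w a b))
  rewriteUnmatched-marks (x ∷ w) a b | opening | zero , e with a ≤? e | suc e ∸ a in eq′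
  ... | yes a≤e | zero = ⊥-elim (<-irrefl refl (≤-trans (m∸n≡0⇒m≤n eq′) a≤e))
  ... | yes a≤e | suc k = cong (i ∷_) (trans
          (cong (λ b′ → rewriteUnmatched i b′ (marks w (suc b))) (sym (trans (cong (λ st → proj₂ st ∸ a) eq)
            (suc-injective (trans (sym (+-∸-assoc 1 a≤e)) eq′)))))
          (rewriteUnmatched-marks w a (suc b)))
  ... | no a≰e | zero = cong (suc i ∷_) (trans
          (cong (λ b′ → rewriteUnmatched i b′ (marks w (suc b))) (sym (trans (cong (λ st → proj₂ st ∸ a) eq)
            (m≤n⇒m∸n≡0 (<⇒≤ (≰⇒> a≰e))))))
          (rewriteUnmatched-marks w a (suc b)))
  ... | no a≰e | suc k with () ← trans (sym eq′) (m≤n⇒m∸n≡0 (≰⇒> a≰e))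
  rewriteUnmatched-marks (x ∷ w) a b | opening | suc _ , e =
    cong (suc i ∷_) (trans (cong (λ e → rewriteUnmatched i (e ∸ a) (marks w (suc b))) (sym (cong proj₂ eq)))
      (rewriteUnmatched-marks w a (suc b)))
  rewriteUnmatched-marks (x ∷ w) a b | neutral _ _ | _ , e =
    cong (x ∷_) (trans (cong (λ e → rewriteUnmatched i (e ∸ a) (marks w b)) (sym (cong proj₂ eq)))
      (rewriteUnmatched-marks w a b))

  sWord≡run : ∀ w → sWord i w ≡ run i (0 , 0) w (0 , 0)
  sWord≡run w = trans (cong (λ m → rewriteUnmatched i (count⟨ m) m) (mark≡marks w))
    (trans (cong (λ b → rewriteUnmatched i b (marks w 0)) (count⟨-marks w 0)) (rewriteUnmatched-marks w 0 0))

-- Inequalities preserved by a reflection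

module _ {i : ℕ} where

  newK-≥ : ∀ {y} (k : Kind i y) l r → (i ≤ y → i ≤ newK k l r) 
  newK-≥ closing (a , zero) (_ , b) _ with b ≤? a
  ... | yes _ = n≤1+n i
  ... | no _  = ≤-refl
  newK-≥ closing (_ , suc _) r _ = ≤-refl
  newK-≥ opening (a , _) (zero , b) _ with a ≤? b
  ... | yes _ = ≤-refl
  ... | no _  = n≤1+n i
  newK-≥ opening _ (suc _ , _) _ = n≤1+n i
  newK-≥ (neutral _ _) l r i≤y = i≤y

  newK-≤ : ∀ {y} (k : Kind i y) l r → (y ≤ suc i → newK k l r ≤ suc i)
  newK-≤ closing (a , zero) (_ , b) _ with b ≤? a
  ... | yes _ = ≤-refl
  ... | no _  = n≤1+n i
  newK-≤ closing (_ , suc _) r _ = n≤1+n i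
  newK-≤ opening (a , _) (zero , b) _ with a ≤? b
  ... | yes _ = n≤1+n i
  ... | no _  = ≤-refl
  newK-≤ opening _ (suc _ , _) _ = ≤-refl
  newK-≤ (neutral _ _) l r y≤ = y≤

  newK-<neutral : ∀ {y z} (k : Kind i y) l r → z ≢ i → z ≢ suc i → y < z → newK k l r < z
  newK-<neutral k@closing l r z≢i z≢1+i y<z = ≤-<-trans (newK-≤ k l r (n≤1+n i)) (≤∧≢⇒< y<z (z≢1+i ∘ sym))
  newK-<neutral k@opening l r z≢i z≢1+i y<z = ≤-<-trans (newK-≤ k l r ≤-refl) y<z
  newK-<neutral (neutral _ _) l r z≢i z≢1+i y<z = y<z

  newK->neutral : ∀ {y z} (k : Kind i y) l r → z ≢ i → z ≢ suc i → z < y → z < newK k l r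
  newK->neutral k@closing l r z≢i z≢1+i z<y = <-≤-trans z<y (newK-≥ k l r ≤-refl)
  newK->neutral k@opening l r z≢i z≢1+i (s≤s z≤i) = <-≤-trans (≤∧≢⇒< z≤i z≢i) (newK-≥ k l r (n≤1+n i))
  newK->neutral (neutral _ _) l r z≢i z≢1+i z<y = z<y

  newK-≤neutral : ∀ {y z} (k : Kind i y) l r → z ≢ i → z ≢ suc i → y ≤ z → newK k l r ≤ z
  newK-≤neutral (neutral _ _) l r _ _ y≤z = y≤z
  newK-≤neutral k@closing l r z≢i z≢1+i y≤z = <⇒≤ (newK-<neutral k l r z≢i z≢1+i (≤∧≢⇒< y≤z (z≢i ∘ sym)))
  newK-≤neutral k@opening l r z≢i z≢1+i y≤z = <⇒≤ (newK-<neutral k l r z≢i z≢1+i (≤∧≢⇒< y≤z (z≢1+i ∘ sym)))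

  newK-≥neutral : ∀ {y z} (k : Kind i y) l r → z ≢ i → z ≢ suc i → z ≤ y → z ≤ newK k l r
  newK-≥neutral (neutral _ _) l r _ _ z≤y = z≤y
  newK-≥neutral k@closing l r z≢i z≢1+i z≤y = <⇒≤ (newK->neutral k l r z≢i z≢1+i (≤∧≢⇒< z≤y z≢i))
  newK-≥neutral k@opening l r z≢i z≢1+i z≤y = <⇒≤ (newK->neutral k l r z≢i z≢1+i (≤∧≢⇒< z≤y z≢1+i))

  -- Unmatched letters become `i` up to some rank and `i + 1` from there on. Matched letters do not
  -- disturb this order: in a block of equal letters a matched `i` precedes the unmatched ones, and
  -- a matched `i + 1` follows them.
  newK-mono-≤ : ∀ {y z} (ky : Kind i y) (kz : Kind i z) l r → y ≤ z →
    newK ky l (consK kz r) ≤ newK kz (snocK ky l) r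
  newK-mono-≤ ky (neutral p q) l r y≤z = newK-≤neutral ky l r p q y≤z
  newK-mono-≤ (neutral p q) kz@closing l r y≤z = newK-≥neutral kz l r p q y≤z
  newK-mono-≤ (neutral p q) kz@opening l r y≤z = newK-≥neutral kz l r p q y≤z
  newK-mono-≤ closing closing (a , zero) (_ , b) _ with b ≤? a | b ≤? suc a
  ... | yes b≤a | yes _ = ≤-refl
  ... | yes b≤a | no b≰ = ⊥-elim (b≰ (m≤n⇒m≤1+n b≤a))
  ... | no _    | yes _ = n≤1+n i
  ... | no _    | no _  = ≤-refl
  newK-mono-≤ closing closing l@(a , suc b) r _ = newK-≥ (closing {i}) (snocK (closing {i}) l) r ≤-refl
  newK-mono-≤ closing opening (a , zero) (zero , b) _ with suc b ≤? a | suc a ≤? b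
  ... | yes p | yes q = ⊥-elim (<-asym p q)
  ... | yes _ | no _  = ≤-refl
  ... | no _  | yes _ = ≤-refl
  ... | no _  | no _  = n≤1+n i
  newK-mono-≤ closing opening l@(a , zero) r@(suc a₂ , b) _ = newK-≤ (closing {i}) l (a₂ , b) (n≤1+n i)
  newK-mono-≤ closing opening l@(a , suc b) r _ = newK-≥ (opening {i}) (a , b) r (n≤1+n i)
  newK-mono-≤ opening closing l r 1+i≤i = ⊥-elim (<-irrefl refl 1+i≤i)
  newK-mono-≤ opening opening (a , _) (zero , b) _ with a ≤? suc b | a ≤? b
  ... | yes _  | yes _ = ≤-refl
  ... | yes _  | no _  = n≤1+n i
  ... | no a≰  | yes a≤b = ⊥-elim (a≰ (m≤n⇒m≤1+n a≤b))
  ... | no _   | no _  = ≤-refl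
  newK-mono-≤ opening opening l r@(suc a₂ , b) _ = newK-≤ (opening {i}) l (a₂ , b) ≤-refl

  -- The only descent between the two letters concerned is `i + 1` directly before `i`; it is a
  -- matched pair and stays as it is.
  newK-anti-< : ∀ {y x} (ky : Kind i y) (kx : Kind i x) l r → x < y →
    newK kx (snocK ky l) r < newK ky l (consK kx r)
  newK-anti-< ky (neutral p q) l r x<y = newK->neutral ky l r p q x<y
  newK-anti-< (neutral p q) kx l r x<y = newK-<neutral kx l r p q x<y
  newK-anti-< opening closing l r _ = ≤-refl
  newK-anti-< closing closing l r i<i = ⊥-elim (<-irrefl refl i<i)
  newK-anti-< opening opening l r i<i = ⊥-elim (<-irrefl refl i<i)
  newK-anti-< closing opening l r 1+i<i = ⊥-elim (<-asym 1+i<i ≤-refl)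

suffix-++ : ∀ i u v r → suffix i (u ++ v) r ≡ suffix i u (suffix i v r)
suffix-++ i []      v r = refl
suffix-++ i (x ∷ u) v r = cong (consK (kind i x)) (suffix-++ i u v r)

run-++ : ∀ i l u v r → run i l (u ++ v) r ≡ run i l u (suffix i v r) ++ run i (prefix i l u) v r
run-++ i l []      v r = refl
run-++ i l (x ∷ u) v r = cong₂ _∷_ (cong (newK (kind i x) l) (suffix-++ i u v r)) (run-++ i _ u v r)

length-run : ∀ i l w r → length (run i l w r) ≡ length w
length-run i l []      r = refl
length-run i l (x ∷ w) r = cong suc (length-run i _ w r)

-- Knuth moves and rotations of words

-- The elementary Knuth relations. The sums list both directions of each, which makes the relation
-- symmetric.
data Knuth : List ℕ → List ℕ → Set where
  swapʳ : ∀ {p q r} → (q < p × p ≤ r) ⊎ (r < p × p ≤ q) → Knuth (p ∷ q ∷ r ∷ []) (p ∷ r ∷ q ∷ [])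
  swapˡ : ∀ {p q r} → (p ≤ r × r < q) ⊎ (q ≤ r × r < p) → Knuth (p ∷ q ∷ r ∷ []) (q ∷ p ∷ r ∷ [])

Knuth-sym : ∀ {t t′} → Knuth t t′ → Knuth t′ t
Knuth-sym (swapʳ (inj₁ h)) = swapʳ (inj₂ h)
Knuth-sym (swapʳ (inj₂ h)) = swapʳ (inj₁ h)
Knuth-sym (swapˡ (inj₁ h)) = swapˡ (inj₂ h)
Knuth-sym (swapˡ (inj₂ h)) = swapˡ (inj₁ h)

-- The inequalities of the two kinds of move contradict each other on any triple. Together with
-- symmetry this makes a move at a given position a partial injection.
Knuth-functional : ∀ {t u v} → Knuth t u → Knuth t v → u ≡ v
Knuth-functional (swapʳ _) (swapʳ _) = refl
Knuth-functional (swapˡ _) (swapˡ _) = refl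
Knuth-functional (swapʳ (inj₁ (q<p , p≤r))) (swapˡ (inj₁ (_ , r<q))) = ⊥-elim (<-irrefl refl (<-trans q<p (≤-<-trans p≤r r<q)))
Knuth-functional (swapʳ (inj₁ (_ , p≤r))) (swapˡ (inj₂ (_ , r<p))) = ⊥-elim (≤⇒≯ p≤r r<p)
Knuth-functional (swapʳ (inj₂ (r<p , _))) (swapˡ (inj₁ (p≤r , _))) = ⊥-elim (≤⇒≯ p≤r r<p)
Knuth-functional (swapʳ (inj₂ (r<p , p≤q))) (swapˡ (inj₂ (q≤r , _))) = ⊥-elim (<-irrefl refl (<-≤-trans r<p (≤-trans p≤q q≤r)))
Knuth-functional a@(swapˡ (inj₁ (_ , r<q))) (swapʳ (inj₁ (q<p , p≤r))) = ⊥-elim (<-irrefl refl (<-trans q<p (≤-<-trans p≤r r<q)))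
Knuth-functional (swapˡ (inj₂ (_ , r<p))) (swapʳ (inj₁ (_ , p≤r))) = ⊥-elim (≤⇒≯ p≤r r<p)
Knuth-functional (swapˡ (inj₁ (p≤r , _))) (swapʳ (inj₂ (r<p , _))) = ⊥-elim (≤⇒≯ p≤r r<p)
Knuth-functional (swapˡ (inj₂ (q≤r , _))) (swapʳ (inj₂ (r<p , p≤q))) = ⊥-elim (<-irrefl refl (<-≤-trans r<p (≤-trans p≤q q≤r)))

module _ {i : ℕ} where

  -- The image can be a move of the other kind: in `i + 1`, `i`, `i + 1` one opening letter may be
  -- unmatched and become `i`, and then the images differ in their first two letters. For this
  -- reason labels record the position of a move only.
  runʳ : ∀ {p q r} (kp : Kind i p) (kq : Kind i q) (kr : Kind i r) → q < p → p ≤ r → ∀ st st′ →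
    Knuth (newK kp st (consK kq (consK kr st′)) ∷ newK kq (snocK kp st) (consK kr st′) ∷ newK kr (snocK kq (snocK kp st)) st′ ∷ [])
          (newK kp st (consK kr (consK kq st′)) ∷ newK kr (snocK kp st) (consK kq st′) ∷ newK kq (snocK kr (snocK kp st)) st′ ∷ [])
    × snocK kr (snocK kq (snocK kp st)) ≡ snocK kq (snocK kr (snocK kp st))
    × consK kp (consK kq (consK kr st′)) ≡ consK kp (consK kr (consK kq st′))
  runʳ kp kq (neutral a b) q<p p≤r st st′ =
    swapʳ (inj₁ (newK-anti-< kp kq st st′ q<p , newK-≤neutral kp st (consK kq st′) a b p≤r)) , refl , refl
  runʳ kp (neutral a b) kr q<p p≤r st st′ =
    swapʳ (inj₁ (newK->neutral kp st (consK kr st′) a b q<p , newK-mono-≤ kp kr st st′ p≤r)) , refl , refl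
  runʳ kp closing closing q<p p≤r st st′ = ⊥-elim (≤⇒≯ p≤r q<p)
  runʳ kp opening opening q<p p≤r st st′ = ⊥-elim (≤⇒≯ p≤r q<p)
  runʳ kp opening closing q<p p≤r st st′ = ⊥-elim (<-asym (<-≤-trans q<p p≤r) ≤-refl)
  runʳ closing closing opening q<p p≤r st st′ = ⊥-elim (<-irrefl refl q<p)
  runʳ (neutral a b) closing opening q<p p≤r st st′ = ⊥-elim (b (≤-antisym p≤r q<p))
  runʳ opening closing opening q<p p≤r (a , b) (suc a₂ , b₂) = swapʳ (inj₁ (≤-refl , ≤-refl)) , refl , refl
  runʳ opening closing opening q<p p≤r (a , b) (zero , b₂) with a ≤? b₂
  ... | yes _ = swapˡ (inj₂ (≤-refl , ≤-refl)) , refl , refl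
  ... | no _  = swapʳ (inj₁ (≤-refl , ≤-refl)) , refl , refl

  runˡ : ∀ {p q r} (kp : Kind i p) (kq : Kind i q) (kr : Kind i r) → p ≤ r → r < q → ∀ st st′ →
    Knuth (newK kp st (consK kq (consK kr st′)) ∷ newK kq (snocK kp st) (consK kr st′) ∷ newK kr (snocK kq (snocK kp st)) st′ ∷ [])
          (newK kq st (consK kp (consK kr st′)) ∷ newK kp (snocK kq st) (consK kr st′) ∷ newK kr (snocK kp (snocK kq st)) st′ ∷ [])
    × snocK kr (snocK kq (snocK kp st)) ≡ snocK kr (snocK kp (snocK kq st))
    × consK kp (consK kq (consK kr st′)) ≡ consK kq (consK kp (consK kr st′))
  runˡ kp (neutral a b) kr p≤r r<q st st′ =
    swapˡ (inj₁ (newK-mono-≤ kp kr st st′ p≤r , newK-<neutral kr (snocK kp st) st′ a b r<q)) , refl , refl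
  runˡ (neutral a b) kq kr p≤r r<q st st′ =
    swapˡ (inj₁ (newK-≥neutral kr (snocK kq st) st′ a b p≤r , newK-anti-< kq kr st st′ r<q)) , refl , refl
  runˡ closing closing kr p≤r r<q st st′ = ⊥-elim (≤⇒≯ p≤r r<q)
  runˡ opening opening kr p≤r r<q st st′ = ⊥-elim (≤⇒≯ p≤r r<q)
  runˡ opening closing kr p≤r r<q st st′ = ⊥-elim (<-asym (≤-<-trans p≤r r<q) ≤-refl)
  runˡ closing opening opening p≤r r<q st st′ = ⊥-elim (<-irrefl refl r<q)
  runˡ closing opening (neutral a b) p≤r (s≤s r≤i) st st′ = ⊥-elim (a (≤-antisym r≤i p≤r))
  runˡ closing opening closing p≤r r<q (a , suc b) (a₂ , b₂) = swapˡ (inj₁ (≤-refl , ≤-refl)) , refl , refl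
  runˡ closing opening closing p≤r r<q (a , zero) (a₂ , b₂) with b₂ ≤? a
  ... | yes _ = swapʳ (inj₂ (≤-refl , ≤-refl)) , refl , refl
  ... | no _  = swapˡ (inj₁ (≤-refl , ≤-refl)) , refl , refl

run-Knuth : ∀ i {t t′} → Knuth t t′ → ∀ l r →
  Knuth (run i l t r) (run i l t′ r) × prefix i l t ≡ prefix i l t′ × suffix i t r ≡ suffix i t′ r
run-Knuth i (swapʳ {p} {q} {r} (inj₁ (h , h′))) st st′ = runʳ (kind i p) (kind i q) (kind i r) h h′ st st′
run-Knuth i (swapʳ {p} {q} {r} (inj₂ (h , h′))) st st′ with runʳ (kind i p) (kind i r) (kind i q) h h′ st st′
... | k , e , e′ = Knuth-sym k , sym e , sym e′
run-Knuth i (swapˡ {p} {q} {r} (inj₁ (h , h′))) st st′ = runˡ (kind i p) (kind i q) (kind i r) h h′ st st′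
run-Knuth i (swapˡ {p} {q} {r} (inj₂ (h , h′))) st st′ with runˡ (kind i q) (kind i p) (kind i r) h h′ st st′
... | k , e , e′ = Knuth-sym k , sym e , sym e′

data KnuthAt : ℕ → List ℕ → List ℕ → Set where
  here  : ∀ {t t′} v → Knuth t t′ → KnuthAt 0 (t ++ v) (t′ ++ v)
  there : ∀ {n} x {w w′} → KnuthAt n w w′ → KnuthAt (suc n) (x ∷ w) (x ∷ w′)

data Label : Set where
  position : ℕ → Label
  rotation : Label

data Step : Label → List ℕ → List ℕ → Set where
  knuth : ∀ {n w w′} → KnuthAt n w w′ → Step (position n) w w′
  rot   : ∀ x w → Step rotation (x ∷ w) (w ∷ʳ x)

Equivariant : (List ℕ → List ℕ) → Set
Equivariant f = ∀ {l w w′} → Step l w w′ → Step l (f w) (f w′)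

-- Rotation of words

module _ {i : ℕ} where

  -- States form the bicyclic monoid, in which opening times closing is 1. `consK` multiplies on the
  -- left and `snocK` on the right, so this is associativity.
  consK-snocK : ∀ {x y} (kx : Kind i x) (ky : Kind i y) st → snocK ky (consK kx st) ≡ consK kx (snocK ky st)
  consK-snocK (neutral _ _) ky            st                = refl
  consK-snocK closing       (neutral _ _) st                = refl
  consK-snocK opening       (neutral _ _) st                = refl
  consK-snocK closing       closing       (a , zero)        = refl
  consK-snocK closing       closing       (a , suc b)       = refl
  consK-snocK closing       opening       st                = refl
  consK-snocK opening       closing       (zero , zero)     = refl
  consK-snocK opening       closing       (zero , suc b)    = refl
  consK-snocK opening       closing       (suc a , zero)    = refl
  consK-snocK opening       closing       (suc a , suc b)   = refl
  consK-snocK opening       opening       (zero , b)        = refl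
  consK-snocK opening       opening       (suc a , b)       = refl

  consK≡snocK : ∀ {x} (k : Kind i x) → consK k (0 , 0) ≡ snocK k (0 , 0)
  consK≡snocK closing       = refl
  consK≡snocK opening       = refl
  consK≡snocK (neutral _ _) = refl

  -- Moving a letter from the front of the word to its end shifts both sides of the comparison in
  -- `newK` by one. In the boundary cases a comparison with 0 holds either way, or `y` is matched
  -- with the moved letter on one side just when the comparison on the other side leaves it
  -- unchanged.
  newK-move : ∀ {x y} (kx : Kind i x) (ky : Kind i y) l r → newK ky (consK kx l) r ≡ newK ky l (snocK kx r)
  newK-move (neutral _ _) ky            l                 r = refl
  newK-move closing       (neutral _ _) l                 r = refl
  newK-move opening       (neutral _ _) l                 r = refl
  newK-move closing       closing       (a , suc b)       r = refl
  newK-move closing       closing       (a , zero)        (_ , zero)  with 0 ≤? suc a | 0 ≤? a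
  ... | yes _ | yes _ = refl
  ... | no  p | _     = ⊥-elim (p z≤n)
  ... | _     | no  p = ⊥-elim (p z≤n)
  newK-move closing       closing       (a , zero)        (_ , suc b) with suc b ≤? suc a | b ≤? a
  ... | yes _ | yes _ = refl
  ... | no  p | yes q = ⊥-elim (p (s≤s q))
  ... | yes (s≤s p) | no q = ⊥-elim (q p)
  ... | no  _ | no  _ = refl
  newK-move closing       opening       (a , _)           (zero , zero)  with suc a ≤? 0
  ... | no _ = refl
  newK-move closing       opening       (a , _)           (zero , suc b) with suc a ≤? suc b | a ≤? b
  ... | yes _ | yes _ = refl
  ... | no  p | yes q = ⊥-elim (p (s≤s q))
  ... | yes (s≤s p) | no q = ⊥-elim (q p)
  ... | no  _ | no  _ = refl
  newK-move closing       opening       (a , _)           (suc _ , zero)  = refl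
  newK-move closing       opening       (a , _)           (suc _ , suc _) = refl
  newK-move opening       closing       (zero , zero)     (_ , b) with suc b ≤? 0
  ... | no _ = refl
  newK-move opening       closing       (suc a , zero)    (_ , b) with b ≤? a | suc b ≤? suc a
  ... | yes _ | yes _ = refl
  ... | no  p | yes (s≤s q) = ⊥-elim (p q)
  ... | yes p | no q = ⊥-elim (q (s≤s p))
  ... | no  _ | no  _ = refl
  newK-move opening       closing       (zero , suc _)    r = refl
  newK-move opening       closing       (suc _ , suc _)   r = refl
  newK-move opening       opening       (zero , _)        (zero , b) with 0 ≤? b | 0 ≤? suc b
  ... | yes _ | yes _ = refl
  ... | no  p | _     = ⊥-elim (p z≤n)
  ... | _     | no  p = ⊥-elim (p z≤n)
  newK-move opening       opening       (suc a , _)       (zero , b) with a ≤? b | suc a ≤? suc b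
  ... | yes _ | yes _ = refl
  ... | no  p | yes (s≤s q) = ⊥-elim (p q)
  ... | yes p | no q = ⊥-elim (q (s≤s p))
  ... | no  _ | no  _ = refl
  newK-move opening       opening       (zero , _)        (suc _ , _) = refl
  newK-move opening       opening       (suc _ , _)       (suc _ , _) = refl

  newK-comm : ∀ {x} (k : Kind i x) st → newK k (0 , 0) st ≡ newK k st (0 , 0)
  newK-comm (neutral _ _) st          = refl
  newK-comm closing       (a , zero)  = refl
  newK-comm closing       (a , suc b) = refl
  newK-comm opening       (zero , b)  = refl
  newK-comm opening       (suc a , b) = refl

prefix-consK : ∀ i {x} (k : Kind i x) l w → prefix i (consK k l) w ≡ consK k (prefix i l w)
prefix-consK i k l []      = refl
prefix-consK i k l (y ∷ w) = trans (cong (λ l → prefix i l w) (consK-snocK k (kind i y) l)) (prefix-consK i k _ w)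

suffix-snocK : ∀ i {x} (k : Kind i x) w r → suffix i w (snocK k r) ≡ snocK k (suffix i w r)
suffix-snocK i k []      r = refl
suffix-snocK i k (y ∷ w) r = trans (cong (consK (kind i y)) (suffix-snocK i k w r)) (sym (consK-snocK (kind i y) k _))

suffix≡prefix : ∀ i w → suffix i w (0 , 0) ≡ prefix i (0 , 0) w
suffix≡prefix i []      = refl
suffix≡prefix i (x ∷ w) = trans (cong (consK (kind i x)) (suffix≡prefix i w))
  (trans (sym (prefix-consK i (kind i x) (0 , 0) w)) (cong (λ l → prefix i l w) (consK≡snocK (kind i x))))

run-move : ∀ i {x} (k : Kind i x) l w r → run i (consK k l) w r ≡ run i l w (snocK k r)
run-move i k l []      r = refl
run-move i k l (y ∷ w) r = cong₂ _∷_
  (trans (newK-move k (kind i y) l _) (cong (newK (kind i y) l) (sym (suffix-snocK i k w r))))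
  (trans (cong (λ l → run i l w r) (consK-snocK k (kind i y) l)) (run-move i k _ w r))

-- The context of `x` lies on its right before the rotation and on its left afterwards, which makes
-- no difference by `newK-comm`. The other letters are covered by `run-move`.
run-rotate : ∀ i x w → ∃[ y ] ∃[ v ] run i (0 , 0) (x ∷ w) (0 , 0) ≡ y ∷ v × run i (0 , 0) (w ∷ʳ x) (0 , 0) ≡ v ∷ʳ y
run-rotate i x w = _ , _ , refl , trans (run-++ i (0 , 0) w (x ∷ []) (0 , 0)) (cong₂ _++_
  (trans (cong (run i (0 , 0) w) (consK≡snocK k)) (trans (sym (run-move i k (0 , 0) w (0 , 0)))
    (cong (λ l → run i l w (0 , 0)) (consK≡snocK k))))
  (cong (_∷ []) (trans (cong (λ l → newK k l (0 , 0)) (sym (suffix≡prefix i w))) (sym (newK-comm k _)))))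
  where k = kind i x

suffix-KnuthAt : ∀ i {n w w′} → KnuthAt n w w′ → ∀ r → suffix i w r ≡ suffix i w′ r
suffix-KnuthAt i (here {t} {t′} v k) r = trans (suffix-++ i t v r)
  (trans (proj₂ (proj₂ (run-Knuth i k (0 , 0) (suffix i v r)))) (sym (suffix-++ i t′ v r)))
suffix-KnuthAt i (there x s) r = cong (consK (kind i x)) (suffix-KnuthAt i s r)

run-KnuthAt : ∀ i {n w w′} → KnuthAt n w w′ → ∀ l r → KnuthAt n (run i l w r) (run i l w′ r)
run-KnuthAt i (here {t} {t′} v k) l r with run-Knuth i k l (suffix i v r)
... | k′ , p , _ = subst₂ (KnuthAt 0) (sym (run-++ i l t v r))
  (trans (cong (λ l′ → run i l t′ (suffix i v r) ++ run i l′ v r) p) (sym (run-++ i l t′ v r))) (here _ k′)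
run-KnuthAt i (there x {w} {w′} s) l r = subst (λ st → KnuthAt _ (run i l (x ∷ w) r) (newK (kind i x) l st ∷ run i _ w′ r))
  (suffix-KnuthAt i s r) (there _ (run-KnuthAt i s _ r))

sWord-equivariant : ∀ i → Equivariant (sWord i)
sWord-equivariant i {w = w} {w′} s rewrite sWord≡run i w | sWord≡run i w′ with s
... | knuth k = knuth (run-KnuthAt i k _ _)
... | rot x v with run-rotate i x v
...   | y , u , p , q = subst₂ (Step rotation) (sym p) (sym q) (rot y u)

Knuth-length₃ : ∀ {t t′} → Knuth t t′ → length t′ ≡ 3
Knuth-length₃ (swapʳ _) = refl
Knuth-length₃ (swapˡ _) = refl

++-injective : ∀ {u u′ v v′ : List ℕ} → length u ≡ length u′ → u ++ v ≡ u′ ++ v′ → u ≡ u′ × v ≡ v′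
++-injective {[]}    {[]}     _ e = refl , e
++-injective {x ∷ u} {y ∷ u′} l e with ++-injective (suc-injective l) (∷-injectiveʳ e)
... | p , q = cong₂ _∷_ (∷-injectiveˡ e) p , q

KnuthAt-cofunctional : ∀ {n u v w w′} → KnuthAt n u w → KnuthAt n v w′ → w ≡ w′ → u ≡ v
KnuthAt-cofunctional (here {t′ = t} v k) (here {t′ = t′} v′ k′) e
  with ++-injective {t} {t′} (trans (Knuth-length₃ k) (sym (Knuth-length₃ k′))) e
... | refl , refl = cong (_++ v) (Knuth-functional (Knuth-sym k) (Knuth-sym k′))
KnuthAt-cofunctional (there x s) (there y s′) e with ∷-injective e
... | refl , e′ = cong (x ∷_) (KnuthAt-cofunctional s s′ e′)

Step-cofunctional : ∀ {l u v w w′} → Step l u w → Step l v w′ → w ≡ w′ → u ≡ v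
Step-cofunctional (knuth s) (knuth s′) e = KnuthAt-cofunctional s s′ e
Step-cofunctional (rot x u) (rot y v)  e with ∷ʳ-injective u v e
... | refl , refl = refl

Knuth⇒↭ : ∀ {t t′} → Knuth t t′ → t ↭ t′
Knuth⇒↭ (swapʳ {p} {q} {r} _) = ↭.prep p (↭.swap q r ↭.refl)
Knuth⇒↭ (swapˡ {p} {q} {r} _) = ↭.swap p q ↭.refl

KnuthAt⇒↭ : ∀ {n w w′} → KnuthAt n w w′ → w ↭ w′
KnuthAt⇒↭ (here v k)  = ++⁺ʳ v (Knuth⇒↭ k)
KnuthAt⇒↭ (there x s) = ↭.prep x (KnuthAt⇒↭ s)

Step⇒↭ : ∀ {l w w′} → Step l w w′ → w ↭ w′
Step⇒↭ (knuth s) = KnuthAt⇒↭ s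
Step⇒↭ (rot x w) = ∷↭∷ʳ x w

-- Sorting words by Knuth moves and rotations

Sorted : List ℕ → Set
Sorted = Linked _≤_

_⟶ᴷ_ _⟶_ : List ℕ → List ℕ → Set
w ⟶ᴷ w′ = ∃[ n ] KnuthAt n w w′
w ⟶ w′  = ∃[ l ] Step l w w′

⟶ᴷ*-∷ : ∀ x {w w′} → Star _⟶ᴷ_ w w′ → Star _⟶ᴷ_ (x ∷ w) (x ∷ w′)
⟶ᴷ*-∷ x = gmap (x ∷_) (λ (n , s) → suc n , there x s)

⟶ᴷ*-++ : ∀ u {w w′} → Star _⟶ᴷ_ w w′ → Star _⟶ᴷ_ (u ++ w) (u ++ w′)
⟶ᴷ*-++ []      s = s
⟶ᴷ*-++ (x ∷ u) s = ⟶ᴷ*-∷ x (⟶ᴷ*-++ u s)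

⟶*⇒↭ : ∀ {w w′} → Star _⟶_ w w′ → w ↭ w′
⟶*⇒↭ ε             = ↭-refl
⟶*⇒↭ ((_ , s) ◅ p) = ↭-trans (Step⇒↭ s) (⟶*⇒↭ p)

move-left : ∀ {x y} r → x < y → Sorted (y ∷ r) → Star _⟶ᴷ_ (y ∷ r ∷ʳ x) (y ∷ x ∷ r)
move-left []      x<y s         = ε
move-left (z ∷ r) x<y (y≤z ∷ s) =
  ⟶ᴷ*-∷ _ (move-left r (<-≤-trans x<y y≤z) s) ◅◅ ((0 , here r (swapʳ (inj₂ (x<y , y≤z)))) ◅ ε)

∷-sorted : ∀ {x y r} → x ≤ y → Sorted (y ∷ r) → Sorted (x ∷ r)
∷-sorted x≤y [-]       = [-]
∷-sorted x≤y (y≤z ∷ s) = ≤-trans x≤y y≤z ∷ s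

-- Schensted row insertion of `x` into `r`, carried out by Knuth moves. `first≥` serves the
-- induction: when a letter `p` precedes the row, the move that carries the bumped letter across it
-- requires `p ≤ first`.
record Bump (x : ℕ) (r : List ℕ) : Set where
  field
    bumped first : ℕ
    rest         : List ℕ
    reach        : Star _⟶ᴷ_ (r ∷ʳ x) (bumped ∷ first ∷ rest)
    sorted       : Sorted (first ∷ rest)
    first<       : first < bumped
    first≥       : ∀ p → p ≤ x → Sorted (p ∷ r) → p ≤ first
    decrease     : sum (first ∷ rest) < sum r

rowInsert : ∀ x r → Sorted r → Sorted (r ∷ʳ x) ⊎ Bump x r
rowInsert x []      s = inj₁ [-]
rowInsert x (p ∷ r) s with p ≤? x
... | no p≰x = inj₂ record
  { bumped   = p
  ; first    = x
  ; rest     = r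
  ; reach    = move-left r (≰⇒> p≰x) s
  ; sorted   = ∷-sorted (<⇒≤ (≰⇒> p≰x)) s
  ; first<   = ≰⇒> p≰x
  ; first≥   = λ _ q≤x _ → q≤x
  ; decrease = +-monoˡ-< (sum r) (≰⇒> p≰x)
  }
... | yes p≤x with r | s
...   | []    | _ = inj₁ (p≤x ∷ [-])
...   | q ∷ r | p≤q ∷ s′ with rowInsert x (q ∷ r) s′
...     | inj₁ s″ = inj₁ (p≤q ∷ s″)
...     | inj₂ b  = inj₂ record
  { bumped   = bumped
  ; first    = p
  ; rest     = first ∷ rest
  ; reach    = ⟶ᴷ*-∷ p reach ◅◅ ((0 , here rest (swapˡ (inj₁ (p≤first , first<)))) ◅ ε)
  ; sorted   = p≤first ∷ sorted
  ; first<   = ≤-<-trans p≤first first<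
  ; first≥   = λ { _ _ (p′≤p ∷ _) → p′≤p }
  ; decrease = +-monoʳ-< p decrease
  }
  where
  open Bump b
  p≤first = first≥ p p≤x (p≤q ∷ s′)

_⟶*Sorted : List ℕ → Set
w ⟶*Sorted = ∃[ z ] Sorted z × Star _⟶_ w z

extend : ∀ {w w′} → Star _⟶_ w w′ → w′ ⟶*Sorted → w ⟶*Sorted
extend p (z , s , q) = z , s , p ◅◅ q

-- Knuth moves and rotations carry v letter by letter into the row r. A bumped
-- letter returns to v, but then the sum of the row has dropped.
++⟶*Sorted : ∀ n v r → length v ≡ n → Sorted r → Acc _<_ (sum r) → (v ++ r) ⟶*Sorted
++⟶*Sorted _       []      r _ s _         = r , s , ε
++⟶*Sorted (suc n) (x ∷ v) r e s (acc rec) = [ (λ s′ → extend (subst (Star _⟶_ _) (++-assoc v r (x ∷ [])) ((rotation , rot x (v ++ r)) ◅ ε))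
  (++⟶*Sorted n v (r ∷ʳ x) (suc-injective e) s′ (<-wellFounded _))) , (λ b → extend
  (subst (Star _⟶_ _) (++-assoc v r (x ∷ [])) ((rotation , rot x (v ++ r)) ◅ ε)
    ◅◅ gmap id (λ (n , s) → position n , knuth s) (⟶ᴷ*-++ v (Bump.reach b)))
  (subst _⟶*Sorted (++-assoc v (Bump.bumped b ∷ []) _)
    (++⟶*Sorted (suc n) (v ∷ʳ Bump.bumped b) (Bump.first b ∷ Bump.rest b)
      (trans (trans (length-++ v) (+-comm (length v) 1)) e) (Bump.sorted b) (rec (Bump.decrease b))))) ]′ (rowInsert x r s)

sort : ∀ w → w ⟶*Sorted
sort w = subst _⟶*Sorted (++-identityʳ w) (++⟶*Sorted (length w) w [] refl [] (<-wellFounded _))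

-- By induction `f w` and `w` have steps with the same label to the same word, and the label and the
-- target of a step determine its source.
fixed-⟵ : ∀ {f} → Equivariant f → ∀ {w z} → Star _⟶_ w z → f z ≡ z → f w ≡ w
fixed-⟵ eqv ε             e = e
fixed-⟵ eqv ((l , s) ◅ p) e = Step-cofunctional (eqv s) s (fixed-⟵ eqv p e)

⟶*-map : ∀ {f} → Equivariant f → ∀ {w z} → Star _⟶_ w z → Star _⟶_ (f w) (f z)
⟶*-map {f} eqv = gmap f (λ (l , s) → l , eqv s)

-- Contents of words

count : ℕ → List ℕ → ℕ
count x w = length (filter (_≟ x) w)

count-≡ : ∀ x w → count x (x ∷ w) ≡ suc (count x w)
count-≡ x w = cong length (filter-accept (_≟ x) refl)

count-≢ : ∀ {x y} w → y ≢ x → count x (y ∷ w) ≡ count x w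
count-≢ {x} w y≢x = cong length (filter-reject (_≟ x) y≢x)

count-↭ : ∀ x {w w′} → w ↭ w′ → count x w ≡ count x w′
count-↭ x p = ↭-length (filter-↭ (_≟ x) p)

count-∷-cong : ∀ x y {w w′} → count x w ≡ count x w′ → count x (y ∷ w) ≡ count x (y ∷ w′)
count-∷-cong x y {w} {w′} e with y ≟ x
... | yes refl = trans (count-≡ x w) (trans (cong suc e) (sym (count-≡ x w′)))
... | no y≢x   = trans (count-≢ w y≢x) (trans e (sym (count-≢ w′ y≢x)))

count-≤-∷ : ∀ x y w → count x w ≤ count x (y ∷ w)
count-≤-∷ x y w with y ≟ x
... | yes refl = ≤-trans (n≤1+n _) (≤-reflexive (sym (count-≡ x w)))
... | no y≢x   = ≤-reflexive (sym (count-≢ w y≢x))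

count-below-sorted : ∀ {x y} w → Sorted (y ∷ w) → x < y → count x (y ∷ w) ≡ 0
count-below-sorted []      _         x<y = count-≢ [] (<⇒≢ x<y ∘ sym)
count-below-sorted (z ∷ w) (y≤z ∷ s) x<y =
  trans (count-≢ (z ∷ w) (<⇒≢ x<y ∘ sym)) (count-below-sorted w s (<-≤-trans x<y y≤z))

sorted-tail : ∀ {x w} → Sorted (x ∷ w) → Sorted w
sorted-tail [-]     = []
sorted-tail (_ ∷ s) = s

sorted-unique : ∀ {w w′} → Sorted w → Sorted w′ → (∀ x → count x w ≡ count x w′) → w ≡ w′
sorted-unique {[]}    {[]}     _ _ e = refl
sorted-unique {[]}    {y ∷ w′} _ _ e with () ← trans (e y) (count-≡ y w′)
sorted-unique {x ∷ w} {[]}     _ _ e with () ← trans (sym (e x)) (count-≡ x w)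
sorted-unique {x ∷ w} {y ∷ w′} s s′ e with <-cmp x y
... | tri< x<y _ _ with () ← trans (sym (count-≡ x w)) (trans (e x) (count-below-sorted w′ s′ x<y))
... | tri> _ _ y<x with () ← trans (sym (count-≡ y w′)) (trans (sym (e y)) (count-below-sorted w s y<x))
... | tri≈ _ refl _ = cong (x ∷_) (sorted-unique (sorted-tail s) (sorted-tail s′) tails)
  where
  tails : ∀ z → count z w ≡ count z w′
  tails z with x ≟ z
  ... | yes refl = suc-injective (trans (sym (count-≡ z w)) (trans (e z) (count-≡ z w′)))
  ... | no x≢z   = trans (sym (count-≢ w x≢z)) (trans (e z) (count-≢ w′ x≢z))

run-sorted : ∀ i l {w} r → Sorted w → Sorted (run i l w r)
run-sorted i l r []                = []
run-sorted i l r [-]               = [-]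
run-sorted i l r (_∷_ {x} {y} {w} x≤y s) =
  newK-mono-≤ (kind i x) (kind i y) l (suffix i w r) x≤y ∷ run-sorted i _ r s

sWord-sorted : ∀ i {w} → Sorted w → Sorted (sWord i w)
sWord-sorted i {w} s = subst Sorted (sym (sWord≡run i w)) (run-sorted i _ _ s)

module _ (i : ℕ) where

  i≢1+i : i ≢ suc i
  i≢1+i = <⇒≢ ≤-refl

  pairCount : List ℕ → ℕ
  pairCount w = count i w + count (suc i) w

  pairCount-i : ∀ w → pairCount (i ∷ w) ≡ suc (pairCount w)
  pairCount-i w = cong₂ _+_ (count-≡ i w) (count-≢ w i≢1+i)

  pairCount-1+i : ∀ w → pairCount (suc i ∷ w) ≡ suc (pairCount w)
  pairCount-1+i w = trans (cong₂ _+_ (count-≢ w (i≢1+i ∘ sym)) (count-≡ (suc i) w)) (+-suc (count i w) _)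

  choose-cases : ∀ {P : Set} (d : Dec P) m n → choose {i} d m n ≡ m ⊎ choose {i} d m n ≡ n
  choose-cases (yes _) m n = inj₁ refl
  choose-cases (no _)  m n = inj₂ refl

  newK-closing-cases : ∀ l r → newK (closing {i}) l r ≡ i ⊎ newK (closing {i}) l r ≡ suc i
  newK-closing-cases (a , zero)  (_ , b) = Sum.swap (choose-cases (b ≤? a) (suc i) i)
  newK-closing-cases (_ , suc _) r       = inj₁ refl

  newK-opening-cases : ∀ l r → newK (opening {i}) l r ≡ i ⊎ newK (opening {i}) l r ≡ suc i
  newK-opening-cases (a , _) (zero , b)  = choose-cases (a ≤? b) i (suc i)
  newK-opening-cases _       (suc _ , _) = inj₂ refl

  pairCount-cases : ∀ {x} w → x ≡ i ⊎ x ≡ suc i → pairCount (x ∷ w) ≡ suc (pairCount w)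
  pairCount-cases w (inj₁ refl) = pairCount-i w
  pairCount-cases w (inj₂ refl) = pairCount-1+i w

  pairCount-run : ∀ l w r → pairCount (run i l w r) ≡ pairCount w
  pairCount-run l []      r = refl
  pairCount-run l (x ∷ w) r with kind i x
  ... | closing = trans (pairCount-cases _ (newK-closing-cases l (suffix i w r)))
                    (trans (cong suc (pairCount-run _ w r)) (sym (pairCount-i w)))
  ... | opening = trans (pairCount-cases _ (newK-opening-cases l (suffix i w r)))
                    (trans (cong suc (pairCount-run _ w r)) (sym (pairCount-1+i w)))
  ... | neutral p q = trans (cong₂ _+_ (count-≢ _ p) (count-≢ _ q))
                    (trans (pairCount-run _ w r) (sym (cong₂ _+_ (count-≢ _ p) (count-≢ _ q))))

  count-other-cases : ∀ {x y} w → x ≢ i → x ≢ suc i → y ≡ i ⊎ y ≡ suc i → count x (y ∷ w) ≡ count x w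
  count-other-cases w p q (inj₁ refl) = count-≢ w (p ∘ sym)
  count-other-cases w p q (inj₂ refl) = count-≢ w (q ∘ sym)

  count-run-other : ∀ {x} → x ≢ i → x ≢ suc i → ∀ l w r → count x (run i l w r) ≡ count x w
  count-run-other p q l []      r = refl
  count-run-other p q l (y ∷ w) r with kind i y
  ... | closing = trans (count-other-cases _ p q (newK-closing-cases l (suffix i w r)))
                    (trans (count-run-other p q _ w r) (sym (count-other-cases w p q (inj₁ refl))))
  ... | opening = trans (count-other-cases _ p q (newK-opening-cases l (suffix i w r)))
                    (trans (count-run-other p q _ w r) (sym (count-other-cases w p q (inj₂ refl))))
  ... | neutral _ _ = count-∷-cong _ y {run i l w r} {w} (count-run-other p q l w r)

  closes-above : ∀ {w} → All (i <_) w → suffix i w (0 , 0) ≡ (0 , count (suc i) w)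
  closes-above []              = refl
  closes-above {x ∷ w} (i<x ∷ a) with kind i x
  ... | closing     = ⊥-elim (<-irrefl refl i<x)
  ... | opening     rewrite closes-above a = cong (0 ,_) (sym (count-≡ (suc i) w))
  ... | neutral _ q = trans (closes-above a) (cong (0 ,_) (sym (count-≢ w q)))

  count-run-above : ∀ {w} → All (i <_) w → ∀ a b → count i (run i (a , b) w (0 , 0)) ≡ count (suc i) w ∸ a
  count-run-above []              a b = sym (0∸n≡0 a)
  count-run-above {x ∷ w} (i<x ∷ all) a b with kind i x
  ... | closing     = ⊥-elim (<-irrefl refl i<x)
  ... | neutral p q = trans (count-≢ _ p) (trans (count-run-above all a b) (cong (_∸ a) (sym (count-≢ w q))))
  ... | opening rewrite closes-above all | count-≡ (suc i) w with a ≤? count (suc i) w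
  ...   | yes a≤ = trans (count-≡ i _) (trans (cong suc (count-run-above all a (suc b))) (sym (+-∸-assoc 1 a≤)))
  ...   | no a≰  = trans (count-≢ _ (i≢1+i ∘ sym)) (trans (count-run-above all a (suc b))
                     (trans (m≤n⇒m∸n≡0 (<⇒≤ (≰⇒> a≰))) (sym (m≤n⇒m∸n≡0 (≰⇒> a≰)))))

  sorted-above : ∀ {x w} → i < x → Sorted (x ∷ w) → All (i <_) (x ∷ w)
  sorted-above i<x [-]       = i<x ∷ []
  sorted-above i<x (x≤y ∷ s) = i<x ∷ sorted-above (<-≤-trans i<x x≤y) s

  opens-sorted : ∀ {w} → Sorted w → proj₂ (suffix i w (0 , 0)) ≡ count (suc i) w
  opens-sorted {[]} s = refl
  opens-sorted {x ∷ w} s with i <? x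
  ... | yes i<x = cong proj₂ (closes-above (sorted-above i<x s))
  ... | no i≮x with kind i x
  ...   | closing     = trans (opens-sorted (sorted-tail s)) (sym (count-≢ w i≢1+i))
  ...   | opening     = ⊥-elim (i≮x ≤-refl)
  ...   | neutral _ q = trans (opens-sorted (sorted-tail s)) (sym (count-≢ w q))

  count-run-sorted : ∀ {w} → Sorted w → ∀ a → count i (run i (a , 0) w (0 , 0)) ≡ count (suc i) w ∸ a
  count-run-sorted {[]}    s a = sym (0∸n≡0 a)
  count-run-sorted {x ∷ w} s a with i <? x
  ... | yes i<x = count-run-above (sorted-above i<x s) a 0
  ... | no i≮x with kind i x
  ...   | opening     = ⊥-elim (i≮x ≤-refl)
  ...   | neutral p q = trans (count-≢ _ p) (trans (count-run-sorted (sorted-tail s) a) (cong (_∸ a) (sym (count-≢ w q))))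
  ...   | closing     with suffix i w (0 , 0) | opens-sorted (sorted-tail s)
  ...     | _ , _ | refl rewrite count-≢ w i≢1+i with count (suc i) w ≤? a
  ...       | yes p≤a = trans (count-≢ _ (i≢1+i ∘ sym)) (trans (count-run-sorted (sorted-tail s) (suc a))
                     (trans (m≤n⇒m∸n≡0 (m≤n⇒m≤1+n p≤a)) (sym (m≤n⇒m∸n≡0 p≤a))))
  ...       | no p≰a  = trans (count-≡ i _) (trans (cong suc (count-run-sorted (sorted-tail s) (suc a))) (sym (+-∸-assoc 1 (≰⇒> p≰a))))

  -- Steps permute letters, so it is enough to look at a sorted word. There all `i` precede all
  -- `i + 1`, and nothing is matched.
  sWord-count-i : ∀ w → count i (sWord i w) ≡ count (suc i) w
  sWord-count-i w with sort w
  ... | z , s , p = trans (count-↭ i (⟶*⇒↭ (⟶*-map (sWord-equivariant i) p)))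
    (trans (cong (count i) (sWord≡run i z)) (trans (count-run-sorted s 0) (sym (count-↭ (suc i) (⟶*⇒↭ p)))))

  sWord-count-1+i : ∀ w → count (suc i) (sWord i w) ≡ count i w
  sWord-count-1+i w = +-cancelˡ-≡ (count (suc i) w) _ _ (trans
    (cong (_+ count (suc i) (sWord i w)) (sym (sWord-count-i w)))
    (trans (cong pairCount (sWord≡run i w)) (trans (pairCount-run _ w _) (+-comm (count i w) _))))

  sWord-count-other : ∀ {x} → x ≢ i → x ≢ suc i → ∀ w → count x (sWord i w) ≡ count x w
  sWord-count-other p q w = trans (cong (count _) (sWord≡run i w)) (count-run-other p q _ w _)

-- Every word is connected to a sorted one, which is determined by its content.
equivariant-fixes : ∀ {f} → Equivariant f → (∀ {z} → Sorted z → Sorted (f z)) →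
  (∀ z x → count x (f z) ≡ count x z) → ∀ w → f w ≡ w
equivariant-fixes eqv srt cnt w with sort w
... | z , s , p = fixed-⟵ eqv p (sorted-unique (srt s) s (cnt z))

sWord-involutive : ∀ i w → sWord i (sWord i w) ≡ w
sWord-involutive i = equivariant-fixes (λ s → sWord-equivariant i (sWord-equivariant i s))
  (λ s → sWord-sorted i (sWord-sorted i s)) cnt
  where
  cnt : ∀ w x → count x (sWord i (sWord i w)) ≡ count x w
  cnt w x with kind i x
  ... | closing     = trans (sWord-count-i i (sWord i w)) (sWord-count-1+i i w)
  ... | opening     = trans (sWord-count-1+i i (sWord i w)) (sWord-count-i i w)
  ... | neutral p q = trans (sWord-count-other i p q (sWord i w)) (sWord-count-other i p q w)

-- Rotation of contents and the order of `cWord`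

Rotates : ℕ → (ℕ → ℕ) → (ℕ → ℕ) → Set
Rotates n m m′ = m′ 1 ≡ m n × (∀ v → 1 ≤ v → v < n → m′ (suc v) ≡ m v)

module _ {n : ℕ} (m : ℕ → ℕ → ℕ) (rotates : ∀ k → Rotates n (m k) (m (suc k))) where

  rotate-shift : ∀ k a v → 1 ≤ v → k + v ≤ n → m (k + a) (k + v) ≡ m a v
  rotate-shift zero    a v 1≤v _     = refl
  rotate-shift (suc k) a v 1≤v k+v<n = trans
    (proj₂ (rotates (k + a)) (k + v) (≤-trans 1≤v (m≤n+m v k)) k+v<n)
    (rotate-shift k a v 1≤v (<⇒≤ k+v<n))

  -- The multiplicity of a letter `x` reaches `n` after `n - x` rotations, wraps around to 1 with
  -- the next one and is back at `x` after another `x - 1`.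
  rotate-period : ∀ v → 1 ≤ v → v ≤ n → m n v ≡ m 0 v
  rotate-period (suc v) 1≤v v<n = begin
    m n (suc v)                                 ≡⟨ cong₂ m (sym (m+[n∸m]≡n v<n)) (+-comm 1 v) ⟩
    m (suc (v + (n ∸ suc v))) (v + 1)           ≡⟨ cong (λ k → m k (v + 1)) (sym (+-suc v _)) ⟩
    m (v + suc (n ∸ suc v)) (v + 1)             ≡⟨ rotate-shift v _ 1 ≤-refl (subst (_≤ n) (+-comm 1 v) v<n) ⟩
    m (suc (n ∸ suc v)) 1                       ≡⟨ proj₁ (rotates (n ∸ suc v)) ⟩
    m (n ∸ suc v) n                             ≡⟨ cong₂ m (sym (+-identityʳ _)) (sym (m∸n+n≡m v<n)) ⟩
    m (n ∸ suc v + 0) (n ∸ suc v + suc v)       ≡⟨ rotate-shift (n ∸ suc v) 0 (suc v) 1≤v (≤-reflexive (m∸n+n≡m v<n)) ⟩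
    m 0 (suc v)                                 ∎
    where open ≡-Reasoning

cWord : ℕ → List ℕ → List ℕ
cWord n w = foldr sWord w (applyUpTo suc (n ∸ 1))

-- The reflections act from the highest letters downwards. The multiplicity of `N + j` is handed
-- down to `j`, and each one that it passes moves up by one.
foldr-sWord-count : ∀ N j (f : ℕ → ℕ) → (∀ k → f k ≡ k + j) → ∀ w → let u = foldr sWord w (applyUpTo f N) in
  count j u ≡ count (N + j) w × (∀ k → k < N → count (suc (k + j)) u ≡ count (k + j) w) ×
  (∀ x → x < j ⊎ N + j < x → count x u ≡ count x w)
foldr-sWord-count zero    j f h w = refl , (λ k ()) , (λ _ _ → refl)
foldr-sWord-count (suc N) j f h w
  rewrite h 0 with foldr-sWord-count N (suc j) (f ∘ suc) (λ k → trans (h (suc k)) (sym (+-suc k j))) w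
... | first , middle , other =
    trans (sWord-count-i j u) (trans first (cong (λ k → count k w) (+-suc N j)))
  , mid
  , λ x → λ { (inj₁ x<j) → trans (sWord-count-other j (<⇒≢ x<j) (<⇒≢ (m<n⇒m<1+n x<j)) u) (other x (inj₁ (m<n⇒m<1+n x<j)))
            ; (inj₂ h<x) → trans (sWord-count-other j (<⇒≢ (≤-<-trans (m≤n+m j (suc N)) h<x) ∘ sym)
                               (<⇒≢ (≤-<-trans (s≤s (m≤n+m j N)) h<x) ∘ sym) u)
                             (other x (inj₂ (subst (_< x) (sym (+-suc N j)) h<x))) }
  where
  u = foldr sWord w (applyUpTo (f ∘ suc) N)
  mid : ∀ k → k < suc N → count (suc (k + j)) (sWord j u) ≡ count (k + j) w
  mid zero    _         = trans (sWord-count-1+i j u) (other j (inj₁ ≤-refl))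
  mid (suc k) (s≤s k<N) = trans
    (sWord-count-other j (<⇒≢ (s≤s (m≤n+m j (suc k))) ∘ sym) (<⇒≢ (s≤s (s≤s (m≤n+m j k))) ∘ sym) u)
    (subst (λ v → count (suc v) u ≡ count v w) (+-suc k j) (middle k k<N))

cWord-rotates : ∀ n → 1 ≤ n → ∀ w → Rotates n (λ x → count x w) (λ x → count x (cWord n w))
cWord-rotates (suc N) _ w with foldr-sWord-count N 1 suc (λ k → +-comm 1 k) w
... | first , middle , _ = trans first (cong (λ k → count k w) (+-comm N 1))
  , λ { (suc v) _ (s≤s v<N) → subst (λ x → count (suc x) (cWord (suc N) w) ≡ count x w) (+-comm v 1) (middle v v<N) }

cWord-count-other : ∀ n → 1 ≤ n → ∀ w x → x < 1 ⊎ n < x → count x (cWord n w) ≡ count x w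
cWord-count-other (suc N) _ w x h with foldr-sWord-count N 1 suc (λ k → +-comm 1 k) w
... | _ , _ , other = other x (Sum.map₂ (subst (_< x) (+-comm 1 N)) h)

foldr-sWord-equivariant : ∀ is → Equivariant (λ w → foldr sWord w is)
foldr-sWord-equivariant []       s = s
foldr-sWord-equivariant (i ∷ is) s = sWord-equivariant i (foldr-sWord-equivariant is s)

foldr-sWord-sorted : ∀ is {w} → Sorted w → Sorted (foldr sWord w is)
foldr-sWord-sorted []       s = s
foldr-sWord-sorted (i ∷ is) s = sWord-sorted i (foldr-sWord-sorted is s)

^-equivariant : ∀ {f} → Equivariant f → ∀ k → Equivariant (f ^ʷ k)
^-equivariant e zero    s = s
^-equivariant e (suc k) s = e (^-equivariant e k s)

^-sorted : ∀ {f} → (∀ {w} → Sorted w → Sorted (f w)) → ∀ k {w} → Sorted w → Sorted ((f ^ʷ k) w)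
^-sorted e zero    s = s
^-sorted e (suc k) s = e (^-sorted e k s)

cWord^n : ∀ n → 1 ≤ n → ∀ w → (cWord n ^ʷ n) w ≡ w
cWord^n n 1≤n = equivariant-fixes (^-equivariant (foldr-sWord-equivariant (applyUpTo suc (n ∸ 1))) n)
  (^-sorted (foldr-sWord-sorted (applyUpTo suc (n ∸ 1))) n) cnt
  where
  outside : ∀ x → x < 1 ⊎ n < x → ∀ k w → count x ((cWord n ^ʷ k) w) ≡ count x w
  outside x h zero    w = refl
  outside x h (suc k) w = trans (cWord-count-other n 1≤n _ x h) (outside x h k w)
  cnt : ∀ w x → count x ((cWord n ^ʷ n) w) ≡ count x w
  cnt w x with 1 ≤? x | x ≤? n
  ... | no 1≰x  | _       = outside x (inj₁ (≰⇒> 1≰x)) n w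
  ... | yes _   | no x≰n  = outside x (inj₂ (≰⇒> x≰n)) n w
  ... | yes 1≤x | yes x≤n = rotate-period (λ k x → count x ((cWord n ^ʷ k) w)) (λ k → cWord-rotates n 1≤n _) x 1≤x x≤n

-- Reflections of tableaux

-- Keeps the rows apart, whereas `s` joins them to one word and cuts it again. The rows are listed
-- in reading order, from the bottom.
runRows : ℕ → State → List (List ℕ) → State → List (List ℕ)
runRows i l []      r = []
runRows i l (L ∷ R) r = run i l L (suffix i (concat R) r) ∷ runRows i (prefix i l L) R r

concat-runRows : ∀ i l R r → concat (runRows i l R r) ≡ run i l (concat R) r
concat-runRows i l []      r = refl
concat-runRows i l (L ∷ R) r = trans (cong (run i l L (suffix i (concat R) r) ++_) (concat-runRows i _ R r)) (sym (run-++ i l L (concat R) r))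

map-length-runRows : ∀ i l R r → map length (runRows i l R r) ≡ map length R
map-length-runRows i l []      r = refl
map-length-runRows i l (L ∷ R) r = cong₂ _∷_ (length-run i l L _) (map-length-runRows i _ R r)

splitRows-concat : ∀ R → splitRows (map length R) (concat R) ≡ R
splitRows-concat []      = refl
splitRows-concat (L ∷ R) = cong₂ _∷_ (take-length L) (trans (cong (splitRows (map length R)) (drop-length L)) (splitRows-concat R))
  where
  take-length : ∀ (xs : List ℕ) {ys} → take (length xs) (xs ++ ys) ≡ xs
  take-length []       = refl
  take-length (x ∷ xs) = cong (x ∷_) (take-length xs)
  drop-length : ∀ (xs : List ℕ) {ys} → drop (length xs) (xs ++ ys) ≡ ys
  drop-length []       = refl
  drop-length (x ∷ xs) = drop-length xs

reading : Filling → List ℕ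
reading T = concat (reverse T)

s≡runRows : ∀ i T → s i T ≡ reverse (runRows i (0 , 0) (reverse T) (0 , 0))
s≡runRows i T = cong reverse (trans
  (cong₂ splitRows (sym (map-length-runRows i _ (reverse T) _))
    (trans (sWord≡run i (reading T)) (sym (concat-runRows i _ (reverse T) _))))
  (splitRows-concat _))

reading-s : ∀ i T → reading (s i T) ≡ sWord i (reading T)
reading-s i T = trans (cong reading (s≡runRows i T)) (trans (cong concat (reverse-involutive (runRows i (0 , 0) (reverse T) (0 , 0))))
  (trans (concat-runRows i (0 , 0) (reverse T) (0 , 0)) (sym (sWord≡run i (reading T)))))

shape-s : ∀ i T → map length (s i T) ≡ map length T
shape-s i T = begin
  map length (s i T)                                              ≡⟨ cong (map length) (s≡runRows i T) ⟩
  map length (reverse (runRows i (0 , 0) (reverse T) (0 , 0)))    ≡⟨ reverse-map length (runRows i (0 , 0) (reverse T) (0 , 0)) ⟩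
  reverse (map length (runRows i (0 , 0) (reverse T) (0 , 0)))    ≡⟨ cong reverse (map-length-runRows i _ (reverse T) _) ⟩
  reverse (map length (reverse T))                                ≡⟨ cong reverse (reverse-map length T) ⟩
  reverse (reverse (map length T))                                ≡⟨ reverse-involutive _ ⟩
  map length T                                                    ∎
  where open ≡-Reasoning

concat-injective : ∀ {R R′ : List (List ℕ)} → map length R ≡ map length R′ → concat R ≡ concat R′ → R ≡ R′
concat-injective {[]}    {[]}      _ _ = refl
concat-injective {L ∷ R} {L′ ∷ R′} h e with ++-injective {L} {L′} (∷-injectiveˡ h) e
... | refl , e′ = cong (L ∷_) (concat-injective (∷-injectiveʳ h) e′)

reading-injective : ∀ {T T′} → map length T ≡ map length T′ → reading T ≡ reading T′ → T ≡ T′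
reading-injective {T} {T′} h e = trans (sym (reverse-involutive T)) (trans
  (cong reverse (concat-injective (trans (reverse-map length T) (trans (cong reverse h) (sym (reverse-map length T′)))) e))
  (reverse-involutive T′))

concat-↭ : ∀ {R R′ : List (List ℕ)} → R ↭ R′ → concat R ↭ concat R′
concat-↭ ↭.refl          = ↭.refl
concat-↭ (↭.prep L p)    = ++⁺ˡ L (concat-↭ p)
concat-↭ (↭.swap {R} {R′} L L′ p) = ↭-trans (shifts L L′ {concat R}) (++⁺ˡ L′ (++⁺ˡ L (concat-↭ p)))
concat-↭ (↭.trans p q)   = ↭-trans (concat-↭ p) (concat-↭ q)

reading-↭ : ∀ T → reading T ↭ concat T
reading-↭ T = concat-↭ (↭-reverse T)

Linked-ʳ++ : ∀ {A : Set} {R : A → A → Set} {x xs ys} → Linked R (x ∷ xs) → Linked (flip R) (x ∷ ys) → Linked (flip R) (xs ʳ++ (x ∷ ys))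
Linked-ʳ++ [-]     s = s
Linked-ʳ++ (r ∷ p) s = Linked-ʳ++ p (r ∷ s)

Linked-reverse : ∀ {A : Set} {R : A → A → Set} {xs} → Linked R xs → Linked (flip R) (reverse xs)
Linked-reverse []        = []
Linked-reverse s@[-]     = Linked-ʳ++ s [-]
Linked-reverse s@(_ ∷ _) = Linked-ʳ++ s [-]

All-reverse : ∀ {A : Set} {P : A → Set} {xs} → All P xs → All P (reverse xs)
All-reverse {xs = xs} = All-resp-↭ (↭-sym (↭-reverse xs))

module _ (i : ℕ) where

  opens-prefix-above : ∀ {w} → All (i <_) w → ∀ l → proj₂ l + count (suc i) w ≤ proj₂ (prefix i l w)
  opens-prefix-above []                   l       = ≤-reflexive (+-identityʳ _)
  opens-prefix-above {x ∷ w} (i<x ∷ all) l@(a , b) with kind i x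
  ... | closing     = ⊥-elim (<-irrefl refl i<x)
  ... | opening     = ≤-trans (≤-reflexive (trans (cong (b +_) (count-≡ (suc i) w)) (+-suc b _))) (opens-prefix-above all (a , suc b))
  ... | neutral _ q = ≤-trans (≤-reflexive (cong (b +_) (count-≢ w q))) (opens-prefix-above all l)

  -- In a row every `i` comes before every `i + 1`, so no `i + 1` is closed within its own row.
  opens-prefix-sorted : ∀ {w} → Sorted w → ∀ l → count (suc i) w ≤ proj₂ (prefix i l w)
  opens-prefix-sorted {[]}    s l = z≤n
  opens-prefix-sorted {x ∷ w} s l with i <? x
  ... | yes i<x = ≤-trans (m≤n+m _ (proj₂ l)) (opens-prefix-above (sorted-above i i<x s) l)
  ... | no i≮x with kind i x
  ...   | closing     = ≤-trans (≤-reflexive (count-≢ w (i≢1+i i))) (opens-prefix-sorted (sorted-tail s) _)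
  ...   | opening     = ⊥-elim (i≮x ≤-refl)
  ...   | neutral _ q = ≤-trans (≤-reflexive (count-≢ w q)) (opens-prefix-sorted (sorted-tail s) l)

  closes-suffix-sorted : ∀ {w} → Sorted w → ∀ r → count i w ≤ proj₁ (suffix i w r)
  closes-suffix-sorted {[]}    s r = z≤n
  closes-suffix-sorted {x ∷ w} s r with i <? x
  ... | yes i<x = ≤-trans (≤-reflexive (count-below-sorted w s i<x)) z≤n
  ... | no i≮x with kind i x
  ...   | closing     = ≤-trans (≤-reflexive (count-≡ i w)) (s≤s (closes-suffix-sorted (sorted-tail s) r))
  ...   | opening     = ⊥-elim (i≮x ≤-refl)
  ...   | neutral p _ = ≤-trans (≤-reflexive (count-≢ w p)) (closes-suffix-sorted (sorted-tail s) r)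

  -- Each `i + 1` in `w` uses up at most one closing parenthesis of `r`.
  closes-suffix : ∀ w r → proj₁ r ≤ proj₁ (suffix i w r) + count (suc i) w
  closes-suffix []      r = m≤m+n _ 0
  closes-suffix (x ∷ w) r with kind i x
  ... | closing     = m≤n⇒m≤1+n (subst (λ k → proj₁ r ≤ proj₁ (suffix i w r) + k) (sym (count-≢ w (i≢1+i i))) (closes-suffix w r))
  ... | neutral _ q = subst (λ k → proj₁ r ≤ proj₁ (suffix i w r) + k) (sym (count-≢ w q)) (closes-suffix w r)
  ... | opening     with suffix i w r | closes-suffix w r
  ...   | zero , _  | h = subst (proj₁ r ≤_) (sym (count-≡ (suc i) w)) (m≤n⇒m≤1+n h)
  ...   | suc a , _ | h = ≤-trans h (≤-reflexive (trans (sym (+-suc a _)) (cong (a +_) (sym (count-≡ (suc i) w)))))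

  count-columns : ∀ {L U} → Prefix _>_ L U → All (i ≤_) U → count (suc i) L ≤ count i U
  count-columns [] _ = z≤n
  count-columns (_∷_ {d} {u} {L} {U} d>u p) (i≤u ∷ all) with d ≟ suc i
  ... | no d≢  = ≤-trans (≤-reflexive (count-≢ L d≢)) (≤-trans (count-columns p all) (count-≤-∷ i u U))
  ... | yes refl with refl ← ≤-antisym i≤u (s≤s⁻¹ d>u) =
    ≤-trans (≤-reflexive (count-≡ (suc i) L)) (≤-trans (s≤s (count-columns p all)) (≤-reflexive (sym (count-≡ i U))))

  sorted-≥ : ∀ {x w} → i ≤ x → Sorted (x ∷ w) → All (i ≤_) w
  sorted-≥ i≤x [-]       = []
  sorted-≥ i≤x (x≤y ∷ s) = ≤-trans i≤x x≤y ∷ sorted-≥ (≤-trans i≤x x≤y) s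

  newK-matched : ∀ l r l′ r′ → 0 < proj₂ l → 0 < proj₁ r′ → newK (closing {i}) l r < newK (opening {i}) l′ r′
  newK-matched (_ , suc _) r l′ (suc _ , _) _ _ = ≤-refl

  -- If i stands above i + 1, then the block of i + 1 in the lower row starts and
  -- ends within the columns of the block of i in the upper row, so both are matched.
  run-columns : ∀ {L U} lL rL lU rU → Prefix _>_ L U → Sorted L → Sorted U →
    count (suc i) L ≤ proj₂ lU → count i U ≤ proj₁ rL →
    Prefix _>_ (run i lL L rL) (run i lU U rU)
  run-columns lL rL lU rU [] sL sU hL hU = []
  run-columns {d ∷ L} {u ∷ U} lL rL lU rU (d>u ∷ p) sL sU hL hU =
    column (kind i d) (kind i u) d>u hL hU sU ∷ run-columns _ _ _ _ p (sorted-tail sL) (sorted-tail sU)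
      (next (kind i d) (kind i u) lU d>u hL sL) (≤-trans (count-≤-∷ i u U) hU)
    where
    next : ∀ {d u} (kd : Kind i d) (ku : Kind i u) lU → u < d → count (suc i) (d ∷ L) ≤ proj₂ lU → Sorted (d ∷ L) →
      count (suc i) L ≤ proj₂ (snocK ku lU)
    next closing       closing lU u<d h s = ⊥-elim (<-irrefl refl u<d)
    next opening       closing (_ , b) u<d h s with b | ≤-trans (≤-reflexive (sym (count-≡ (suc i) L))) h
    ... | suc b | s≤s h′ = h′
    -- The lower entry exceeds `i + 1` here, so no `i + 1` follows it in its row.
    next (neutral p q) closing lU u<d h s = ≤-trans (≤-reflexive (trans (sym (count-≢ L q))
      (count-below-sorted L s (≤∧≢⇒< u<d (q ∘ sym))))) z≤n
    next {d} kd opening       lU _ h s = m≤n⇒m≤1+n (≤-trans (count-≤-∷ (suc i) d L) h)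
    next {d} kd (neutral _ _) lU _ h s = ≤-trans (count-≤-∷ (suc i) d L) h

    column : ∀ {d u} (kd : Kind i d) (ku : Kind i u) → u < d → count (suc i) (d ∷ L) ≤ proj₂ lU →
      count i (u ∷ U) ≤ proj₁ rL → Sorted (u ∷ U) →
      newK ku lU (suffix i U rU) < newK kd lL (suffix i L rL)
    column kd@(neutral p q) ku u<d _ _ _ = newK-<neutral ku lU _ p q u<d
    column kd (neutral p q) u<d _ _ _ = newK->neutral kd lL _ p q u<d
    column closing closing u<d _ _ _ = ⊥-elim (<-irrefl refl u<d)
    column opening opening u<d _ _ _ = ⊥-elim (<-irrefl refl u<d)
    column closing opening u<d _ _ _ = ⊥-elim (<-asym u<d ≤-refl)
    -- From this column on the upper row has more letters `i` than the lower row has letters `i + 1`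
    -- after `d`. The latter cannot use up all closing parentheses, so one remains for `d`. By `hL`
    -- an opening one is pending for `u`.
    column opening closing u<d hL hU sU = newK-matched lU _ lL _
      (≤-trans (s≤s z≤n) (≤-trans (≤-reflexive (sym (count-≡ (suc i) L))) hL))
      (+-cancelʳ-≤ (count (suc i) L) 1 _ (≤-trans (s≤s (count-columns p (sorted-≥ ≤-refl sU)))
        (≤-trans (≤-reflexive (sym (count-≡ i U))) (≤-trans hU (closes-suffix L rL)))))

InRange : ℕ → ℕ → Set
InRange n x = 1 ≤ x × x ≤ n

run-entries : ∀ {n i} → 1 ≤ i → i < n → ∀ l {w} r → All (InRange n) w → All (InRange n) (run i l w r)
run-entries 1≤i i<n l r [] = []
run-entries {n} {i} 1≤i i<n l {x ∷ w} r (h ∷ all) = entry′ (kind i x) h ∷ run-entries 1≤i i<n _ r all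
  where
  r′ = suffix i w r
  entry′ : ∀ {x} (k : Kind i x) → InRange n x → InRange n (newK k l r′)
  entry′ (neutral _ _) h = h
  entry′ k@closing     _ = ≤-trans 1≤i (newK-≥ k l r′ ≤-refl) , ≤-trans (newK-≤ k l r′ (n≤1+n i)) i<n
  entry′ k@opening     _ = ≤-trans 1≤i (newK-≥ k l r′ (n≤1+n i)) , ≤-trans (newK-≤ k l r′ ≤-refl) i<n

runRows-entries : ∀ {n i} → 1 ≤ i → i < n → ∀ l {R} r → All (All (InRange n)) R → All (All (InRange n)) (runRows i l R r)
runRows-entries 1≤i i<n l r []        = []
runRows-entries 1≤i i<n l r (h ∷ all) = run-entries 1≤i i<n l _ h ∷ runRows-entries 1≤i i<n _ r all

runRows-sorted : ∀ i l {R} r → All Sorted R → All Sorted (runRows i l R r)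
runRows-sorted i l r []        = []
runRows-sorted i l r (h ∷ all) = run-sorted i l _ h ∷ runRows-sorted i _ r all

runRows-columns : ∀ i l {R} r → All Sorted R → Linked (Prefix _>_) R → Linked (Prefix _>_) (runRows i l R r)
runRows-columns i l r _ []  = []
runRows-columns i l r _ [-] = [-]
runRows-columns i l {L ∷ U ∷ R} r (sL ∷ sU ∷ all) (p ∷ ps) =
  run-columns i l _ _ _ p sL sU (opens-prefix-sorted i sL l)
    (≤-trans (closes-suffix-sorted i sU (suffix i (concat R) r)) (≤-reflexive (cong proj₁ (sym (suffix-++ i U (concat R) r)))))
  ∷ runRows-columns i _ r (sU ∷ all) ps

s-SST : ∀ {n Λ i T} → 1 ≤ i → i < n → SST n Λ T → SST n Λ (s i T)
s-SST {n} {Λ} {i} {T} 1≤i i<n t = record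
  { shape     = trans (shape-s i T) shape
  ; entries   = transport (All (All (InRange n))) (All-reverse (runRows-entries 1≤i i<n _ _ (All-reverse entries)))
  ; rowWeak   = transport (All Sorted) (All-reverse (runRows-sorted i _ _ (All-reverse rowWeak)))
  ; colStrict = transport (Linked (λ upper lower → Prefix _>_ lower upper))
                  (Linked-reverse (runRows-columns i _ _ (All-reverse rowWeak) (Linked-reverse colStrict)))
  }
  where
  open SST t
  transport : (P : Filling → Set) → P (reverse (runRows i (0 , 0) (reverse T) (0 , 0))) → P (s i T)
  transport P = subst P (sym (s≡runRows i T))

-- Entries and levels of a tableau

rowLength : List ℕ → ℕ → ℕ
rowLength []       _       = 0
rowLength (m ∷ ms) zero    = m
rowLength (m ∷ ms) (suc r) = rowLength ms r

rowLength-decreasing : ∀ {ms} → Linked _≥_ ms → ∀ r → rowLength ms (suc r) ≤ rowLength ms r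
rowLength-decreasing []        r       = z≤n
rowLength-decreasing [-]       r       = z≤n
rowLength-decreasing (m≥ ∷ ms) zero    = m≥
rowLength-decreasing (_ ∷ ms)  (suc r) = rowLength-decreasing ms r

rowLength-beyond : ∀ ms {r} → length ms ≤ r → rowLength ms r ≡ 0
rowLength-beyond []       _         = refl
rowLength-beyond (m ∷ ms) (s≤s h)   = rowLength-beyond ms h

nth : List ℕ → ℕ → Maybe ℕ
nth w c = head (drop c w)

nth-inside : ∀ w {c} → c < length w → ∃[ x ] nth w c ≡ just x
nth-inside (x ∷ w) {zero}  _         = x , refl
nth-inside (x ∷ w) {suc c} (s≤s c<) = nth-inside w c<

nth-outside : ∀ w {c} → length w ≤ c → nth w c ≡ nothing
nth-outside []      {zero}  _        = refl
nth-outside []      {suc c} _        = refl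
nth-outside (x ∷ w) {suc c} (s≤s h) = nth-outside w h

nth-applyUpTo : ∀ (f : ℕ → ℕ) m {c} → c < m → nth (applyUpTo f m) c ≡ just (f c)
nth-applyUpTo f (suc m) {zero}  _       = refl
nth-applyUpTo f (suc m) {suc c} (s≤s h) = nth-applyUpTo (f ∘ suc) m h

applyUpTo-nth : ∀ (f : ℕ → ℕ) w → (∀ c x → nth w c ≡ just x → f c ≡ x) → applyUpTo f (length w) ≡ w
applyUpTo-nth f []      h = refl
applyUpTo-nth f (x ∷ w) h = cong₂ _∷_ (h 0 x refl) (applyUpTo-nth (f ∘ suc) w (h ∘ suc))

nth-All : ∀ {P : ℕ → Set} {w} → All P w → ∀ c {x} → nth w c ≡ just x → P x
nth-All (p ∷ _)   zero    refl = p
nth-All (_ ∷ all) (suc c) e    = nth-All all c e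
nth-All []        zero    ()
nth-All []        (suc c) ()

nth-Prefix : ∀ {L U} → Prefix _>_ L U → ∀ c {x y} → nth U c ≡ just x → nth L c ≡ just y → x < y
nth-Prefix (r ∷ _) zero    refl refl = r
nth-Prefix (_ ∷ p) (suc c) e    e′   = nth-Prefix p c e e′
nth-Prefix []      zero    e    ()
nth-Prefix []      (suc c) e    ()

atMost : ℕ → List ℕ → ℕ
atMost k w = length (filter (_≤? k) w)

atMost-accept : ∀ {k x} w → x ≤ k → atMost k (x ∷ w) ≡ suc (atMost k w)
atMost-accept w x≤k = cong length (filter-accept (_≤? _) x≤k)

atMost-reject : ∀ {k x} w → ¬ x ≤ k → atMost k (x ∷ w) ≡ atMost k w
atMost-reject w x≰k = cong length (filter-reject (_≤? _) x≰k)

nth-atMost : ∀ {k w} → Sorted w → ∀ c {x} → nth w c ≡ just x → (x ≤ k → c < atMost k w) × (c < atMost k w → x ≤ k)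
nth-atMost {k} {[]}    s zero ()
nth-atMost {k} {[]}    s (suc c) ()
nth-atMost {k} {y ∷ w} s c e with y ≤? k
nth-atMost {k} {y ∷ w} s zero    refl | yes y≤k =
  (λ _ → subst (0 <_) (sym (atMost-accept w y≤k)) (s≤s z≤n)) , (λ _ → y≤k)
nth-atMost {k} {y ∷ w} s (suc c) e    | yes y≤k with nth-atMost {k} (sorted-tail s) c e
... | to , from = (λ h → subst (suc c <_) (sym (atMost-accept w y≤k)) (s≤s (to h)))
                , (λ h → from (s≤s⁻¹ (subst (suc c <_) (atMost-accept w y≤k) h)))
nth-atMost {k} {y ∷ w} s c {x} e | no y≰k = ⊥-elim ∘ x≰k
  , subst (λ m → c < m → x ≤ k) (sym (cong length (filter-none (_≤? k) (All.map (λ y≤z z≤k → y≰k (≤-trans y≤z z≤k)) all)))) (λ ())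
  where
  all = Linked.Linked⇒All ≤-trans ≤-refl s
  x≰k : ¬ x ≤ k
  x≰k x≤k = y≰k (≤-trans (nth-All all c e) x≤k)

level : Filling → ℕ → ℕ → ℕ
level []      k r       = 0
level (w ∷ T) k zero    = atMost k w
level (w ∷ T) k (suc r) = level T k r

entry-[] : ∀ r c → entry [] r c ≡ nothing
entry-[] zero    c = refl
entry-[] (suc r) c = refl

entry-inside : ∀ T {r c} → c < rowLength (map length T) r → ∃[ x ] entry T r c ≡ just x
entry-inside (w ∷ T) {zero}  h = nth-inside w h
entry-inside (w ∷ T) {suc r} h = entry-inside T h

entry-outside : ∀ T {r c} → rowLength (map length T) r ≤ c → entry T r c ≡ nothing
entry-outside []      {r} {c} h = entry-[] r c
entry-outside (w ∷ T) {zero}  h = nth-outside w h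
entry-outside (w ∷ T) {suc r} h = entry-outside T h

entry-inside⁻ : ∀ T r c {x} → entry T r c ≡ just x → c < rowLength (map length T) r
entry-inside⁻ T r c e with c <? rowLength (map length T) r
... | yes h = h
... | no h with () ← trans (sym e) (entry-outside T (≮⇒≥ h))

entry-fromGrid : ∀ ms f {r c} → c < rowLength ms r → entry (fromGrid ms f) r c ≡ just (f r c)
entry-fromGrid (m ∷ ms) f {zero}  h = nth-applyUpTo (f 0) m h
entry-fromGrid (m ∷ ms) f {suc r} h = entry-fromGrid ms (f ∘ suc) h

fromGrid-entry : ∀ T f → (∀ r c x → entry T r c ≡ just x → f r c ≡ x) → fromGrid (map length T) f ≡ T
fromGrid-entry []      f h = refl
fromGrid-entry (w ∷ T) f h = cong₂ _∷_ (applyUpTo-nth (f 0) w (h 0)) (fromGrid-entry T (f ∘ suc) (h ∘ suc))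

filling-ext : ∀ {T T′} → map length T ≡ map length T′ →
  (∀ r c x y → entry T r c ≡ just x → entry T′ r c ≡ just y → x ≡ y) → T ≡ T′
filling-ext {T} {T′} e h = trans (sym (fromGrid-entry T f (λ r c x e → cong (maybe id 0) e)))
  (trans (cong (λ ms → fromGrid ms f) e) (fromGrid-entry T′ f λ r c y e′ →
    let x , e″ = entry-inside T (subst (λ ms → c < rowLength ms r) (sym e) (entry-inside⁻ T′ r c e′))
    in trans (cong (maybe id 0) e″) (h r c x y e″ e′)))
  where
  f : ℕ → ℕ → ℕ
  f r c = maybe id 0 (entry T r c)

map-length-fromGrid : ∀ ms f → map length (fromGrid ms f) ≡ ms
map-length-fromGrid []       f = refl
map-length-fromGrid (m ∷ ms) f = cong₂ _∷_ (length-applyUpTo (f 0) m) (map-length-fromGrid ms (f ∘ suc))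

module _ {n : ℕ} {Λ : YoungDiagram} {T : Filling} (t : SST n Λ T) where
  open SST t

  entry-inRange : ∀ r c {x} → entry T r c ≡ just x → InRange n x
  entry-inRange = go entries
    where
    go : ∀ {T} → All (All (InRange n)) T → ∀ r c {x} → entry T r c ≡ just x → InRange n x
    go []        r       c e with () ← trans (sym (entry-[] r c)) e
    go (all ∷ _) zero    c e = nth-All all c e
    go (_ ∷ all) (suc r) c e = go all r c e

  entry-level : ∀ k r c {x} → entry T r c ≡ just x → (x ≤ k → c < level T k r) × (c < level T k r → x ≤ k)
  entry-level k = go rowWeak
    where
    go : ∀ {T} → All Sorted T → ∀ r c {x} → entry T r c ≡ just x → (x ≤ k → c < level T k r) × (c < level T k r → x ≤ k)
    go []        r       c e with () ← trans (sym (entry-[] r c)) e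
    go (s ∷ _)   zero    c e = nth-atMost s c e
    go (_ ∷ all) (suc r) c e = go all r c e

  entry-columns : ∀ r c {x y} → entry T r c ≡ just x → entry T (suc r) c ≡ just y → x < y
  entry-columns = go colStrict
    where
    go : ∀ {T} → Linked (λ upper lower → Prefix _>_ lower upper) T →
      ∀ r c {x y} → entry T r c ≡ just x → entry T (suc r) c ≡ just y → x < y
    go []       r       c e _ with () ← trans (sym (entry-[] r c)) e
    go [-]      r       c _ e with () ← trans (sym (entry-[] r c)) e
    go (p ∷ _)  zero    c e e′ = nth-Prefix p c e e′
    go (_ ∷ ps) (suc r) c e e′ = go ps r c e e′

level-≤ : ∀ T k r → level T k r ≤ rowLength (map length T) r
level-≤ []      k r       = z≤n
level-≤ (w ∷ T) k zero    = length-filter (_≤? k) w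
level-≤ (w ∷ T) k (suc r) = level-≤ T k r

≤-from-< : ∀ {a b} → (∀ c → c < a → c < b) → a ≤ b
≤-from-< {zero}  h = z≤n
≤-from-< {suc a} h = h a ≤-refl

module _ {n : ℕ} {Λ : YoungDiagram} where
  private ms = rows Λ

  record Tableau (V : ℕ → ℕ → ℕ) : Set where
    field
      inRange : ∀ {r c} → c < rowLength ms r → InRange n (V r c)
      weak    : ∀ {r c} → suc c < rowLength ms r → V r c ≤ V r (suc c)
      strict  : ∀ {r c} → c < rowLength ms (suc r) → V r c < V (suc r) c

  fromGrid-SST : ∀ {V} → Tableau V → SST n Λ (fromGrid ms V)
  fromGrid-SST {V} tab = record
    { shape     = map-length-fromGrid ms V
    ; entries   = ranges ms V inRange
    ; rowWeak   = weaks ms V weak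
    ; colStrict = stricts (YoungDiagram.decreasing Λ) V strict
    }
    where
    open Tableau tab
    ranges : ∀ ms V → (∀ {r c} → c < rowLength ms r → InRange n (V r c)) → All (All (InRange n)) (fromGrid ms V)
    ranges []       V h = []
    ranges (m ∷ ms) V h = All.applyUpTo⁺₁ (V 0) m (h {0}) ∷ ranges ms (V ∘ suc) (λ {r} → h {suc r})

    weaks : ∀ ms V → (∀ {r c} → suc c < rowLength ms r → V r c ≤ V r (suc c)) → All Sorted (fromGrid ms V)
    weaks []       V h = []
    weaks (m ∷ ms) V h = Linked.applyUpTo⁺₁ (V 0) m (h {0}) ∷ weaks ms (V ∘ suc) (λ {r} → h {suc r})

    columns : ∀ (U L : ℕ → ℕ) {m m′} → m′ ≤ m → (∀ {c} → c < m′ → U c < L c) → Prefix _>_ (applyUpTo L m′) (applyUpTo U m)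
    columns U L z≤n      h = []
    columns U L (s≤s m≤) h = h (s≤s z≤n) ∷ columns (U ∘ suc) (L ∘ suc) m≤ (h ∘ s≤s)

    stricts : ∀ {ms} → Linked _≥_ ms → ∀ V → (∀ {r c} → c < rowLength ms (suc r) → V r c < V (suc r) c) →
      Linked (λ upper lower → Prefix _>_ lower upper) (fromGrid ms V)
    stricts []        V h = []
    stricts [-]       V h = [-]
    stricts (m≥ ∷ ms) V h = columns (V 0) (V 1) m≥ (h {0}) ∷ stricts ms (V ∘ suc) (λ {r} → h {suc r})

sumTo : ℕ → (ℕ → ℕ) → ℕ
sumTo zero    f = 0
sumTo (suc m) f = f 0 + sumTo m (f ∘ suc)

atMost-++ : ∀ k v w → atMost k (v ++ w) ≡ atMost k v + atMost k w
atMost-++ k v w = trans (cong length (filter-++ (_≤? k) v w)) (length-++ (filter (_≤? k) v))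

sumTo-level : ∀ T k → sumTo (length T) (level T k) ≡ atMost k (concat T)
sumTo-level []      k = refl
sumTo-level (w ∷ T) k = trans (cong (atMost k w +_) (sumTo-level T k)) (sym (atMost-++ k w (concat T)))

-- Chains of levels and paths of sliding dots

-- L k r is the number of entries at most k in row r.
Levels : Set
Levels = ℕ → ℕ → ℕ

-- A Gelfand-Tsetlin pattern. Level 0 may be nonzero in the first row, where dots that have finished
-- sliding are counted.
record Chain (n : ℕ) (ms : List ℕ) (L : Levels) : Set where
  field
    mono   : ∀ {k} → k < n → ∀ r → L k r ≤ L (suc k) r
    inter  : ∀ {k} → k < n → ∀ r → L (suc k) (suc r) ≤ L k r
    top    : ∀ r → L n r ≡ rowLength ms r
    bottom : ∀ r → L 0 (suc r) ≡ 0

bump : ℕ → (ℕ → ℕ) → ℕ → ℕ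
bump i f r with r ≟ i
... | yes _ = suc (f r)
... | no _  = f r

bump-≡ : ∀ i f → bump i f i ≡ suc (f i)
bump-≡ i f with i ≟ i
... | yes _  = refl
... | no i≢i = ⊥-elim (i≢i refl)

bump-≢ : ∀ {i r} f → r ≢ i → bump i f r ≡ f r
bump-≢ {i} {r} f r≢i with r ≟ i
... | yes r≡i = ⊥-elim (r≢i r≡i)
... | no _    = refl

bump-≥ : ∀ i f r → f r ≤ bump i f r
bump-≥ i f r with r ≟ i
... | yes _ = n≤1+n _
... | no _  = ≤-refl

bump-injective : ∀ i {f g : ℕ → ℕ} r → bump i f r ≡ bump i g r → f r ≡ g r
bump-injective i r e with r ≟ i
... | yes _ = suc-injective e
... | no _  = e

bump-cong : ∀ i {f g : ℕ → ℕ} r → f r ≡ g r → bump i f r ≡ bump i g r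
bump-cong i r e with r ≟ i
... | yes _ = cong suc e
... | no _  = e

raise : ℕ → ℕ → Levels → Levels
raise t i M k with k ≟ t
... | yes _ = bump i (M k)
... | no _  = M k

raise-≡ : ∀ t i M r → raise t i M t r ≡ bump i (M t) r
raise-≡ t i M r with t ≟ t
... | yes _  = refl
... | no t≢t = ⊥-elim (t≢t refl)

raise-≢ : ∀ {t i k} M r → k ≢ t → raise t i M k r ≡ M k r
raise-≢ {t} {i} {k} M r k≢t with k ≟ t
... | yes k≡t = ⊥-elim (k≢t k≡t)
... | no _    = refl

raise-≥ : ∀ t i M k r → M k r ≤ raise t i M k r
raise-≥ t i M k r with k ≟ t
... | yes _ = bump-≥ i (M k) r
... | no _  = ≤-refl

-- Levels below `t` are raised from the highest down, in the order in which a sliding dot passes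
-- them.
raiseAll : ℕ → (ℕ → ℕ) → Levels → Levels
raiseAll zero    ρ M = M
raiseAll (suc t) ρ M = raiseAll t ρ (raise t (ρ t) M)

raiseAll-≥ : ∀ t ρ M {k} r → t ≤ k → raiseAll t ρ M k r ≡ M k r
raiseAll-≥ zero    ρ M r t≤k = refl
raiseAll-≥ (suc t) ρ M r t<k = trans (raiseAll-≥ t ρ _ r (<⇒≤ t<k)) (raise-≢ M r (<⇒≢ t<k ∘ sym))

raiseAll-< : ∀ t ρ M {k} r → k < t → raiseAll t ρ M k r ≡ bump (ρ k) (M k) r
raiseAll-< (suc t) ρ M {k} r (s≤s k≤t) with k ≟ t
... | yes refl = trans (raiseAll-≥ t ρ _ r ≤-refl) (raise-≡ t (ρ t) M r)
... | no k≢t   = trans (raiseAll-< t ρ _ r (≤∧≢⇒< k≤t k≢t)) (bump-cong (ρ k) r (raise-≢ M r k≢t))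

-- A dot slides along the path ρ if it lies in row ρ k after passing all entries
-- larger than k. Counted as an entry 0 at the end, it raises level k in this row.

Up : Levels → (ℕ → ℕ) → ℕ → Set
Up L ρ k = ρ (suc k) ≡ suc (ρ k) × L k (ρ k) ≤ L (suc k) (suc (ρ k))

Stay : Levels → (ℕ → ℕ) → ℕ → Set
Stay L ρ k = ρ (suc k) ≡ ρ k × (∀ r → ρ k ≡ suc r → L (suc k) (suc r) < L k r)

-- Of `Stay` only the equality of rows is kept: raising the levels along a path preserves `Up`, but
-- can turn the strict inequality of `Stay` into an equality. What is left bounds the next path
-- (`guarded`) and lets a path be recovered from its result (`Slides₁-rows`).
record Guard (n : ℕ) (L : Levels) (ρ : ℕ → ℕ) : Set where
  field
    start : ρ 0 ≡ 0
    step  : ∀ {k} → suc k < n → ρ (suc k) ≡ ρ k ⊎ Up L ρ k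

record Slides₁ (n : ℕ) (ms : List ℕ) (L L′ : Levels) : Set where
  field
    chain  : Chain n ms L
    ρ      : ℕ → ℕ
    guard  : Guard n L ρ
    raised : ∀ {k} → k < n → ∀ r → L′ k r ≡ bump (ρ k) (L k) r
    top    : ∀ r → L′ n r ≡ L n r

module _ {n : ℕ} {ms : List ℕ} {L₁ L₁′ L₂ L₂′ : Levels} (S : Slides₁ n ms L₁ L₁′) (S′ : Slides₁ n ms L₂ L₂′)
         (same : ∀ {k} → k ≤ n → ∀ r → L₁′ k r ≡ L₂′ k r) where
  private
    module S = Slides₁ S
    module S′ = Slides₁ S′

  private
    -- Level `suc k` ends up equal in row `suc p`, where only the second slide has raised it.
    -- Interlacing for the first slide then puts the level before the second one strictly below the
    -- bound that `Up` demands.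
    not-both : ∀ {n ms L L′ M M′} (S : Slides₁ n ms L L′) (S′ : Slides₁ n ms M M′) →
      let open Slides₁ in ∀ {k p} → suc k < n → (∀ r → L′ (suc k) r ≡ M′ (suc k) r) → L k p ≡ M k p →
      ρ S (suc k) ≡ p → ρ S′ (suc k) ≡ suc p → M k p ≤ M (suc k) (suc p) → ⊥
    not-both {L = L} {L′} {M} {M′} S S′ {k} {p} k<n e ek s u h = <-irrefl refl (begin-strict
      M k p                                        ≤⟨ h ⟩
      M (suc k) (suc p)                            <⟨ n<1+n _ ⟩
      suc (M (suc k) (suc p))                      ≡⟨ bump-≡ (suc p) (M (suc k)) ⟨
      bump (suc p) (M (suc k)) (suc p)             ≡⟨ cong (λ q → bump q (M (suc k)) (suc p)) u ⟨
      bump (ρ S′ (suc k)) (M (suc k)) (suc p)      ≡⟨ raised S′ k<n (suc p) ⟨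
      M′ (suc k) (suc p)                           ≡⟨ e (suc p) ⟨
      L′ (suc k) (suc p)                           ≡⟨ raised S k<n (suc p) ⟩
      bump (ρ S (suc k)) (L (suc k)) (suc p)       ≡⟨ bump-≢ (L (suc k)) (λ q → <⇒≢ (n<1+n p) (sym (trans q s))) ⟩
      L (suc k) (suc p)                            ≤⟨ Chain.inter (chain S) (<⇒≤ k<n) p ⟩
      L k p                                        ≡⟨ ek ⟩
      M k p                                        ∎)
      where
      open Slides₁
      open ≤-Reasoning

  -- Induction upwards from the common row 0. Equal rows at level `k` give equal levels before the
  -- slides, and then `not-both` prevents the paths from parting at the next level.
  Slides₁-rows : ∀ {k} → k < n → S.ρ k ≡ S′.ρ k × (∀ r → L₁ k r ≡ L₂ k r)
  Slides₁-rows {k} k<n = agree k k<n , λ r → levels k k<n (agree k k<n) r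
    where
    levels : ∀ k → k < n → S.ρ k ≡ S′.ρ k → ∀ r → L₁ k r ≡ L₂ k r
    levels k k<n e r = bump-injective (S.ρ k) r (trans (sym (S.raised k<n r)) (trans (same (<⇒≤ k<n) r)
      (trans (S′.raised k<n r) (cong (λ p → bump p (L₂ k) r) (sym e)))))

    agree : ∀ k → k < n → S.ρ k ≡ S′.ρ k
    agree zero    _   = trans (Guard.start S.guard) (sym (Guard.start S′.guard))
    agree (suc k) k<n with agree k (<⇒≤ k<n) | Guard.step S.guard k<n | Guard.step S′.guard k<n
    ... | e | inj₁ s       | inj₁ s′       = trans s (trans e (sym s′))
    ... | e | inj₂ (u , _) | inj₂ (u′ , _) = trans u (trans (cong suc e) (sym u′))
    ... | e | inj₁ s       | inj₂ (u′ , h) = ⊥-elim (not-both S S′ k<n (same (<⇒≤ k<n))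
                                               (levels k (<⇒≤ k<n) e _) (trans s e) u′ h)
    ... | e | inj₂ (u , h) | inj₁ s′       = ⊥-elim (not-both S′ S k<n (λ r → sym (same (<⇒≤ k<n) r))
                                               (sym (levels k (<⇒≤ k<n) e _)) (trans s′ (sym e)) u h)

  Slides₁-injective : ∀ {k} → k ≤ n → ∀ r → L₁ k r ≡ L₂ k r
  Slides₁-injective {k} k≤n r with k ≟ n
  ... | yes refl = trans (sym (S.top r)) (trans (same ≤-refl r) (S′.top r))
  ... | no k≢n   = proj₂ (Slides₁-rows (≤∧≢⇒< k≤n k≢n)) r

data Slides (n : ℕ) (ms : List ℕ) : ℕ → Levels → Levels → Set where
  done : ∀ {L} → Slides n ms 0 L L
  _∷_  : ∀ {m L L₁ L′} → Slides₁ n ms L L₁ → Slides n ms m L₁ L′ → Slides n ms (suc m) L L′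

Slides-injective : ∀ {n ms m L₁ L₂ L₁′ L₂′} → Slides n ms m L₁ L₁′ → Slides n ms m L₂ L₂′ →
  (∀ {k} → k ≤ n → ∀ r → L₁′ k r ≡ L₂′ k r) → ∀ {k} → k ≤ n → ∀ r → L₁ k r ≡ L₂ k r
Slides-injective done     done       e = e
Slides-injective (S ∷ Ss) (S′ ∷ Ss′) e = Slides₁-injective S S′ (λ k≤n r → Slides-injective Ss Ss′ e k≤n r)

-- The jeu de taquin rule in terms of levels. A dot directly behind the entries at most `suc t` of
-- its row goes up unless the entry above it is at most `t`.
rowBelow : Levels → ℕ → ℕ → ℕ
rowBelow L t zero    = zero
rowBelow L t (suc i) with L (suc t) (suc i) <? L t i
... | yes _ = suc i
... | no _  = i

trace : Levels → ℕ → ℕ → ℕ → ℕ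
trace L zero    i k = i
trace L (suc t) i k with k ≤? t
... | yes _ = trace L t (rowBelow L t i) k
... | no _  = i

trace-start : ∀ L t i → trace L t i t ≡ i
trace-start L zero    i = refl
trace-start L (suc t) i with suc t ≤? t
... | yes h = ⊥-elim (<-irrefl refl h)
... | no _  = refl

trace-≤ : ∀ L {t i k} → k ≤ t → trace L (suc t) i k ≡ trace L t (rowBelow L t i) k
trace-≤ L {t} {i} {k} k≤t with k ≤? t
... | yes _ = refl
... | no h  = ⊥-elim (h k≤t)

trace-step : ∀ L t i {k} → k < t → Stay L (trace L t i) k ⊎ Up L (trace L t i) k
trace-step L (suc t) i {k} (s≤s k≤t) with k ≟ t
... | no k≢t rewrite trace-≤ L {t} {i} k≤t | trace-≤ L {t} {i} (≤∧≢⇒< k≤t k≢t) = trace-step L t (rowBelow L t i) (≤∧≢⇒< k≤t k≢t)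
... | yes refl rewrite trace-≤ L {t} {i} k≤t | trace-start L (suc t) i | trace-start L t (rowBelow L t i) = below i
  where
  below : ∀ i → (i ≡ rowBelow L t i × (∀ r → rowBelow L t i ≡ suc r → L (suc t) (suc r) < L t r)) ⊎
                (i ≡ suc (rowBelow L t i) × L t (rowBelow L t i) ≤ L (suc t) (suc (rowBelow L t i)))
  below zero    = inj₁ (refl , λ r ())
  below (suc i) with L (suc t) (suc i) <? L t i
  ... | yes h = inj₁ (refl , λ { r refl → h })
  ... | no h  = inj₂ (refl , ≮⇒≥ h)

-- A dot that starts weakly above the path of its predecessor stays weakly above it.
guarded : ∀ {N L ρ σ} → Guard (suc N) L ρ → (∀ {k} → k < N → Stay L σ k ⊎ Up L σ k) → σ N ≤ ρ N →
  ∀ d k → k + d ≡ N → σ k ≤ ρ k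
guarded {ρ = ρ} {σ} g moves h zero    k e with refl ← trans (sym (+-identityʳ k)) e = h
guarded {N} {L} {ρ} {σ} g moves h (suc d) k e = go (moves k<N) (Guard.step g (s≤s k<N))
  where
  k<N : k < N
  k<N = subst (k <_) e (m<m+n k (s≤s z≤n))
  ih : σ (suc k) ≤ ρ (suc k)
  ih = guarded g moves h d (suc k) (trans (sym (+-suc k d)) e)
  go : Stay L σ k ⊎ Up L σ k → ρ (suc k) ≡ ρ k ⊎ Up L ρ k → σ k ≤ ρ k
  go (inj₁ (s , _)) (inj₁ s′)      = subst₂ _≤_ s s′ ih
  go (inj₂ (u , _)) (inj₁ s′)      = ≤-trans (n≤1+n _) (subst₂ _≤_ u s′ ih)
  go (inj₂ (u , _)) (inj₂ (u′ , _)) = s≤s⁻¹ (subst₂ _≤_ u u′ ih)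
  go (inj₁ (s , stay)) (inj₂ (u′ , up)) with m≤n⇒m<n∨m≡n (subst₂ _≤_ s u′ ih)
  ... | inj₁ (s≤s σ≤ρ) = σ≤ρ
  -- Here `ρ` leaves upwards a row in which `σ` stays, so `Up` and `Stay` give opposite inequalities
  -- between the same two levels.
  ... | inj₂ eq = ⊥-elim (≤⇒≯ up (stay (ρ k) eq))

-- Where the path goes up, both sides of the inequality in `Up` are raised by one.
bump-guard : ∀ {N L L′ σ} → σ 0 ≡ 0 → (∀ {k} → k < N → Stay L σ k ⊎ Up L σ k) →
  (∀ {k} → k < suc N → ∀ r → L′ k r ≡ bump (σ k) (L k) r) → Guard (suc N) L′ σ
bump-guard {N} {L} {L′} {σ} start moves raised = record { start = start ; step = λ { (s≤s k<N) → step k<N } }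
  where
  step : ∀ {k} → k < N → σ (suc k) ≡ σ k ⊎ Up L′ σ k
  step {k} k<N with moves k<N
  ... | inj₁ (s , _) = inj₁ s
  ... | inj₂ (u , h) = inj₂ (u , subst₂ _≤_
    (sym (trans (raised (m<n⇒m<1+n k<N) (σ k)) (bump-≡ (σ k) (L k))))
    (sym (trans (raised (s≤s k<N) (suc (σ k))) (trans (cong (λ p → bump p (L (suc k)) (suc (σ k))) u) (bump-≡ (suc (σ k)) (L (suc k))))))
    (s≤s h))

moves⇒guard : ∀ {N L σ} → σ 0 ≡ 0 → (∀ {k} → k < N → Stay L σ k ⊎ Up L σ k) → Guard (suc N) L σ
moves⇒guard start moves = record { start = start ; step = λ { (s≤s k<N) → Sum.map₁ proj₁ (moves k<N) } }

sumTo-cong : ∀ {f g : ℕ → ℕ} m → (∀ r → f r ≡ g r) → sumTo m f ≡ sumTo m g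
sumTo-cong zero    e = refl
sumTo-cong (suc m) e = cong₂ _+_ (e 0) (sumTo-cong m (e ∘ suc))

sumTo-bump : ∀ {i m} f → i < m → sumTo m (bump i f) ≡ suc (sumTo m f)
sumTo-bump {zero}  {suc m} f _       = cong suc (cong (f 0 +_) (sumTo-cong m (λ r → bump-≢ {0} {suc r} f (λ ()))))
sumTo-bump {suc i} {suc m} f (s≤s h) = trans (cong (f 0 +_) (trans (sumTo-cong m shift) (sumTo-bump (f ∘ suc) h))) (+-suc (f 0) _)
  where
  shift : ∀ r → bump (suc i) f (suc r) ≡ bump i (f ∘ suc) r
  shift r with r ≟ i
  ... | yes refl = bump-≡ (suc i) f
  ... | no r≢i   = bump-≢ f (r≢i ∘ suc-injective)

-- Jeu de taquin slides on grids

≡ᵇ-refl : ∀ i → (i ≡ᵇ i) ≡ true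
≡ᵇ-refl zero    = refl
≡ᵇ-refl (suc i) = ≡ᵇ-refl i

≢⇒≡ᵇ : ∀ {i j} → i ≢ j → (i ≡ᵇ j) ≡ false
≢⇒≡ᵇ {i} {j} i≢j with i ≡ᵇ j in eq
... | false = refl
... | true  = ⊥-elim (i≢j (≡ᵇ⇒≡ i j (subst IsTrue (sym eq) _)))

set-here : ∀ i j v g → set i j v g i j ≡ v
set-here i j v g rewrite ≡ᵇ-refl i | ≡ᵇ-refl j = refl

set-there : ∀ {i j k l} v g → k ≢ i ⊎ l ≢ j → set i j v g k l ≡ g k l
set-there {i} {j} {k} {l} v g (inj₁ k≢i) rewrite ≢⇒≡ᵇ k≢i = refl
set-there {i} {j} {k} {l} v g (inj₂ l≢j) with k ≡ᵇ i
... | true rewrite ≢⇒≡ᵇ l≢j = refl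
... | false = refl

≤⇒≤ᵇ-true : ∀ {a b} → a ≤ b → (a ≤ᵇ b) ≡ true
≤⇒≤ᵇ-true {a} {b} h with a ≤ᵇ b in eq
... | true  = refl
... | false = ⊥-elim (subst IsTrue eq (≤⇒≤ᵇ h))

>⇒≤ᵇ-false : ∀ {a b} → b < a → (a ≤ᵇ b) ≡ false
>⇒≤ᵇ-false {a} {b} h with a ≤ᵇ b in eq
... | true  = ⊥-elim (≤⇒≯ (≤ᵇ⇒≤ a b (subst IsTrue (sym eq) _)) h)
... | false = refl

slide-up : ∀ g i j a → g i j ≡ just a → (∀ j′ → j ≡ suc j′ → ∀ b → g (suc i) j′ ≡ just b → b ≤ a) →
  slide g (suc i) j ≡ slide (moveUp i j a g) i j
slide-up g i zero    a e h rewrite e = refl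
slide-up g i (suc j) a e h with g (suc i) j in eq
... | nothing rewrite e = refl
... | just b  rewrite e | ≤⇒≤ᵇ-true (h j refl b eq) = refl

slide-left : ∀ g i j b → g i j ≡ just b → (∀ i′ → i ≡ suc i′ → ∀ a → g i′ (suc j) ≡ just a → a < b) →
  slide g i (suc j) ≡ slide (moveLeft i j b g) i j
slide-left g zero    j b e h rewrite e = refl
slide-left g (suc i) j b e h with g i (suc j) in eq
... | nothing rewrite e = refl
... | just a  rewrite e | >⇒≤ᵇ-false (h i refl a eq) = refl

slide-stop : ∀ g j → (∀ j′ → j ≡ suc j′ → g 0 j′ ≡ nothing) → slide g 0 j ≡ g
slide-stop g zero    h = refl
slide-stop g (suc j) h rewrite h j refl = refl

-- Dots at the beginning of the first row count as entries 0, those not yet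
-- processed and the positions outside the diagram as entries larger than N.
module _ (N : ℕ) where

  CellOK : Maybe ℕ → Levels → ℕ → ℕ → Set
  CellOK (just x) M r c = InRange N x × (∀ k → k ≤ N → (x ≤ k → c < M k r) × (c < M k r → x ≤ k))
  CellOK nothing  M r c = c < M 0 r ⊎ M N r ≤ c

  record Hole (g : Grid) (i j : ℕ) (M : Levels) : Set where
    field
      cells : ∀ r c → r ≢ i ⊎ c ≢ j → CellOK (g r c) M r c
      empty : g i j ≡ nothing

  move-hole : ∀ {g i j M t} i₂ j₂ → Hole g i j M → CellOK (just t) M i j → Hole (set i₂ j₂ nothing (set i j (just t) g)) i₂ j₂ M
  move-hole {g} {i} {j} {M} {t} i₂ j₂ h ok = record
    { cells = λ r c off → subst (λ m → CellOK m M r c) (sym (set-there nothing g′ off)) (inner r c)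
    ; empty = set-here i₂ j₂ nothing g′
    }
    where
    g′ = set i j (just t) g
    inner : ∀ r c → CellOK (set i j (just t) g r c) M r c
    inner r c with r ≟ i | c ≟ j
    ... | yes refl | yes refl = subst (λ m → CellOK m M r c) (sym (set-here i j (just t) g)) ok
    ... | yes _    | no c≢j   = subst (λ m → CellOK m M r c) (sym (set-there (just t) g (inj₂ c≢j))) (Hole.cells h r c (inj₂ c≢j))
    ... | no r≢i   | _        = subst (λ m → CellOK m M r c) (sym (set-there (just t) g (inj₁ r≢i))) (Hole.cells h r c (inj₁ r≢i))

  bump-cell : ∀ {i j r c} f → f i ≡ j → r ≢ i ⊎ c ≢ j → (c < f r → c < bump i f r) × (c < bump i f r → c < f r)
  bump-cell {i} {j} {r} {c} f e off with r ≟ i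
  ... | no _ = id , id
  ... | yes refl = m<n⇒m<1+n , λ { (s≤s h) → ≤∧≢⇒< h (λ c≡ → [ (λ r≢r → r≢r refl) , (λ c≢j → c≢j (trans c≡ e)) ]′ off) }

  raise-cell : ∀ {t i j r c} M → M t i ≡ j → r ≢ i ⊎ c ≢ j → ∀ k → (c < M k r → c < raise t i M k r) × (c < raise t i M k r → c < M k r)
  raise-cell {t} M e off k with k ≟ t
  ... | yes refl = bump-cell (M k) e off
  ... | no _     = id , id

  raise-CellOK : ∀ {t i j r c} m M → M t i ≡ j → r ≢ i ⊎ c ≢ j → CellOK m M r c → CellOK m (raise t i M) r c
  raise-CellOK (just x) M e off (range , h) = range , λ k k≤N → let a , b = raise-cell M e off k ; a′ , b′ = h k k≤N in
    (a ∘ a′) , (b′ ∘ b)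
  raise-CellOK {t} {i} nothing M e off (inj₁ h) = inj₁ (<-≤-trans h (raise-≥ t i M 0 _))
  raise-CellOK {t} {i} nothing M e off (inj₂ h) = inj₂ (≮⇒≥ (λ h′ → ≤⇒≯ h (proj₂ (raise-cell M e off N) h′)))

  raise-Hole : ∀ {t i j g M} → M t i ≡ j → Hole g i j M → Hole g i j (raise t i M)
  raise-Hole {M = M} e h = record
    { cells = λ r c off → raise-CellOK _ M e off (Hole.cells h r c off)
    ; empty = Hole.empty h }

  cell-just : ∀ {m M r c t} → CellOK m M r c → (∀ {k} → k ≤ t → M k r ≤ c) → t < N → c < M (suc t) r → (c < M N r) → m ≡ just (suc t)
  cell-just {nothing} (inj₁ h) below t<N above c<N = ⊥-elim (≤⇒≯ (below z≤n) h)
  cell-just {nothing} (inj₂ h) below t<N above c<N = ⊥-elim (≤⇒≯ h c<N)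
  cell-just {just x} {t = t} (_ , h) below t<N above c<N = cong just (≤-antisym (proj₂ (h (suc t) t<N) above)
    (≰⇒> (λ x≤t → ≤⇒≯ (below ≤-refl) (proj₁ (h t (<⇒≤ t<N)) x≤t))))

  cell-≤ : ∀ {m M r c k x} → CellOK m M r c → k ≤ N → c < M k r → m ≡ just x → x ≤ k
  cell-≤ (_ , h) k≤N c< refl = proj₂ (h _ k≤N) c<

  -- The dot has just passed level t in row ρ t; M is L with the levels from t on raised.
  module _ (L : Levels) (ρ : ℕ → ℕ)
           (L-mono : ∀ {k} → k ≤ N → ∀ r → L k r ≤ L (suc k) r)
           (L-inter : ∀ {k} → k ≤ N → ∀ r → L (suc k) (suc r) ≤ L k r)
           (start : ρ 0 ≡ 0)
           (moves : ∀ {k} → k < N → Stay L ρ k ⊎ Up L ρ k) where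

    -- The dot stands directly behind the entries at most `t` of its row and is itself counted among
    -- them. Interlacing is required from level `t` on only: if the dot is about to go up, the
    -- raised level `t` violates it against the level underneath until that one is raised too.
    record Passed (t j : ℕ) (g : Grid) (M : Levels) : Set where
      field
        hole   : Hole g (ρ t) j M
        column : j ≡ L t (ρ t)
        below  : ∀ {k} → k < t → ∀ r → M k r ≡ L k r
        at     : ∀ r → M t r ≡ bump (ρ t) (L t) r
        mono   : ∀ {k} → k ≤ N → ∀ r → M k r ≤ M (suc k) r
        inter  : ∀ {k} → t ≤ k → k ≤ N → ∀ r → M (suc k) (suc r) ≤ M k r

      mono-≤ : ∀ {k k′} → k′ ≤ suc N → k ≤ k′ → ∀ r → M k r ≤ M k′ r
      mono-≤ {k} {zero}   k′≤ z≤n r = ≤-refl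
      mono-≤ {k} {suc k′} (s≤s k′≤) k≤k′ r with m≤n⇒m<n∨m≡n k≤k′
      ... | inj₁ (s≤s h) = ≤-trans (mono-≤ (m≤n⇒m≤1+n k′≤) h r) (mono k′≤ r)
      ... | inj₂ refl    = ≤-refl

      at-row : M t (ρ t) ≡ suc j
      at-row = trans (at (ρ t)) (trans (bump-≡ (ρ t) (L t)) (cong suc (sym column)))

    module _ {t j : ℕ} {g : Grid} {M : Levels} (t<N : t < N) (st : Passed (suc t) j g M) where
      open Passed st

      private
        L≡M : ∀ r → L t r ≡ M t r
        L≡M r = sym (below ≤-refl r)

        below-≤ : ∀ {k} → k ≤ t → ∀ r → M k r ≤ L t r
        below-≤ k≤t r = ≤-trans (mono-≤ (m≤n⇒m≤1+n (<⇒≤ t<N)) k≤t r) (≤-reflexive (below ≤-refl r))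

        above-≥ : ∀ {k} → t < k → k ≤ N → ∀ r → M (suc t) r ≤ M k r
        above-≥ t<k k≤N r = mono-≤ (m≤n⇒m≤1+n k≤N) t<k r

        filled : ∀ {r c} → L t r ≤ c → c < M (suc t) r → CellOK (just (suc t)) M r c
        filled {r} {c} h h′ = (s≤s z≤n , t<N) , λ k k≤N →
          (λ t<k → <-≤-trans h′ (above-≥ t<k k≤N r)) ,
          (λ c<M → ≰⇒> (λ k≤t → ≤⇒≯ h (<-≤-trans c<M (below-≤ k≤t r))))

        found : ∀ {r c} → L t r ≤ c → c < M (suc t) r → r ≢ ρ (suc t) ⊎ c ≢ j → g r c ≡ just (suc t)
        found {r} {c} h h′ off = cell-just (Hole.cells hole r c off) (λ k≤t → ≤-trans (below-≤ k≤t r) h) t<N h′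
          (<-≤-trans h′ (above-≥ t<N ≤-refl r))

      -- By the first hypothesis the entries above the cells passed are at most `t`, so they lose
      -- against the `suc t` on the left.
      run-left : (∀ r → ρ (suc t) ≡ suc r → j < L t r) → ∀ d c → c ≡ d + L t (ρ (suc t)) → c ≤ j → ∀ {g′} → Hole g′ (ρ (suc t)) c M →
        ∃[ g″ ] slide g′ (ρ (suc t)) c ≡ slide g″ (ρ (suc t)) (L t (ρ (suc t))) × Hole g″ (ρ (suc t)) (L t (ρ (suc t))) M
      run-left stay zero    c refl c≤j h = _ , refl , h
      run-left stay (suc d) (suc c) e c<j {g′} h with refl ← suc-injective e =
        let i = ρ (suc t)
            c<row : suc c < M (suc t) i
            c<row = ≤-trans (s≤s c<j) (≤-reflexive (sym at-row))
            left : g′ i c ≡ just (suc t)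
            left = cell-just (Hole.cells h i c (inj₂ (<⇒≢ ≤-refl))) (λ k≤t → ≤-trans (below-≤ k≤t i) (m≤n+m (L t i) d)) t<N
                     (<⇒≤ c<row) (<-≤-trans (<⇒≤ c<row) (above-≥ t<N ≤-refl i))
            above : ∀ i′ → i ≡ suc i′ → ∀ a → g′ i′ (suc c) ≡ just a → a < suc t
            above i′ e a e′ = s≤s (cell-≤ (Hole.cells h i′ (suc c) (inj₁ λ e″ → <⇒≢ ≤-refl (trans e″ e))) (<⇒≤ t<N)
                                (<-≤-trans (≤-<-trans c<j (stay i′ e)) (≤-reflexive (L≡M i′))) e′)
            g″ , p , h″ = run-left stay d c refl (<⇒≤ c<j)
                            (move-hole i c h (filled (m≤n⇒m≤1+n (m≤n+m (L t i) d)) c<row))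
        in g″ , trans (slide-left g′ i c (suc t) left above) p , h″

      lower : ∀ {g′} → Hole g′ (ρ t) (L t (ρ t)) M → L t (ρ t) < M (suc t) (ρ t) →
        (∀ r → r ≢ ρ t → M (suc t) (suc r) ≤ L t r) → M (suc t) (suc (ρ t)) ≤ suc (L t (ρ t)) →
        Passed t (L t (ρ t)) g′ (raise t (ρ t) M)
      lower {g′} h room other same = record
        { hole   = raise-Hole (below ≤-refl (ρ t)) h
        ; column = refl
        ; below  = λ k<t r → trans (raise-≢ M r (<⇒≢ k<t)) (below (m<n⇒m<1+n k<t) r)
        ; at     = λ r → trans (raise-≡ t (ρ t) M r) (bump-cong (ρ t) r (below ≤-refl r))
        ; mono   = mono′
        ; inter  = inter′
        }
        where
        M′ = raise t (ρ t) M

        mono′ : ∀ {k} → k ≤ N → ∀ r → M′ k r ≤ M′ (suc k) r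
        mono′ {k} k≤N r with k ≟ t
        ... | no k≢t = ≤-trans (mono k≤N r) (raise-≥ t (ρ t) M (suc k) r)
        ... | yes refl rewrite raise-≢ {t} {ρ t} M r (<⇒≢ (n<1+n t) ∘ sym) with r ≟ ρ t
        ...   | no _     = mono k≤N r
        ...   | yes refl = ≤-trans (≤-reflexive (cong suc (below ≤-refl r))) room

        inter′ : ∀ {k} → t ≤ k → k ≤ N → ∀ r → M′ (suc k) (suc r) ≤ M′ k r
        inter′ {k} t≤k k≤N r rewrite raise-≢ {t} {ρ t} M (suc r) (<⇒≢ (s≤s t≤k) ∘ sym) with k ≟ t
        ... | no k≢t = inter (≤∧≢⇒< t≤k (k≢t ∘ sym)) k≤N r
        ... | yes refl with r ≟ ρ t
        ...   | no r≢    = ≤-trans (other r r≢) (≤-reflexive (L≡M r))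
        ...   | yes refl = ≤-trans same (≤-reflexive (cong suc (L≡M r)))

      private
        L-inter-t : ∀ r → L (suc t) (suc r) ≤ L t r
        L-inter-t = L-inter (<⇒≤ t<N)

      step-stay : Stay L ρ t → ∃[ g′ ] slide g (ρ (suc t)) j ≡ slide g′ (ρ t) (L t (ρ t)) × Passed t (L t (ρ t)) g′ (raise t (ρ t) M)
      step-stay (s , stay) =
        let g′ , p , h = run-left (λ r e → subst (_< L t r) (sym (trans column (cong (L (suc t)) e))) (stay r (trans (sym s) e)))
                           (j ∸ L t (ρ (suc t))) j (sym (m∸n+n≡m L≤j)) ≤-refl hole
        in g′ , trans p (cong (λ i → slide g′ i (L t i)) s)
         , lower (subst (λ i → Hole g′ i (L t i) M) s h)
             (subst (λ i → L t i < M (suc t) i) s (<-≤-trans (s≤s L≤j) (≤-reflexive (sym at-row))))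
             (λ r _ → other r) (m≤n⇒m≤1+n (other (ρ t)))
        where
        L≤j : L t (ρ (suc t)) ≤ j
        L≤j = ≤-trans (L-mono (<⇒≤ t<N) _) (≤-reflexive (sym column))
        other : ∀ r → M (suc t) (suc r) ≤ L t r
        other r with suc r ≟ ρ (suc t)
        ... | no r≢  = ≤-trans (≤-reflexive (trans (at (suc r)) (bump-≢ (L (suc t)) r≢))) (L-inter-t r)
        ... | yes r≡ = ≤-trans (≤-reflexive (trans (cong (M (suc t)) r≡) (trans at-row (cong suc (trans column (cong (L (suc t)) (sym r≡)))))))
                         (stay r (trans (sym s) (sym r≡)))

      -- Interlacing and `Up` together force `j ≡ L t (ρ t)`. A single move upwards thus brings the
      -- dot to its place at level `t`, and no move to the left follows.
      step-up : Up L ρ t → ∃[ g′ ] slide g (ρ (suc t)) j ≡ slide g′ (ρ t) (L t (ρ t)) × Passed t (L t (ρ t)) g′ (raise t (ρ t) M)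
      step-up (u , h) = _ , trans (cong (λ i → slide g i j) u) (trans (slide-up g i j (suc t) up left) (cong (slide (moveUp i j (suc t) g) i) j≡))
        , lower (subst (λ c → Hole (moveUp i j (suc t) g) i c M) j≡ (move-hole i j (subst (λ i → Hole g i j M) u hole)
                   (filled (≤-trans (L-inter-t′) (≤-reflexive (sym j≡L))) (≤-reflexive (sym (trans (cong (M (suc t)) (sym u)) at-row))))))
            (subst (_< M (suc t) i) j≡ j<)
            (λ r r≢ → ≤-trans (≤-reflexive (trans (at (suc r)) (bump-≢ (L (suc t)) (λ e → r≢ (suc-injective (trans e u)))))) (L-inter-t r))
            (≤-reflexive (trans (cong (M (suc t)) (sym u)) (trans at-row (cong suc j≡))))
        where
        i = ρ t
        j≡L : j ≡ L (suc t) (suc i)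
        j≡L = trans column (cong (L (suc t)) u)
        j≡ : j ≡ L t i
        j≡ = trans j≡L (≤-antisym (L-inter-t i) h)
        L-inter-t′ : L t (suc i) ≤ L (suc t) (suc i)
        L-inter-t′ = L-mono (<⇒≤ t<N) (suc i)
        -- That the entry above is at most `suc t` is seen through the next higher level, by
        -- monotonicity and interlacing.
        j< : j < M (suc t) i
        j< = ≤-trans (≤-reflexive (sym (trans (cong (M (suc t)) (sym u)) at-row)))
               (≤-trans (mono t<N (suc i)) (inter ≤-refl t<N i))
        up : g i j ≡ just (suc t)
        up = found (≤-reflexive (sym j≡)) j< (inj₁ (λ e → <⇒≢ ≤-refl (trans e u)))
        -- The entry on the left may be `suc t` as well; a tie is decided in favour of the one
        -- above.
        left : ∀ j′ → j ≡ suc j′ → ∀ b → g (suc i) j′ ≡ just b → b ≤ suc t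
        left j′ e b e′ = cell-≤ (Hole.cells hole (suc i) j′ (inj₂ (λ e″ → <⇒≢ ≤-refl (trans e″ e)))) t<N
          (≤-trans (≤-trans (≤-reflexive (sym e)) (n≤1+n j)) (≤-reflexive (sym (trans (cong (M (suc t)) (sym u)) at-row)))) e′

    record Final (g : Grid) (M : Levels) : Set where
      field
        cells : ∀ r c → CellOK (g r c) M r c
        mono  : ∀ {k} → k ≤ N → ∀ r → M k r ≤ M (suc k) r
        inter : ∀ {k} → k ≤ N → ∀ r → M (suc k) (suc r) ≤ M k r

    -- At level 0 the dot lies in the first row by `start` and has only earlier dots on its left, so
    -- the slide stops there.
    slide-raiseAll : ∀ t {j g M} → t ≤ N → Passed t j g M → Final (slide g (ρ t) j) (raiseAll t ρ M)
    slide-raiseAll zero {j} {g} {M} _ st = subst (λ g → Final g M) (sym (trans (cong (λ i → slide g i j) start) (slide-stop g j stop))) record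
      { cells = all ; mono = mono ; inter = inter z≤n }
      where
      open Passed st
      all : ∀ r c → CellOK (g r c) M r c
      all r c with r ≟ ρ 0 | c ≟ j
      ... | no r≢ | _     = Hole.cells hole r c (inj₁ r≢)
      ... | _     | no c≢ = Hole.cells hole r c (inj₂ c≢)
      ... | yes refl | yes refl = subst (λ m → CellOK m M r c) (sym (Hole.empty hole)) (inj₁ (≤-reflexive (sym at-row)))
      stop : ∀ j′ → j ≡ suc j′ → g 0 j′ ≡ nothing
      stop j′ e with g 0 j′ in eq
      ... | nothing = refl
      ... | just x  = ⊥-elim (≤⇒≯ (cell-≤ (Hole.cells hole 0 j′ (inj₂ (λ e′ → <⇒≢ ≤-refl (trans e′ e)))) z≤n
          (≤-trans (≤-trans (≤-reflexive (sym e)) (n≤1+n j)) (≤-reflexive (sym (trans (cong (M 0) (sym start)) at-row)))) eq)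
          (proj₁ (proj₁ (subst (λ m → CellOK m M 0 j′) eq (Hole.cells hole 0 j′ (inj₂ (λ e′ → <⇒≢ ≤-refl (trans e′ e))))))))
    slide-raiseAll (suc t) {j} {g} {M} t<N st with [ step-stay t<N st , step-up t<N st ]′ (moves t<N)
    ... | g′ , p , st′ = subst (λ g → Final g _) (sym p) (slide-raiseAll t (<⇒≤ t<N) st′)

-- Promotion

Lex : ℕ × ℕ → ℕ × ℕ → Set
Lex (c , r) (c′ , r′) = c < c′ ⊎ (c ≡ c′ × r < r′)

Lex-irrefl : ∀ {p} → ¬ Lex p p
Lex-irrefl (inj₁ h)       = <-irrefl refl h
Lex-irrefl (inj₂ (_ , h)) = <-irrefl refl h

cartesianProduct-Lex : ∀ {xs ys} → AllPairs _<_ xs → AllPairs _<_ ys → AllPairs Lex (cartesianProduct xs ys)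
cartesianProduct-Lex []                  _  = []
cartesianProduct-Lex {x ∷ xs} {ys} (x< ∷ sx) sy = AllPairs.++⁺
  (AllPairs.map⁺ (AllPairs.map (λ y< → inj₂ (refl , y<)) sy))
  (cartesianProduct-Lex sx sy)
  (All.tabulate λ p → let y , _ , e = ∈-map⁻ (x ,_) p in
    subst (λ p → All (Lex p) _) (sym e) (All.tabulate λ q → inj₁ (All.lookup x< (proj₁ (∈-cartesianProduct⁻ xs ys q)))))

Chain-≤ : ∀ {n ms L} → Chain n ms L → ∀ {k} → k ≤ n → ∀ r → L k r ≤ rowLength ms r
Chain-≤ {n} {ms} {L} ch {k} k≤n r = ≤-trans (go n ≤-refl k≤n) (≤-reflexive (top r))
  where
  open Chain ch
  go : ∀ m → m ≤ n → k ≤ m → L k r ≤ L m r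
  go zero    m≤ z≤n = ≤-refl
  go (suc m) m< k≤m with m≤n⇒m<n∨m≡n k≤m
  ... | inj₁ (s≤s h) = ≤-trans (go m (<⇒≤ m<) h) (mono m< r)
  ... | inj₂ refl    = ≤-refl

module _ (N : ℕ) {ms : List ℕ} (decreasing : ∀ r → rowLength ms (suc r) ≤ rowLength ms r) where

  private
    n = suc N

    rowLength-≤ : ∀ {r r′} → r ≤ r′ → rowLength ms r′ ≤ rowLength ms r
    rowLength-≤ {r} {zero} z≤n = ≤-refl
    rowLength-≤ {r} {suc r′} h with m≤n⇒m<n∨m≡n h
    ... | inj₁ (s≤s h′) = ≤-trans (decreasing r′) (rowLength-≤ h′)
    ... | inj₂ refl     = ≤-refl

  record Processed (m : ℕ) (g : Grid) (L L′ : Levels) : Set where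
    field
      slides : Slides n ms m L L′
      cells  : ∀ r c → CellOK N (g r c) L′ r c
      chain  : Chain n ms L′
      full   : ∀ r → L′ N r ≡ rowLength ms r
      totals : ∀ {k} → k ≤ N → sumTo (length ms) (L′ k) ≡ m + sumTo (length ms) (L k)

  -- The remaining dots fill each row from level `N` to its end, and `ρ` is the guard left by the
  -- preceding dot. As no remaining dot lies below row `ρ N`, the next path stays weakly above `ρ`,
  -- ends in row 0 and becomes the next guard.
  processDots : ∀ ds {g L ρ} → (∀ r c → CellOK N (g r c) L r c) → Chain n ms L → Guard n L ρ →
    AllPairs Lex ds → (∀ {c r} → (c , r) ∈ˡ ds → L N r ≤ c × c < rowLength ms r) →
    (∀ {c r} → L N r ≤ c → c < rowLength ms r → (c , r) ∈ˡ ds) →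
    (∀ {c r} → (c , r) ∈ˡ ds → r ≤ ρ N) →
    ∃[ L′ ] Processed (length ds) (foldl (λ g (j , i) → slide g i j) g ds) L L′
  processDots [] {L = L} cells chain guard _ _ complete _ = L , record
    { slides = done ; cells = cells ; chain = chain ; totals = λ _ → refl
    ; full   = λ r → ≤-antisym (Chain-≤ chain (n≤1+n N) r) (≮⇒≥ λ h → case (complete ≤-refl h)) }
    where
    case : ∀ {p} → ¬ p ∈ˡ []
    case ()
  processDots ((j , i) ∷ ds) {g} {L} {ρ} cells chain guard (lex ∷ sorted) sound complete rows =
    let L″ , pr = processDots ds (Final.cells final) chain′ (bump-guard start moves raised) sorted sound′ complete′ rows′
        module P = Processed pr
    in L″ , record
      { slides = record { chain = chain ; ρ = σ ; guard = moves⇒guard start moves ; raised = raised ; top = λ r → raiseAll-≥ n σ L r ≤-refl } ∷ P.slides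
      ; cells  = P.cells
      ; chain  = P.chain
      ; full   = P.full
      ; totals = λ {k} k≤N → trans (P.totals k≤N) (trans (cong (length ds +_) (trans (sumTo-cong (length ms) (raised (s≤s k≤N)))
                   (sumTo-bump (L k) (σ< k≤N)))) (+-suc (length ds) _))
      }
    where
    open Chain chain
    σ = trace L N i
    moves : ∀ {k} → k < N → Stay L σ k ⊎ Up L σ k
    moves = trace-step L N i
    σN : σ N ≡ i
    σN = trace-start L N i
    start : σ 0 ≡ 0
    start = n≤0⇒n≡0 (≤-trans (guarded guard moves (≤-trans (≤-reflexive σN) (rows (here refl))) N 0 refl)
              (≤-reflexive (Guard.start guard)))
    -- A cell of row `i` between level `N` and the dot would be a dot further to the left, against
    -- the order of processing.
    j≡ : j ≡ L N i
    j≡ with proj₁ (sound (here refl)) | m≤n⇒m<n∨m≡n (proj₁ (sound (here refl)))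
    ... | _   | inj₂ e = sym e
    ... | L≤j | inj₁ L<j with complete {L N i} {i} ≤-refl (<-trans L<j (proj₂ (sound (here refl))))
    ...   | here e  = ⊥-elim (<⇒≢ L<j (cong proj₁ e))
    ...   | there p with All.lookup lex p
    ...     | inj₁ h       = ⊥-elim (<-asym L<j h)
    ...     | inj₂ (e , _) = ⊥-elim (<⇒≢ L<j (sym e))

    j<row : j < rowLength ms i
    j<row = proj₂ (sound (here refl))

    empty : g i j ≡ nothing
    empty with g i j in eq
    ... | nothing = refl
    ... | just x  = ⊥-elim (<-irrefl j≡ (proj₁ (proj₂ ok N ≤-refl) (proj₂ (proj₁ ok))))
      where ok = subst (λ m → CellOK N m L i j) eq (cells i j)

    state : Passed N L σ (λ { (k≤N) r → mono (s≤s k≤N) r }) (λ { k≤N r → inter (s≤s k≤N) r }) start moves N j g (raise N (σ N) L)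
    state = record
      { hole   = subst (λ i → Hole N g i j (raise N i L)) (sym σN)
                   (raise-Hole N (sym j≡) (record { cells = λ r c _ → cells r c ; empty = empty }))
      ; column = trans j≡ (cong (L N) (sym σN))
      ; below  = λ k<N r → raise-≢ L r (<⇒≢ k<N)
      ; at     = λ r → raise-≡ N (σ N) L r
      ; mono   = mono′
      ; inter  = inter′
      }
      where
      mono′ : ∀ {k} → k ≤ N → ∀ r → raise N (σ N) L k r ≤ raise N (σ N) L (suc k) r
      mono′ {k} k≤N r with k ≟ N
      ... | no _ = ≤-trans (mono (s≤s k≤N) r) (raise-≥ N (σ N) L (suc k) r)
      ... | yes refl rewrite raise-≢ {N} {σ N} L r (<⇒≢ (n<1+n N) ∘ sym) with r ≟ σ N
      ...   | no _  = mono ≤-refl r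
      ...   | yes r≡ = ≤-trans (≤-reflexive (cong suc (trans (cong (L N) (trans r≡ σN)) (sym j≡))))
                      (≤-trans j<row (≤-reflexive (trans (cong (rowLength ms) (sym (trans r≡ σN))) (sym (top r)))))
      inter′ : ∀ {k} → N ≤ k → k ≤ N → ∀ r → raise N (σ N) L (suc k) (suc r) ≤ raise N (σ N) L k r
      inter′ N≤k k≤N r with refl ← ≤-antisym N≤k k≤N rewrite raise-≢ {N} {σ N} L (suc r) (<⇒≢ (n<1+n N) ∘ sym) =
        ≤-trans (inter ≤-refl r) (raise-≥ N (σ N) L N r)

    L′ : Levels
    L′ = raiseAll n σ L

    final : Final N L σ _ _ start moves (slide g i j) L′
    final = subst (λ i → Final N L σ _ _ start moves (slide g i j) L′) σN
      (slide-raiseAll N L σ _ _ start moves N ≤-refl state)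

    raised : ∀ {k} → k < n → ∀ r → L′ k r ≡ bump (σ k) (L k) r
    raised k<n r = raiseAll-< n σ L r k<n

    chain′ : Chain n ms L′
    chain′ = record
      { mono   = λ { (s≤s k≤N) r → Final.mono final k≤N r }
      ; inter  = λ { (s≤s k≤N) r → Final.inter final k≤N r }
      ; top    = λ r → trans (raiseAll-≥ n σ L r ≤-refl) (top r)
      ; bottom = λ r → trans (raised (s≤s z≤n) (suc r)) (trans (cong (λ i → bump i (L 0) (suc r)) start)
                   (trans (bump-≢ {0} {suc r} (L 0) (λ ())) (bottom r)))
      }

    -- The raised level is positive in row `σ k`, and rows outside the diagram have length 0.
    σ< : ∀ {k} → k ≤ N → σ k < length ms
    σ< {k} k≤N = ≰⇒> λ h → <⇒≢ {0} (s≤s z≤n) (sym (n≤0⇒n≡0 (≤-trans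
      (≤-reflexive (sym (trans (raised (s≤s k≤N) (σ k)) (bump-≡ (σ k) (L k)))))
      (≤-trans (Chain-≤ chain′ (m≤n⇒m≤1+n k≤N) (σ k)) (≤-reflexive (rowLength-beyond ms h))))))

    L′N : ∀ r → L′ N r ≡ bump i (L N) r
    L′N r = trans (raised ≤-refl r) (cong (λ i → bump i (L N) r) σN)

    sound′ : ∀ {c r} → (c , r) ∈ˡ ds → L′ N r ≤ c × c < rowLength ms r
    sound′ {c} {r} p = ≤-trans (≤-reflexive (L′N r)) lower′ , proj₂ (sound (there p))
      where
      lower′ : bump i (L N) r ≤ c
      lower′ with r ≟ i
      ... | no _ = proj₁ (sound (there p))
      ... | yes refl = ≤∧≢⇒< (proj₁ (sound (there p))) λ e → Lex-irrefl (subst (λ c → Lex (j , i) (c , i)) (sym (trans j≡ e)) (All.lookup lex p))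

    complete′ : ∀ {c r} → L′ N r ≤ c → c < rowLength ms r → (c , r) ∈ˡ ds
    complete′ {c} {r} h c< with complete (≤-trans (bump-≥ i (L N) r) (≤-trans (≤-reflexive (sym (L′N r))) h)) c<
    ... | there p   = p
    ... | here refl = ⊥-elim (<-irrefl (sym j≡) (≤-trans (≤-reflexive (sym (trans (L′N r) (bump-≡ r (L N))))) h))

    -- The entries `n` form a horizontal strip: by interlacing the rows below row `i` end at or
    -- before column `j`, while later dots lie in column `j` or further right.
    rows′ : ∀ {c r} → (c , r) ∈ˡ ds → r ≤ σ N
    rows′ {c} {r} p = ≤-trans (≮⇒≥ λ i<r → ≤⇒≯ (c≥ (All.lookup lex p))
        (<-≤-trans (proj₂ (sound (there p))) (≤-trans (rowLength-≤ i<r)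
          (≤-trans (≤-reflexive (sym (top (suc i)))) (≤-trans (inter ≤-refl i) (≤-reflexive (sym j≡)))))))
      (≤-reflexive (sym σN))
      where
      c≥ : Lex (j , i) (c , r) → j ≤ c
      c≥ (inj₁ h)       = <⇒≤ h
      c≥ (inj₂ (e , _)) = ≤-reflexive e

rowLength-≤-max : ∀ ms r → rowLength ms r ≤ foldr _⊔_ 0 ms
rowLength-≤-max []       r       = z≤n
rowLength-≤-max (m ∷ ms) zero    = m≤m⊔n m _
rowLength-≤-max (m ∷ ms) (suc r) = ≤-trans (rowLength-≤-max ms r) (m≤n⊔m m _)

atMost-suc : ∀ k w → atMost (suc k) w ≡ count (suc k) w + atMost k w
atMost-suc k []      = refl
atMost-suc k (x ∷ w) with <-cmp x (suc k)
... | tri< x≤k x≢ _ = trans (atMost-accept w (<⇒≤ x≤k)) (trans (cong suc (atMost-suc k w))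
  (trans (sym (+-suc _ _)) (sym (cong₂ _+_ (count-≢ w x≢) (atMost-accept w (s≤s⁻¹ x≤k))))))
... | tri≈ x≮ refl _ = trans (atMost-accept w ≤-refl) (trans (cong suc (atMost-suc k w))
  (sym (cong₂ _+_ (count-≡ (suc k) w) (atMost-reject w (<-irrefl refl)))))
... | tri> _ x≢ x> = trans (atMost-reject w (<⇒≱ x>)) (trans (atMost-suc k w)
  (sym (cong₂ _+_ (count-≢ w x≢) (atMost-reject w (λ x≤k → ≤⇒≯ x≤k (<⇒≤ x>))))))

sum-map-length : ∀ (T : Filling) → sum (map length T) ≡ length (concat T)
sum-map-length []      = refl
sum-map-length (w ∷ T) = trans (cong (length w +_) (sum-map-length T)) (sym (length-++ w))

module _ {n : ℕ} {Λ : YoungDiagram} {T : Filling} (t : SST n Λ T) where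
  open SST t

  All-concat : All (InRange n) (concat T)
  All-concat = All.concat⁺ entries

  length-concat : length (concat T) ≡ ∣_∣ Λ
  length-concat = trans (sym (sum-map-length T)) (cong sum shape)

  atMost-all : atMost n (concat T) ≡ ∣_∣ Λ
  atMost-all = trans (cong length (filter-all (_≤? n) (All.map proj₂ All-concat))) length-concat

  atMost-0 : atMost 0 (concat T) ≡ 0
  atMost-0 = go All-concat
    where
    go : ∀ {w} → All (InRange n) w → atMost 0 w ≡ 0
    go []              = refl
    go {_ ∷ w} ((1≤x , _) ∷ all) = trans (atMost-reject w (<⇒≱ 1≤x)) (go all)

  length-T : length T ≡ ℓ Λ
  length-T = trans (sym (length-map length T)) (cong length shape)

module Promotion (N : ℕ) {Λ : YoungDiagram} where

  private
    n  = suc N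
    ms = rows Λ
    decreasing = rowLength-decreasing (YoungDiagram.decreasing Λ)

  module _ {T : Filling} (t : SST n Λ T) where
    private
      module t = SST t
      L = level T

      inside : ∀ {r c} → c < rowLength ms r → ∃[ x ] entry T r c ≡ just x
      inside {r} {c} h = entry-inside T (subst (λ ms → c < rowLength ms r) (sym t.shape) h)

      inside⁻ : ∀ {r c x} → entry T r c ≡ just x → c < rowLength ms r
      inside⁻ {r} {c} e = subst (λ ms → c < rowLength ms r) t.shape (entry-inside⁻ T r c e)

      L≤ : ∀ k r → L k r ≤ rowLength ms r
      L≤ k r = subst (λ ms → L k r ≤ rowLength ms r) t.shape (level-≤ T k r)

      to : ∀ k {r c x} → entry T r c ≡ just x → x ≤ k → c < L k r
      to k {r} {c} e = proj₁ (entry-level t k r c e)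

      from : ∀ k {r c x} → entry T r c ≡ just x → c < L k r → x ≤ k
      from k {r} {c} e = proj₂ (entry-level t k r c e)

      L0 : ∀ r → L 0 r ≡ 0
      L0 r = n≤0⇒n≡0 (≤-from-< λ c h → let x , e = inside (<-≤-trans h (L≤ 0 r)) in
        ⊥-elim (<⇒≱ (proj₁ (entry-inRange t r c e)) (from 0 e h)))

      chain : Chain n ms L
      chain = record
        { mono   = λ {k} _ r → ≤-from-< λ c h → let x , e = inside (<-≤-trans h (L≤ k r)) in
                     to (suc k) e (m≤n⇒m≤1+n (from k e h))
        ; inter  = λ {k} _ r → ≤-from-< λ c h →
                     let h′ = <-≤-trans h (L≤ (suc k) (suc r))
                         y , e′ = inside h′
                         x , e  = inside (<-≤-trans h′ (decreasing r))
                     in to k e (s≤s⁻¹ (≤-trans (entry-columns t r c e e′) (from (suc k) e′ h)))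
        ; top    = λ r → ≤-antisym (L≤ n r) (≤-from-< λ c h → let x , e = inside h in
                     to n e (proj₂ (entry-inRange t r c e)))
        ; bottom = λ r → L0 (suc r)
        }

      L-below : ∀ {k r} → k ≤ n → k ≤ r → L k r ≡ 0
      L-below {zero}  {r}     _   _         = L0 r
      L-below {suc k} {suc r} k<n (s≤s k≤r) = n≤0⇒n≡0 (≤-trans (Chain.inter chain k<n r) (≤-reflexive (L-below (<⇒≤ k<n) k≤r)))

      -- The first dot has no predecessor, and the diagonal takes its place. Columns are strict, so
      -- row `k`, counted from 0, has no entry at most `k`, and `Up` holds at every level.
      guard : Guard n L id
      guard = record { start = refl ; step = λ {k} k<n → inj₂ (refl ,
        ≤-trans (≤-reflexive (L-below {k} {k} (<⇒≤ (<⇒≤ k<n)) ≤-refl)) z≤n) }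

      cells : ∀ r c → CellOK N (dotted n T r c) L r c
      cells r c with entry T r c in eq
      ... | nothing = inj₂ (≤-trans (L≤ N r) (≮⇒≥ λ h → case (trans (sym eq) (proj₂ (inside h)))))
        where
        case : ∀ {x : ℕ} → ¬ nothing ≡ just x
        case ()
      ... | just x with x ≡ᵇ n in e
      ...   | true  = inj₂ (≮⇒≥ λ h → <-irrefl (≡ᵇ⇒≡ x n (subst IsTrue (sym e) _)) (s≤s (from N eq h)))
      ...   | false = (proj₁ range , s≤s⁻¹ (≤∧≢⇒< (proj₂ range) (λ x≡n → subst IsTrue e (≡⇒≡ᵇ x n x≡n))))
                    , λ k _ → to k eq , from k eq
        where range = entry-inRange t r c eq

      ds = dots n T

      isDot? : ∀ (p : ℕ × ℕ) → Dec (entry T (proj₂ p) (proj₁ p) ≡ just n)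
      isDot? (c , r) = ≡-dec _≟_ (entry T r c) (just n)

      sorted : AllPairs Lex ds
      sorted = AllPairs.filter⁺ isDot? (cartesianProduct-Lex (upTo-< (foldr _⊔_ 0 (map length T))) (upTo-< (length T)))
        where
        upTo-< : ∀ m → AllPairs _<_ (upTo m)
        upTo-< m = AllPairs.applyUpTo⁺₁ id m (λ i<j _ → i<j)

      sound : ∀ {c r} → (c , r) ∈ˡ ds → L N r ≤ c × c < rowLength ms r
      sound {c} {r} p = ≮⇒≥ (λ h → <-irrefl refl (s≤s (from N e h))) , inside⁻ e
        where
        e : entry T r c ≡ just n
        e = proj₂ (∈-filter⁻ isDot? {xs = cartesianProduct (upTo (foldr _⊔_ 0 (map length T))) (upTo (length T))} p)

      complete : ∀ {c r} → L N r ≤ c → c < rowLength ms r → (c , r) ∈ˡ ds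
      complete {c} {r} h c< = ∈-filter⁺ isDot? (∈-cartesianProduct⁺
          (∈-upTo⁺ (<-≤-trans c< (≤-trans (rowLength-≤-max ms r) (≤-reflexive (cong (foldr _⊔_ 0) (sym t.shape))))))
          (∈-upTo⁺ (subst (r <_) (sym (length-T t)) r<)))
        (trans e (cong just (≤-antisym (proj₂ (entry-inRange t r c e)) (≰⇒> λ x≤N → ≤⇒≯ h (to N e x≤N)))))
        where
        x = proj₁ (inside c<)
        e = proj₂ (inside c<)
        r< : r < length ms
        r< = ≰⇒> λ ℓ≤r → <⇒≱ c< (≤-trans (≤-reflexive (rowLength-beyond ms ℓ≤r)) z≤n)

      rows≤N : ∀ {c r} → (c , r) ∈ˡ ds → r ≤ N
      rows≤N {c} {r} p = ≮⇒≥ λ N<r → <⇒≱ (proj₂ (sound p))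
        (≤-trans (≤-reflexive (trans (sym (Chain.top chain r)) (L-below ≤-refl N<r))) z≤n)

    final : Levels
    final = proj₁ (processDots N decreasing ds cells chain guard sorted sound complete rows≤N)

    processed : Processed N decreasing (length ds) (slideAll n T) (level T) final
    processed = proj₂ (processDots N decreasing ds cells chain guard sorted sound complete rows≤N)

    private
      module P = Processed processed
      module C = Chain P.chain

      V : ℕ → ℕ → ℕ
      V r c = maybe suc 1 (slideAll n T r c)

      final-mono : ∀ {k} → k ≤ N → ∀ r → final 0 r ≤ final k r
      final-mono {zero}  _   r = ≤-refl
      final-mono {suc k} k<N r = ≤-trans (final-mono (<⇒≤ k<N) r) (C.mono (m≤n⇒m≤1+n k<N) r)

      V-level : ∀ {k r c} → k ≤ N → c < rowLength ms r → (V r c ≤ suc k → c < final k r) × (c < final k r → V r c ≤ suc k)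
      V-level {k} {r} {c} k≤N c< with slideAll n T r c | P.cells r c
      ... | just x  | _ , h      = proj₁ (h k k≤N) ∘ s≤s⁻¹ , s≤s ∘ proj₂ (h k k≤N)
      ... | nothing | inj₁ h     = (λ _ → <-≤-trans h (final-mono k≤N r)) , (λ _ → s≤s z≤n)
      ... | nothing | inj₂ h     = ⊥-elim (<⇒≱ c< (≤-trans (≤-reflexive (sym (P.full r))) h))

      V-range : ∀ {r c} → ∃[ k ] V r c ≡ suc k × k ≤ N
      V-range {r} {c} with slideAll n T r c | P.cells r c
      ... | just x  | (_ , x≤N) , _ = x , refl , x≤N
      ... | nothing | _             = 0 , refl , z≤n

      tableau : Tableau {n} {Λ} V
      tableau = record
        { inRange = λ {r} {c} _ → let k , e , k≤N = V-range {r} {c} in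
            subst (InRange n) (sym e) (s≤s z≤n , s≤s k≤N)
        ; weak    = λ {r} {c} h → let k , e , k≤N = V-range {r} {suc c} in
            ≤-trans (proj₂ (V-level k≤N (<⇒≤ h)) (<⇒≤ (proj₁ (V-level k≤N h) (≤-reflexive e)))) (≤-reflexive (sym e))
        ; strict  = λ {r} {c} h → strict r c h (V-range {suc r} {c})
        }
        where
        strict : ∀ r c → c < rowLength ms (suc r) → ∃[ k ] V (suc r) c ≡ suc k × k ≤ N → V r c < V (suc r) c
        strict r c h (zero  , e , k≤N) = ⊥-elim (<⇒≱ (proj₁ (V-level k≤N h) (≤-reflexive e)) (≤-trans (≤-reflexive (C.bottom r)) z≤n))
        strict r c h (suc k , e , k<N) = ≤-trans (s≤s (proj₂ (V-level (<⇒≤ k<N) (<-≤-trans h (decreasing r)))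
          (<-≤-trans (proj₁ (V-level k<N h) (≤-reflexive e)) (C.inter (m≤n⇒m≤1+n k<N) r)))) (≤-reflexive (sym e))

      pr≡ : pr n T ≡ fromGrid ms V
      pr≡ = cong (λ ms → fromGrid ms V) t.shape

    pr-SST : SST n Λ (pr n T)
    pr-SST = subst (SST n Λ) (sym pr≡) (fromGrid-SST tableau)

    level-pr : ∀ {k} → k ≤ N → ∀ r → level (pr n T) (suc k) r ≡ final k r
    level-pr {k} k≤N r = ≤-antisym
      (≤-from-< λ c h → let c< = <-≤-trans h (level≤ r) in
        proj₁ (V-level k≤N c<) (proj₂ (entry-level pr-SST (suc k) r c (entry≡ c<)) h))
      (≤-from-< λ c h → let c< = <-≤-trans h (Chain-≤ P.chain (m≤n⇒m≤1+n k≤N) r) in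
        proj₁ (entry-level pr-SST (suc k) r c (entry≡ c<)) (proj₂ (V-level k≤N c<) h))
      where
      level≤ : ∀ r → level (pr n T) (suc k) r ≤ rowLength ms r
      level≤ r = subst (λ ms → level (pr n T) (suc k) r ≤ rowLength ms r) (SST.shape pr-SST) (level-≤ (pr n T) (suc k) r)
      entry≡ : ∀ {r c} → c < rowLength ms r → entry (pr n T) r c ≡ just (V r c)
      entry≡ {r} {c} c< = trans (cong (λ T → entry T r c) pr≡) (entry-fromGrid ms V c<)

    atMost-pr : ∀ {k} → k ≤ N → atMost (suc k) (concat (pr n T)) ≡ length (dots n T) + atMost k (concat T)
    atMost-pr {k} k≤N = begin
      atMost (suc k) (concat (pr n T))                    ≡⟨ sumTo-level (pr n T) (suc k) ⟨
      sumTo (length (pr n T)) (level (pr n T) (suc k))    ≡⟨ cong (λ m → sumTo m (level (pr n T) (suc k))) (length-T pr-SST) ⟩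
      sumTo (ℓ Λ) (level (pr n T) (suc k))                ≡⟨ sumTo-cong (ℓ Λ) (level-pr k≤N) ⟩
      sumTo (ℓ Λ) (final k)                               ≡⟨ P.totals k≤N ⟩
      length (dots n T) + sumTo (ℓ Λ) (level T k)         ≡⟨ cong (λ m → length (dots n T) + sumTo m (level T k)) (length-T t) ⟨
      length (dots n T) + sumTo (length T) (level T k)    ≡⟨ cong (length (dots n T) +_) (sumTo-level T k) ⟩
      length (dots n T) + atMost k (concat T)             ∎
      where open ≡-Reasoning

    pr-rotates : Rotates n (λ v → count v (concat T)) (λ v → count v (concat (pr n T)))
    pr-rotates = first , λ { (suc v) _ (s≤s v<N) → middle v v<N }
      where
      m = length (dots n T)
      w = concat T
      w′ = concat (pr n T)
      open ≡-Reasoning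
      first : count 1 w′ ≡ count n w
      first = +-cancelʳ-≡ (atMost N w) _ _ (begin
        count 1 w′ + atMost N w   ≡⟨ cong (_+ atMost N w) (trans (sym (+-identityʳ _)) (trans (cong (count 1 w′ +_) (sym (atMost-0 pr-SST))) (sym (atMost-suc 0 w′)))) ⟩
        atMost 1 w′ + atMost N w  ≡⟨ cong (_+ atMost N w) (trans (atMost-pr z≤n) (trans (cong (m +_) (atMost-0 t)) (+-identityʳ m))) ⟩
        m + atMost N w            ≡⟨ atMost-pr ≤-refl ⟨
        atMost n w′               ≡⟨ trans (atMost-all pr-SST) (sym (atMost-all t)) ⟩
        atMost n w                ≡⟨ atMost-suc N w ⟩
        count n w + atMost N w    ∎)
      middle : ∀ v → v < N → count (suc (suc v)) w′ ≡ count (suc v) w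
      middle v v<N = +-cancelʳ-≡ (m + atMost v w) _ _ (begin
        count (suc (suc v)) w′ + (m + atMost v w)         ≡⟨ cong (count (suc (suc v)) w′ +_) (atMost-pr (<⇒≤ v<N)) ⟨
        count (suc (suc v)) w′ + atMost (suc v) w′        ≡⟨ atMost-suc (suc v) w′ ⟨
        atMost (suc (suc v)) w′                           ≡⟨ atMost-pr v<N ⟩
        m + atMost (suc v) w                              ≡⟨ cong (m +_) (atMost-suc v w) ⟩
        m + (count (suc v) w + atMost v w)                ≡⟨ x∙yz≈y∙xz m (count (suc v) w) _ ⟩
        count (suc v) w + (m + atMost v w)                ∎)

  level-determines : ∀ {T T′} → SST n Λ T → SST n Λ T′ → (∀ {k} → k ≤ n → ∀ r → level T k r ≡ level T′ k r) → T ≡ T′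
  level-determines {T} {T′} t t′ e = filling-ext (trans (SST.shape t) (sym (SST.shape t′))) λ r c x y ex ey → ≤-antisym
    (proj₂ (entry-level t y r c ex) (subst (c <_) (sym (e (proj₂ (entry-inRange t′ r c ey)) r)) (proj₁ (entry-level t′ y r c ey) ≤-refl)))
    (proj₂ (entry-level t′ x r c ey) (subst (c <_) (e (proj₂ (entry-inRange t r c ex)) r) (proj₁ (entry-level t x r c ex) ≤-refl)))

  -- The number of dots is the number of entries 1 in the image. Equal images thus come from equally
  -- many slides, which can be undone one at a time.
  pr-injective : ∀ {T T′} → SST n Λ T → SST n Λ T′ → pr n T ≡ pr n T′ → T ≡ T′
  pr-injective {T} {T′} t t′ e = level-determines t t′
    (Slides-injective (Processed.slides p) (subst (λ m → Slides n ms m _ _) (sym m≡) (Processed.slides p′)) same)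
    where
    p = processed t
    p′ = processed t′
    same : ∀ {k} → k ≤ n → ∀ r → final t k r ≡ final t′ k r
    same {k} k≤n r with m≤n⇒m<n∨m≡n k≤n
    ... | inj₁ (s≤s k≤N) = trans (sym (level-pr t k≤N r)) (trans (cong (λ T → level T (suc k) r) e) (level-pr t′ k≤N r))
    ... | inj₂ refl      = trans (Chain.top (Processed.chain p) r) (sym (Chain.top (Processed.chain p′) r))
    size : ∀ {T} (t : SST n Λ T) → atMost 1 (concat (pr n T)) ≡ length (dots n T)
    size {T} t = trans (atMost-pr t z≤n) (trans (cong (length (dots n T) +_) (atMost-0 t)) (+-identityʳ _))
    m≡ : length (dots n T) ≡ length (dots n T′)
    m≡ = trans (sym (size t)) (trans (cong (atMost 1 ∘ concat) e) (size t′))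

-- Iteration on the finite set of tableaux

words : ℕ → ℕ → List (List ℕ)
words n zero    = [] ∷ []
words n (suc m) = cartesianProductWith _∷_ (upTo (suc n)) (words n m)

∈-words : ∀ {n w} → All (InRange n) w → w ∈ˡ words n (length w)
∈-words []                  = here refl
∈-words ((_ , x≤n) ∷ all) = ∈-cartesianProductWith⁺ _∷_ (∈-upTo⁺ (s≤s x≤n)) (∈-words all)

fillings : ℕ → List ℕ → List Filling
fillings n []       = [] ∷ []
fillings n (m ∷ ms) = cartesianProductWith _∷_ (words n m) (fillings n ms)

∈-fillings : ∀ {n T} → All (All (InRange n)) T → T ∈ˡ fillings n (map length T)
∈-fillings []          = here refl
∈-fillings (all ∷ ps) = ∈-cartesianProductWith⁺ _∷_ (∈-words all) (∈-fillings ps)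

_≟ᶠ_ : (T U : Filling) → Dec (T ≡ U)
_≟ᶠ_ = List-≡-dec (List-≡-dec _≟_)

SST? : ∀ n Λ T → Dec (SST n Λ T)
SST? n Λ T = map′
  (λ (a , b , c , d) → record { shape = a ; entries = b ; rowWeak = c ; colStrict = d })
  (λ t → let open SST t in shape , entries , rowWeak , colStrict)
  (List-≡-dec _≟_ (map length T) (rows Λ)
    ×-dec all? (all? (λ x → 1 ≤? x ×-dec x ≤? n)) T
    ×-dec all? (linked? _≤?_) T
    ×-dec linked? (λ upper lower → prefix? _>?_ lower upper) T)

tableaux : ℕ → YoungDiagram → List Filling
tableaux n Λ = filter (SST? n Λ) (fillings n (rows Λ))

∈-tableaux⁺ : ∀ {n Λ T} → SST n Λ T → T ∈ˡ tableaux n Λ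
∈-tableaux⁺ {n} {Λ} {T} t = ∈-filter⁺ (SST? n Λ) (subst (λ ms → T ∈ˡ fillings n ms) (SST.shape t) (∈-fillings (SST.entries t))) t

∈-tableaux⁻ : ∀ {n Λ T} → T ∈ˡ tableaux n Λ → SST n Λ T
∈-tableaux⁻ {n} {Λ} p = proj₂ (∈-filter⁻ (SST? n Λ) {xs = fillings n (rows Λ)} p)

^-+ : ∀ (f : Filling → Filling) a b T → (f ^ (a + b)) T ≡ (f ^ a) ((f ^ b) T)
^-+ f zero    b T = refl
^-+ f (suc a) b T = cong f (^-+ f a b T)

^-* : ∀ (f : Filling → Filling) a b T → ((f ^ a) ^ b) T ≡ (f ^ (b * a)) T
^-* f a zero    T = refl
^-* f a (suc b) T = trans (cong (f ^ a) (^-* f a b T)) (sym (^-+ f a (b * a) T))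

^-periodic : ∀ f {m T} → (f ^ m) T ≡ T → ∀ q → (f ^ (q * m)) T ≡ T
^-periodic f {m} {T} e zero    = refl
^-periodic f {m} {T} e (suc q) = trans (^-+ f m (q * m) T) (trans (cong (f ^ m) (^-periodic f e q)) e)

^-% : ∀ f {m T} .{{_ : NonZero m}} → (f ^ m) T ≡ T → ∀ k → (f ^ k) T ≡ (f ^ (k % m)) T
^-% f {m} {T} e k = trans (cong (λ k → (f ^ k) T) (m≡m%n+[m/n]*n k m))
  (trans (^-+ f (k % m) (k / m * m) T) (cong (f ^ (k % m)) (^-periodic f e (k / m))))

^-closed : ∀ {f} (X : Pred Filling 0ℓ) → (∀ {T} → X T → X (f T)) → ∀ k {T} → X T → X ((f ^ k) T)
^-closed X cl zero    x = x
^-closed X cl (suc k) x = cl (^-closed X cl k x)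

IsOrder-∣ : ∀ {f S m} → IsOrder f S m → ∀ {k} → IsIdentityOn S (f ^ k) → m ∣ k
IsOrder-∣ {f} {S} {m} o {k} h = m%n≡0⇒n∣m k m (zero-remainder (k % m) refl)
  where
  open IsOrder o
  instance
    m≢0 : NonZero m
    m≢0 = >-nonZero positive
  zero-remainder : ∀ r → r ≡ k % m → k % m ≡ 0
  zero-remainder zero    e = sym e
  zero-remainder (suc r) e = ⊥-elim (<⇒≱ (m%n<n k m) (subst (m ≤_) e (least (suc r) (s≤s z≤n)
    λ T s → trans (cong (λ k → (f ^ k) T) e) (trans (sym (^-% f (identity T s) k)) (h T s)))))

leastPositive : ∀ {P : ℕ → Set} → (∀ k → Dec (P k)) → ∀ {k} → 0 < k → P k → ∃[ m ] 0 < m × P m × (∀ j → 0 < j → P j → m ≤ j)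
leastPositive {P} P? {k} 0<k pk = search k 1 (s≤s z≤n) (m<m+n k (s≤s z≤n)) (λ j 0<j _ → 0<j)
  where
  search : ∀ d m → 0 < m → k < d + m → (∀ j → 0 < j → P j → m ≤ j) → ∃[ m ] 0 < m × P m × (∀ j → 0 < j → P j → m ≤ j)
  search zero    m 0<m k<m below = ⊥-elim (<⇒≱ k<m (below k 0<k pk))
  search (suc d) m 0<m k<  below with P? m
  ... | yes p = m , 0<m , p , below
  ... | no ¬p = search d (suc m) (s≤s z≤n) (subst (k <_) (sym (+-suc d m)) k<)
                  λ j 0<j pj → ≤∧≢⇒< (below j 0<j pj) (λ { refl → ¬p pj })

module FiniteDynamics (f : Filling → Filling) (X : Pred Filling 0ℓ) (xs : List Filling) (enumerates : ∀ {T} → X T → T ∈ˡ xs)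
    (closed : ∀ {T} → X T → X (f T)) (injective : ∀ {T U} → X T → X U → f T ≡ f U → T ≡ U) where

  ^-injective : ∀ k {T U} → X T → X U → (f ^ k) T ≡ (f ^ k) U → T ≡ U
  ^-injective zero    x y e = e
  ^-injective (suc k) x y e = ^-injective k x y (injective (^-closed X closed k x) (^-closed X closed k y) e)

  ^-cancel : ∀ {T i j} → X T → i ≤ j → (f ^ i) T ≡ (f ^ j) T → (f ^ (j ∸ i)) T ≡ T
  ^-cancel {T} {i} {j} x i≤j e = sym (^-injective i x (^-closed X closed (j ∸ i) x)
    (trans e (trans (cong (λ k → (f ^ k) T) (sym (m+[n∸m]≡n i≤j))) (^-+ f i (j ∸ i) T))))

  period : ∀ {T} → X T → ∃[ k ] 0 < k × (f ^ k) T ≡ T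
  period {T} x = toℕ j ∸ toℕ i , m<n⇒0<n∸m i<j , ^-cancel x (<⇒≤ i<j) same
    where
    member : ∀ (i : Fin (suc (length xs))) → (f ^ toℕ i) T ∈ˡ xs
    member i = enumerates (^-closed X closed (toℕ i) x)
    hole = pigeonhole ≤-refl (λ i → index (member i))
    i = proj₁ hole
    j = proj₁ (proj₂ hole)
    i<j = proj₁ (proj₂ (proj₂ hole))
    same : (f ^ toℕ i) T ≡ (f ^ toℕ j) T
    same = trans (lookup-index (member i)) (trans (cong (Data.List.lookup xs) (proj₂ (proj₂ (proj₂ hole)))) (sym (lookup-index (member j))))
      where import Data.List

  commonPeriod : ∀ {ys} → All X ys → ∃[ k ] 0 < k × All (λ T → (f ^ k) T ≡ T) ys
  commonPeriod []       = 1 , s≤s z≤n , []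
  commonPeriod {T ∷ _} (x ∷ all) with period x | commonPeriod all
  ... | k , 0<k , e | l , 0<l , es = k * l , *-mono-≤ 0<k 0<l
    , trans (cong (λ m → (f ^ m) T) (*-comm k l)) (^-periodic f e l) ∷ All.map (λ e → ^-periodic f e k) es

  order : ∀ (S : Pred Filling 0ℓ) (ys : List Filling) → (∀ {T} → S T → T ∈ˡ ys) → (∀ {T} → T ∈ˡ ys → S T) →
    (∀ {T} → S T → X T) → ∃[ m ] IsOrder f S m
  order S ys to from S⊆X with commonPeriod {ys} (All.tabulate (S⊆X ∘ from))
  ... | k , 0<k , es with leastPositive (λ k → all? (λ T → (f ^ k) T ≟ᶠ T) ys) 0<k es
  ...   | m , 0<m , fixes , least = m , record
    { positive = 0<m
    ; identity = λ T s → All.lookup fixes (to s)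
    ; least    = λ j 0<j h → least j 0<j (All.tabulate λ p → h _ (from p))
    }

-- Rotating contents

sumTo-snoc : ∀ m f → sumTo (suc m) f ≡ sumTo m f + f m
sumTo-snoc zero    f = +-comm (f 0) 0
sumTo-snoc (suc m) f = trans (cong (f 0 +_) (sumTo-snoc m (f ∘ suc))) (sym (+-assoc (f 0) _ _))

sumTo-cong-< : ∀ m {f g : ℕ → ℕ} → (∀ v → v < m → f v ≡ g v) → sumTo m f ≡ sumTo m g
sumTo-cong-< zero    e = refl
sumTo-cong-< (suc m) e = cong₂ _+_ (e 0 (s≤s z≤n)) (sumTo-cong-< m (λ v v<m → e (suc v) (s≤s v<m)))

sumTo-+ : ∀ m f g → sumTo m (λ v → f v + g v) ≡ sumTo m f + sumTo m g
sumTo-+ zero    f g = refl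
sumTo-+ (suc m) f g = trans (cong (f 0 + g 0 +_) (sumTo-+ m (f ∘ suc) (g ∘ suc)))
  (solve 4 (λ a b c d → (a :+ b) :+ (c :+ d) := (a :+ c) :+ (b :+ d)) refl (f 0) (g 0) _ _)
  where open +-*-Solver

weight size : ℕ → (ℕ → ℕ) → ℕ
weight n m = sumTo n (λ v → suc v * m (suc v))
size   n m = sumTo n (λ v → m (suc v))

-- Every letter gains 1, and each letter `n` then loses `n`. The term for the loss stands on the
-- left to avoid subtraction.
weight-rotates : ∀ {n m m′} → 1 ≤ n → Rotates n m m′ → weight n m′ + n * m n ≡ weight n m + size n m
weight-rotates {suc N} {m} {m′} _ (first , next) = begin
  (1 * m′ 1 + sumTo N (λ v → suc (suc v) * m′ (suc (suc v)))) + n * m n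
    ≡⟨ cong (_+ n * m n) (cong₂ _+_ (trans (*-identityˡ (m′ 1)) first)
         (trans (sumTo-cong-< N (λ v v<N → cong (suc (suc v) *_) (next (suc v) (s≤s z≤n) (s≤s v<N)))) (sumTo-+ N _ _))) ⟩
  (m n + (A + B)) + n * m n
    ≡⟨ solve 4 (λ a b c d → (a :+ (b :+ c)) :+ d := (c :+ d) :+ (b :+ a)) refl (m n) A B (n * m n) ⟩
  (B + n * m n) + (A + m n)
    ≡⟨ cong₂ _+_ (sumTo-snoc N (λ v → suc v * m (suc v))) (sumTo-snoc N (λ v → m (suc v))) ⟨
  weight n m + size n m ∎
  where
  n = suc N
  A = sumTo N (λ v → m (suc v))
  B = sumTo N (λ v → suc v * m (suc v))
  open +-*-Solver
  open ≡-Reasoning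

size-count : ∀ k w → size k (λ v → count v w) + atMost 0 w ≡ atMost k w
size-count zero    w = refl
size-count (suc k) w = trans (cong (_+ atMost 0 w) (trans (sumTo-snoc k _) (+-comm _ (count (suc k) w))))
  (trans (+-assoc (count (suc k) w) _ _) (trans (cong (count (suc k) w +_) (size-count k w)) (sym (atMost-suc k w))))

contentOf : Filling → ℕ → ℕ
contentOf T v = count v (concat T)

size-content : ∀ {n Λ T} → SST n Λ T → size n (contentOf T) ≡ ∣_∣ Λ
size-content {n} {Λ} {T} t = trans (sym (trans (cong (size n (contentOf T) +_) (atMost-0 t)) (+-identityʳ _)))
  (trans (size-count n (concat T)) (atMost-all t))

module RotatingMap {n : ℕ} {Λ : YoungDiagram} (1≤n : 1 ≤ n) (coprime : gcd n (∣_∣ Λ) ≡ 1) (f : Filling → Filling)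
    (closed : ∀ {T} → SST n Λ T → SST n Λ (f T))
    (rotates : ∀ {T} → SST n Λ T → Rotates n (contentOf T) (contentOf (f T))) where

  iterate-weight : ∀ k {T} → SST n Λ T → ∃[ q ] weight n (contentOf ((f ^ k) T)) + n * q ≡ weight n (contentOf T) + k * ∣_∣ Λ
  iterate-weight zero    {T} t = 0 , cong (weight n (contentOf T) +_) (*-zeroʳ n)
  iterate-weight (suc k) {T} t with iterate-weight k t
  ... | q , e = contentOf U n + q , (begin
    weight n (contentOf (f U)) + n * (contentOf U n + q)
      ≡⟨ solve 4 (λ w n a q → w :+ n :* (a :+ q) := (w :+ n :* a) :+ n :* q) refl (weight n (contentOf (f U))) n (contentOf U n) q ⟩
    (weight n (contentOf (f U)) + n * contentOf U n) + n * q
      ≡⟨ cong (_+ n * q) (weight-rotates {m = contentOf U} {contentOf (f U)} 1≤n (rotates u)) ⟩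
    (weight n (contentOf U) + size n (contentOf U)) + n * q
      ≡⟨ cong (λ s → (weight n (contentOf U) + s) + n * q) (size-content u) ⟩
    (weight n (contentOf U) + ∣_∣ Λ) + n * q
      ≡⟨ solve 3 (λ w l x → (w :+ l) :+ x := (w :+ x) :+ l) refl (weight n (contentOf U)) (∣_∣ Λ) (n * q) ⟩
    (weight n (contentOf U) + n * q) + ∣_∣ Λ
      ≡⟨ cong (_+ ∣_∣ Λ) e ⟩
    (weight n (contentOf T) + k * ∣_∣ Λ) + ∣_∣ Λ
      ≡⟨ solve 3 (λ w x l → (w :+ x) :+ l := w :+ (l :+ x)) refl (weight n (contentOf T)) (k * ∣_∣ Λ) (∣_∣ Λ) ⟩
    weight n (contentOf T) + suc k * ∣_∣ Λ ∎)
    where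
    U = (f ^ k) T
    u = ^-closed (SST n Λ) closed k t
    open +-*-Solver
    open ≡-Reasoning

  -- Allowing two starting points covers both the periods of one tableau and the comparison of
  -- different members of an orbit of the `n`-th power of promotion, whose weights agree.
  same-weight : ∀ {a b T U} → SST n Λ T → SST n Λ U → weight n (contentOf T) ≡ weight n (contentOf U) →
    a ≤ b → (f ^ a) T ≡ (f ^ b) U → n ∣ b ∸ a
  same-weight {a} {b} {T} {U} t u w a≤b e with iterate-weight a t | iterate-weight b u
  ... | q , ea | q′ , eb = coprime-divisor (gcd≡1⇒coprime coprime) (subst (n ∣_) (*-comm (b ∸ a) (∣_∣ Λ))
      (∣m+n∣m⇒∣n (divides q′ (trans key (*-comm n q′))) (m∣m*n q)))
    where
    open ≡-Reasoning
    open +-*-Solver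
    X = weight n (contentOf ((f ^ a) T))
    W = weight n (contentOf T)
    L = ∣_∣ Λ
    key : n * q + (b ∸ a) * L ≡ n * q′
    key = +-cancelˡ-≡ X _ _ (begin
      X + (n * q + (b ∸ a) * L)    ≡⟨ +-assoc X (n * q) _ ⟨
      (X + n * q) + (b ∸ a) * L    ≡⟨ cong (_+ (b ∸ a) * L) ea ⟩
      (W + a * L) + (b ∸ a) * L    ≡⟨ solve 4 (λ w a d l → (w :+ a :* l) :+ d :* l := w :+ (a :+ d) :* l) refl W a (b ∸ a) L ⟩
      W + (a + (b ∸ a)) * L        ≡⟨ cong₂ (λ w k → w + k * L) w (m+[n∸m]≡n a≤b) ⟩
      weight n (contentOf U) + b * L ≡⟨ eb ⟨
      weight n (contentOf ((f ^ b) U)) + n * q′ ≡⟨ cong (λ T → weight n (contentOf T) + n * q′) e ⟨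
      X + n * q′                   ∎)

  period-∣ : ∀ {k T} → SST n Λ T → (f ^ k) T ≡ T → n ∣ k
  period-∣ t e = same-weight t t refl z≤n (sym e)

  iterate-content : ∀ {T} → SST n Λ T → ∀ v → 1 ≤ v → v ≤ n → contentOf ((f ^ n) T) v ≡ contentOf T v
  iterate-content {T} t = rotate-period (λ k → contentOf ((f ^ k) T)) (λ k → rotates (^-closed (SST n Λ) closed k t))

-- Reflections and contents of tableaux

contentOf-reading : ∀ T v → contentOf T v ≡ count v (reading T)
contentOf-reading T v = sym (count-↭ v (reading-↭ T))

s-involutive : ∀ i T → s i (s i T) ≡ T
s-involutive i T = reading-injective (trans (shape-s i (s i T)) (shape-s i T))
  (trans (reading-s i (s i T)) (trans (cong (sWord i) (reading-s i T)) (sWord-involutive i (reading T))))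

contentOf-s : ∀ i T v → contentOf (s i T) v ≡ count v (sWord i (reading T))
contentOf-s i T v = trans (contentOf-reading (s i T) v) (cong (count v) (reading-s i T))

contentOf-s-i : ∀ i T → contentOf (s i T) i ≡ contentOf T (suc i)
contentOf-s-i i T = trans (contentOf-s i T i) (trans (sWord-count-i i (reading T)) (sym (contentOf-reading T (suc i))))

contentOf-s-1+i : ∀ i T → contentOf (s i T) (suc i) ≡ contentOf T i
contentOf-s-1+i i T = trans (contentOf-s i T (suc i)) (trans (sWord-count-1+i i (reading T)) (sym (contentOf-reading T i)))

contentOf-s-other : ∀ i T {v} → v ≢ i → v ≢ suc i → contentOf (s i T) v ≡ contentOf T v
contentOf-s-other i T {v} p q = trans (contentOf-s i T v) (trans (sWord-count-other i p q (reading T)) (sym (contentOf-reading T v)))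

foldr-s-reading : ∀ is T → reading (foldr s T is) ≡ foldr sWord (reading T) is
foldr-s-reading []       T = refl
foldr-s-reading (i ∷ is) T = trans (reading-s i (foldr s T is)) (cong (sWord i) (foldr-s-reading is T))

foldr-s-shape : ∀ is T → map length (foldr s T is) ≡ map length T
foldr-s-shape []       T = refl
foldr-s-shape (i ∷ is) T = trans (shape-s i (foldr s T is)) (foldr-s-shape is T)

foldr-s-SST : ∀ {n Λ is T} → All (λ i → 1 ≤ i × i < n) is → SST n Λ T → SST n Λ (foldr s T is)
foldr-s-SST []                    t = t
foldr-s-SST ((1≤i , i<n) ∷ all) t = s-SST 1≤i i<n (foldr-s-SST all t)

c-SST : ∀ {n Λ T} → SST n Λ T → SST n Λ (c n T)
c-SST {zero}  t = t
c-SST {suc N} t = foldr-s-SST (All.applyUpTo⁺₁ suc N (λ i<N → s≤s z≤n , s≤s i<N)) t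

c-rotates : ∀ {n} → 1 ≤ n → ∀ T → Rotates n (contentOf T) (contentOf (c n T))
c-rotates {n} 1≤n T with cWord-rotates n 1≤n (reading T)
... | first , next = trans (content-c 1) (trans first (sym (contentOf-reading T n)))
  , λ v 1≤v v<n → trans (content-c (suc v)) (trans (next v 1≤v v<n) (sym (contentOf-reading T v)))
  where
  content-c : ∀ v → contentOf (c n T) v ≡ count v (cWord n (reading T))
  content-c v = trans (contentOf-reading (c n T) v) (cong (count v) (foldr-s-reading (applyUpTo suc (n ∸ 1)) T))

c^n : ∀ n → 1 ≤ n → ∀ T → (c n ^ n) T ≡ T
c^n n 1≤n T = reading-injective (shape n) (trans (iterate-reading n) (cWord^n n 1≤n (reading T)))
  where
  is = applyUpTo suc (n ∸ 1)
  shape : ∀ k → map length ((c n ^ k) T) ≡ map length T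
  shape zero    = refl
  shape (suc k) = trans (foldr-s-shape is ((c n ^ k) T)) (shape k)
  iterate-reading : ∀ k → reading ((c n ^ k) T) ≡ (cWord n ^ʷ k) (reading T)
  iterate-reading zero    = refl
  iterate-reading (suc k) = trans (foldr-s-reading is ((c n ^ k) T)) (cong (cWord n) (iterate-reading k))

tabulate-Linked : ∀ n (g : ℕ → ℕ) → (∀ v → suc v < n → g (suc v) ≤ g v) → Vec.Linked _≥_ (tabulate {n = n} (g ∘ toℕ))
tabulate-Linked zero          g h = Vec.[]
tabulate-Linked (suc zero)    g h = Vec.[-]
tabulate-Linked (suc (suc n)) g h = h 0 (s≤s (s≤s z≤n)) Vec.∷ tabulate-Linked (suc n) (g ∘ suc) (λ v v< → h (suc v) (s≤s v<))

sumTo-swap : ∀ {n} j {f g : ℕ → ℕ} → suc j < n → g j + g (suc j) < f j + f (suc j) →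
  (∀ v → v ≢ j → v ≢ suc j → g v ≡ f v) → sumTo n g < sumTo n f
sumTo-swap {suc (suc n)} zero {f} {g} _ h e = begin-strict
  g 0 + (g 1 + sumTo n (g ∘ suc ∘ suc))   ≡⟨ +-assoc (g 0) (g 1) _ ⟨
  g 0 + g 1 + sumTo n (g ∘ suc ∘ suc)     ≡⟨ cong (g 0 + g 1 +_) (sumTo-cong n (λ v → e (suc (suc v)) (λ ()) (λ ()))) ⟩
  g 0 + g 1 + sumTo n (f ∘ suc ∘ suc)     <⟨ +-monoˡ-< _ h ⟩
  f 0 + f 1 + sumTo n (f ∘ suc ∘ suc)     ≡⟨ +-assoc (f 0) (f 1) _ ⟩
  f 0 + (f 1 + sumTo n (f ∘ suc ∘ suc))   ∎
  where open ≤-Reasoning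
sumTo-swap {suc n} (suc j) {f} {g} (s≤s j<n) h e = begin-strict
  g 0 + sumTo n (g ∘ suc)   ≡⟨ cong (_+ sumTo n (g ∘ suc)) (e 0 (λ ()) (λ ())) ⟩
  f 0 + sumTo n (g ∘ suc)   <⟨ +-monoʳ-< (f 0) (sumTo-swap j j<n h (λ v p q → e (suc v) (p ∘ suc-injective) (q ∘ suc-injective))) ⟩
  f 0 + sumTo n (f ∘ suc)   ∎
  where open ≤-Reasoning

weight-s : ∀ {n} j T → suc j < n → contentOf T (suc j) < contentOf T (suc (suc j)) →
  weight n (contentOf (s (suc j) T)) < weight n (contentOf T)
weight-s {n} j T j<n a<b = sumTo-swap j j<n
  (subst₂ (λ x y → suc j * x + suc (suc j) * y < suc j * a + suc (suc j) * b)
    (sym (contentOf-s-i (suc j) T)) (sym (contentOf-s-1+i (suc j) T)) ineq)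
  (λ v p q → cong (suc v *_) (contentOf-s-other (suc j) T (p ∘ suc-injective) (q ∘ suc-injective)))
  where
  a = contentOf T (suc j)
  b = contentOf T (suc (suc j))
  open ≤-Reasoning
  open +-*-Solver
  ineq : suc j * b + suc (suc j) * a < suc j * a + suc (suc j) * b
  ineq = begin-strict
    suc j * b + suc (suc j) * a        ≡⟨ solve 3 (λ j a b → j :* b :+ (a :+ j :* a) := a :+ (j :* a :+ j :* b)) refl (suc j) a b ⟩
    a + (suc j * a + suc j * b)        <⟨ +-monoˡ-< _ a<b ⟩
    b + (suc j * a + suc j * b)        ≡⟨ solve 3 (λ j a b → b :+ (j :* a :+ j :* b) := j :* a :+ (b :+ j :* b)) refl (suc j) a b ⟩
    suc j * a + suc (suc j) * b        ∎

-- Induction on the weight: reflecting at an ascent of the content lowers it, and a content without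
-- ascents is weakly decreasing.
sort-content : ∀ {n Λ} (P : Filling → Set) →
  (∀ {T} → SST n Λ T → Vec.Linked _≥_ (content n T) → P T) →
  (∀ {i T} → 1 ≤ i → i < n → SST n Λ T → P (s i T) → P T) →
  ∀ {T} → SST n Λ T → P T
sort-content {n} {Λ} P base reflect t = go t (<-wellFounded _)
  where
  <∸1⇒ : ∀ {j} n → j < n ∸ 1 → suc j < n
  <∸1⇒ (suc n) h = s≤s h
  ⇒<∸1 : ∀ {j} n → suc j < n → j < n ∸ 1
  ⇒<∸1 (suc n) (s≤s h) = h
  go : ∀ {T} → SST n Λ T → Acc _<_ (weight n (contentOf T)) → P T
  go {T} t (acc rec) with anyUpTo? (λ j → contentOf T (suc j) <? contentOf T (suc (suc j))) (n ∸ 1)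
  ... | yes (j , j< , a<b) = reflect (s≤s z≤n) (<∸1⇒ n j<) t
          (go (s-SST (s≤s z≤n) (<∸1⇒ n j<) t) (rec (weight-s j T (<∸1⇒ n j<) a<b)))
  ... | no none = base t (tabulate-Linked n (contentOf T ∘ suc) (λ v v< → ≮⇒≥ (λ a<b → none (v , ⇒<∸1 n v< , a<b))))

-- Guarantees that there is a tableau at all: an exponent acting as the identity then has a fixed
-- point, to which `period-∣` applies.
superstandard : ∀ {n Λ} → ℓ Λ < n → SST n Λ (fromGrid (rows Λ) (λ r _ → suc r))
superstandard {n} {Λ} ℓ<n = fromGrid-SST record
  { inRange = λ {r} h → s≤s z≤n , <-trans (≰⇒> λ ℓ≤r → <⇒≱ h (≤-trans (≤-reflexive (rowLength-beyond (rows Λ) ℓ≤r)) z≤n)) ℓ<n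
  ; weak    = λ _ → ≤-refl
  ; strict  = λ _ → ≤-refl
  }

-- Orbits and orders

module CommutingRotations (n : ℕ) .{{_ : NonZero n}} (Λ : YoungDiagram) (coprime : gcd n (∣_∣ Λ) ≡ 1)
    (f : Filling → Filling)
    (f-SST : ∀ {T} → SST n Λ T → SST n Λ (f T))
    (f-rotates : ∀ {T} → SST n Λ T → Rotates n (contentOf T) (contentOf (f T)))
    (f-injective : ∀ {T U} → SST n Λ T → SST n Λ U → f T ≡ f U → T ≡ U) where

  private
    X : Pred Filling 0ℓ
    X = SST n Λ
    p : Filling → Filling
    p = f ^ n
    1≤n : 1 ≤ n
    1≤n = >-nonZero⁻¹ n
    module R  = RotatingMap {n} {Λ} 1≤n coprime f f-SST f-rotates
    module DR = FiniteDynamics f X (tableaux n Λ) ∈-tableaux⁺ f-SST f-injective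

    p-SST : ∀ {T} → X T → X (p T)
    p-SST = ^-closed X f-SST n

    module DP = FiniteDynamics p X (tableaux n Λ) ∈-tableaux⁺ p-SST (DR.^-injective n)

    p^-weight : ∀ k {T} → X T → weight n (contentOf ((p ^ k) T)) ≡ weight n (contentOf T)
    p^-weight zero    t = refl
    p^-weight (suc k) t = trans (sumTo-cong-< n (λ v v<n → cong (suc v *_)
      (R.iterate-content (^-closed X p-SST k t) (suc v) (s≤s z≤n) v<n))) (p^-weight k t)

    f^-multiple : ∀ k T → (f ^ (k * n)) T ≡ (p ^ k) T
    f^-multiple k T = sym (^-* f n k T)

    withContent : Vec ℕ n → List Filling
    withContent α = filter (λ T → Vec-≡-dec _≟_ (content n T) α) (tableaux n Λ)

  -- On the singleton of `T` the order is the period of `T`.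
  orderAt : ∀ {T} → X T → ∃[ r ] IsOrder p (_≡ T) r
  orderAt {T} t = DP.order (_≡ T) (T ∷ []) here (λ { (here e) → e }) (λ { refl → t })

  orderOn : ∀ α → ∃[ m ] IsOrder p (SSTα n Λ α) m
  orderOn α = DP.order (SSTα n Λ α) (withContent α)
    (λ (t , e) → ∈-filter⁺ (λ T → Vec-≡-dec _≟_ (content n T) α) (∈-tableaux⁺ t) e)
    (λ q → let q′ , e = ∈-filter⁻ (λ T → Vec-≡-dec _≟_ (content n T) α) {xs = tableaux n Λ} q in ∈-tableaux⁻ q′ , e)
    proj₁

  orderOnAll : ∃[ l ] IsOrder p X l
  orderOnAll = DP.order X (tableaux n Λ) ∈-tableaux⁺ ∈-tableaux⁻ id

  module Orbits (g : Filling → Filling) (g-SST : ∀ {T} → X T → X (g T))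
      (g-rotates : ∀ {T} → X T → Rotates n (contentOf T) (contentOf (g T)))
      (g^n : ∀ T → (g ^ n) T ≡ T)
      {T} (t : X T) {r} (r-order : IsOrder p (_≡ T) r) where
    𝒪f 𝒪g×p : Pred Filling 0ℓ
    𝒪f   U = ∃[ k ] U ≡ (f ^ k) T
    𝒪g×p U = ∃[ a ] ∃[ b ] U ≡ (g ^ a) ((f ^ (b * n)) T)

    private
      module C = RotatingMap {n} {Λ} 1≤n coprime g g-SST g-rotates

      g-injective : ∀ {T U} → X T → X U → g T ≡ g U → T ≡ U
      g-injective {T} {U} _ _ e = trans (sym (g^n T)) (trans (^-cong n) (g^n U))
        where
        shift : ∀ k T → (g ^ suc k) T ≡ (g ^ k) (g T)
        shift k T = trans (cong (λ k → (g ^ k) T) (+-comm 1 k)) (^-+ g k 1 T)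
        ^-cong : ∀ n .{{_ : NonZero n}} → (g ^ n) T ≡ (g ^ n) U
        ^-cong (suc k) = trans (shift k T) (trans (cong (g ^ k) e) (sym (shift k U)))

      module DC = FiniteDynamics g X (tableaux n Λ) ∈-tableaux⁺ g-SST g-injective

      open IsOrder r-order

      instance
        r≢0 : NonZero r
        r≢0 = >-nonZero positive
        rn≢0 : NonZero (r * n)
        rn≢0 = m*n≢0 r n

      r-∣ : ∀ {k} → (p ^ k) T ≡ T → r ∣ k
      r-∣ e = IsOrder-∣ r-order (λ { _ refl → e })

      ∣∧<⇒≡0 : ∀ {m k} → m ∣ k → k < m → k ≡ 0
      ∣∧<⇒≡0 {m} {zero}  _   _   = refl
      ∣∧<⇒≡0 {m} {suc k} m∣k k<m = ⊥-elim (<⇒≱ k<m (∣⇒≤ m∣k))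

      f-period : (f ^ (r * n)) T ≡ T
      f-period = trans (f^-multiple r T) (identity T refl)

    -- The weights make a period of `f` at `T` a multiple of `n`. The quotient is an exponent of `p`
    -- that fixes `T`, hence a multiple of `r`.
    f-orbit : HasCardinality (𝒪f) (r * n)
    f-orbit = xs , AllPairs.applyUpTo⁺₁ F (r * n) distinct , (λ U → mk⇔ to from) , length-applyUpTo F (r * n)
      where
      F : ℕ → Filling
      F k = (f ^ k) T
      xs = applyUpTo F (r * n)
      distinct : ∀ {i j} → i < j → j < r * n → F i ≢ F j
      distinct {i} {j} i<j j<m e with R.period-∣ t (DR.^-cancel t (<⇒≤ i<j) e)
      ... | divides q j∸i≡q*n = <⇒≢ (m<n⇒0<n∸m i<j) (sym (∣∧<⇒≡0 r*n∣ (≤-<-trans (m∸n≤m j i) j<m)))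
        where
        r*n∣ : r * n ∣ j ∸ i
        r*n∣ = subst (r * n ∣_) (sym j∸i≡q*n) (*-monoˡ-∣ n (r-∣ {q} (trans (sym (f^-multiple q T))
          (trans (cong (λ k → (f ^ k) T) (sym j∸i≡q*n)) (DR.^-cancel t (<⇒≤ i<j) e)))))
      to : ∀ {U} → U ∈ 𝒪f → U ∈ˡ xs
      to (k , refl) = subst (_∈ˡ xs) (sym (^-% f {r * n} f-period k)) (∈-applyUpTo⁺ F (m%n<n k (r * n)))
      from : ∀ {U} → U ∈ˡ xs → U ∈ 𝒪f
      from q with k , _ , e ← ∈-applyUpTo⁻ F q = k , e

    -- Powers of `p` keep the weight, so the weights determine the exponent of `g` modulo `n`. Once
    -- the powers of `g` agree they cancel, and the exponent of `p` is determined modulo `r`.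
    g×p-orbit : HasCardinality (𝒪g×p) (r * n)
    g×p-orbit = xs , AllPairs.applyUpTo⁺₁ F (r * n) distinct , (λ U → mk⇔ to from) , length-applyUpTo F (r * n)
      where
      G : ℕ → ℕ → Filling
      G a b = (g ^ a) ((f ^ (b * n)) T)
      -- A number below `r * n` encodes the exponents `a < n` and `b < r` as remainder and quotient
      -- by `n`.
      F : ℕ → Filling
      F k = G (k % n) (k / n)
      xs = applyUpTo F (r * n)

      row : ∀ b → X ((f ^ (b * n)) T)
      row b = ^-closed X f-SST (b * n) t

      row-weight : ∀ b → weight n (contentOf ((f ^ (b * n)) T)) ≡ weight n (contentOf T)
      row-weight b = trans (cong (λ U → weight n (contentOf U)) (f^-multiple b T)) (p^-weight b t)

      same-power : ∀ a a′ b b′ → a ≤ a′ → a′ < n → G a b ≡ G a′ b′ → a ≡ a′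
      same-power a a′ b b′ a≤a′ a′<n e = ≤-antisym a≤a′ (m∸n≡0⇒m≤n (∣∧<⇒≡0
        (C.same-weight (row b) (row b′) (trans (row-weight b) (sym (row-weight b′))) a≤a′ e)
        (≤-<-trans (m∸n≤m a′ a) a′<n)))

      G-injective : ∀ a a′ b b′ → a < n → a′ < n → b ≤ b′ → b′ < r → G a b ≡ G a′ b′ → a ≡ a′ × b ≡ b′
      G-injective a a′ b b′ a<n a′<n b≤b′ b′<r e = a≡a′ , ≤-antisym b≤b′ (m∸n≡0⇒m≤n (∣∧<⇒≡0
        (r-∣ (DP.^-cancel t b≤b′ (trans (sym (f^-multiple b T)) (trans
          (DC.^-injective a (row b) (row b′) (trans e (cong (λ a → G a b′) (sym a≡a′)))) (f^-multiple b′ T)))))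
        (≤-<-trans (m∸n≤m b′ b) b′<r)))
        where
        a≡a′ : a ≡ a′
        a≡a′ with ≤-total a a′
        ... | inj₁ a≤a′ = same-power a a′ b b′ a≤a′ a′<n e
        ... | inj₂ a′≤a = sym (same-power a′ a b′ b a′≤a a<n (sym e))

      distinct : ∀ {i j} → i < j → j < r * n → F i ≢ F j
      distinct {i} {j} i<j j<m e = <⇒≢ i<j (trans (m≡m%n+[m/n]*n i n)
        (trans (cong₂ (λ a b → a + b * n) (proj₁ ab) (proj₂ ab)) (sym (m≡m%n+[m/n]*n j n))))
        where
        ab = G-injective (i % n) (j % n) (i / n) (j / n) (m%n<n i n) (m%n<n j n)
               (/-monoˡ-≤ n (<⇒≤ i<j)) (m<n*o⇒m/o<n j<m) e

      to : ∀ {U} → U ∈ 𝒪g×p → U ∈ˡ xs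
      to (a , b , refl) = subst (_∈ˡ xs) reduce (∈-applyUpTo⁺ F k<)
        where
        a′ = a % n
        b′ = b % r
        k  = a′ + b′ * n
        k< : k < r * n
        k< = <-≤-trans (+-monoˡ-< (b′ * n) (m%n<n a n)) (*-monoˡ-≤ n (m%n<n b r))
        k%n : k % n ≡ a′
        k%n = trans ([m+kn]%n≡m%n a′ b′ n) (m%n%n≡m%n a n)
        k/n : k / n ≡ b′
        k/n = trans (+-distrib-/-∣ʳ a′ (divides b′ refl)) (cong₂ _+_ (m<n⇒m/n≡0 (m%n<n a n)) (m*n/n≡m b′ n))
        W = (f ^ (b * n)) T
        reduce : F k ≡ G a b
        reduce = trans (cong₂ G k%n k/n) (trans
          (cong (g ^ a′) (trans (f^-multiple b′ T) (trans (sym (^-% p {r} (identity T refl) b)) (sym (f^-multiple b T)))))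
          (sym (^-% g {n} (g^n W) a)))
      from : ∀ {U} → U ∈ˡ xs → U ∈ 𝒪g×p
      from q with k , _ , e ← ∈-applyUpTo⁻ F q = k % n , k / n , e

    sameCardinality : SameCardinality (𝒪f) (𝒪g×p)
    sameCardinality = r * n , f-orbit , g×p-orbit

  module Orders {𝔬 : Vec ℕ n → ℕ} (𝔬-order : ∀ α → IsOrder p (SSTα n Λ α) (𝔬 α))
      {l} (l-order : IsOrder p X l) (ℓ<n : ℓ Λ < n)
      (commutes : ∀ i → 1 ≤ i → i < n → ∀ T → X T → s i (p T) ≡ p (s i T)) where
    private
      p^-commutes : ∀ m {i T} → 1 ≤ i → i < n → X T → (p ^ m) (s i T) ≡ s i ((p ^ m) T)
      p^-commutes zero    _   _   t = refl
      p^-commutes (suc m) {i} 1≤i i<n t = trans (cong p (p^-commutes m 1≤i i<n t))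
        (sym (commutes i 1≤i i<n _ (^-closed X p-SST m t)))

    l-lcm : IsLCM (λ m → ∃[ α ] α ∈ cont⁺ n Λ × m ≡ 𝔬 α) l
    l-lcm = record
      { commonMultiple = λ { (α , _ , refl) → IsOrder-∣ (𝔬-order α) {l} (λ T (t , _) → IsOrder.identity l-order T t) }
      ; least          = λ {m} multiple → IsOrder-∣ l-order {m} (λ T t → sort-content (λ T → (p ^ m) T ≡ T)
          (λ {T} t dominant → fixes m (content n T) (multiple (content n T , ((T , t , refl) , dominant) , refl)) (t , refl))
          -- Conjugation by the involution `s i`, which commutes with `p ^ m`, carries the fixed
          -- point `s i T` back to `T`.
          (λ {i} {T} 1≤i i<n t e → trans (sym (s-involutive i _)) (trans (cong (s i) (trans (sym (p^-commutes m 1≤i i<n t)) e)) (s-involutive i T)))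
          t)
      }
      where
      fixes : ∀ m α {T} → 𝔬 α ∣ m → T ∈ SSTα n Λ α → (p ^ m) T ≡ T
      fixes m α {T} (divides q refl) tα = ^-periodic p (IsOrder.identity (𝔬-order α) T tα) q

    f-order : IsOrder f X (n * l)
    f-order = record
      { positive = *-mono-≤ 1≤n (IsOrder.positive l-order)
      ; identity = λ T t → trans (cong (λ k → (f ^ k) T) (*-comm n l)) (trans (f^-multiple l T) (IsOrder.identity l-order T t))
      ; least    = least
      }
      where
      least : ∀ k → 0 < k → IsIdentityOn X (f ^ k) → n * l ≤ k
      least k 0<k h with R.period-∣ {k} (superstandard ℓ<n) (h _ (superstandard ℓ<n))
      ... | divides zero    refl = ⊥-elim (<-irrefl refl 0<k)
      ... | divides (suc q) refl = ≤-trans (≤-reflexive (*-comm n l)) (*-monoˡ-≤ n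
        (IsOrder.least l-order (suc q) (s≤s z≤n) (λ T t → trans (sym (f^-multiple (suc q) T)) (h T t))))


theorem4p6 : (n : ℕ) → 2 ≤ n → (Λ : YoungDiagram) → ℓ Λ < n →
    gcd n (∣_∣ Λ) ≡ 1 →
    (∀ i → 1 ≤ i → i < n → ∀ T → T ∈ SST n Λ →
    s i ((pr n ^ n) T) ≡ (pr n ^ n) (s i T)) →
    (∀ T → T ∈ SST n Λ → SameCardinality (𝒪pr n T) (𝒪C×P n T))
    ×
    (Σ[ 𝔬 ∈ (Vec ℕ n → ℕ) ]
    ((α : Vec ℕ n) → α ∈ cont n Λ → IsOrder (pr n ^ n) (SSTα n Λ α) (𝔬 α)) ×
    (∃[ l ]
    IsLCM (λ m → ∃[ α ] α ∈ cont⁺ n Λ × m ≡ 𝔬 α) l ×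
    IsOrder (pr n) (SST n Λ) (n * l)))
theorem4p6 (suc N) 2≤n Λ ℓ<n coprime commutes =
  (λ T t → M.Orbits.sameCardinality (c n) c-SST (λ {T} _ → c-rotates 1≤n T) (c^n n 1≤n) t (proj₂ (M.orderAt t)))
  , 𝔬 , (λ α _ → 𝔬-order α) , l , O.l-lcm , O.f-order
  where
  n = suc N
  1≤n : 1 ≤ n
  1≤n = s≤s z≤n
  module P = Promotion N {Λ}
  module M = CommutingRotations n Λ coprime (pr n) P.pr-SST P.pr-rotates P.pr-injective
  -- Defined on all vectors. For one that is not a content, the restriction is to the empty set and
  -- the order is 1.
  𝔬 : Vec ℕ n → ℕ
  𝔬 α = proj₁ (M.orderOn α)
  𝔬-order : ∀ α → IsOrder (pr n ^ n) (SSTα n Λ α) (𝔬 α)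
  𝔬-order α = proj₂ (M.orderOn α)
  l = proj₁ M.orderOnAll
  module O = M.Orders {𝔬} 𝔬-order (proj₂ M.orderOnAll) ℓ<n commutes
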